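{- Define $m_4=21$, $m_5=19$, $m_6=16$, $m_7=14$, $m_8=12$, $m_9=11$, $m_{10}=10$, $m_{11}=9$. For every $b\in\{4,5,\dots,11\}$ and every $n\in\{2,3\}$, the maximum of $|\mathsf B(\mathcal G)|$ over all 3-graphs $\mathcal G$ with $|\mathcal G|=b$, $\nu(\mathcal G)=n$, $\tau(\mathcal G)=3$ and $\tau(\mathsf B(\mathcal G))=3$ is attained and equals $m_b$.
   Context: A 3-graph is a finite family (set) of 3-element sets, called its edges. The covering number $\tau(\mathcal H)$ is the minimum cardinality of a set meeting every member of $\mathcal H$. The matching number $\nu(\mathcal H)$ is the maximum number of pairwise disjoint edges of $\mathcal H$. The support of $\mathcal H$ is $V(\mathcal H)=\bigcup_{H\in\mathcal H}H$. For a 3-graph $\mathcal H$ with $\tau(\mathcal H)=3$, put $$\mathsf T_3(\mathcal H)=\{T\subseteq V(\mathcal H): |T|=3\text{ and }T\cap H\neq\varnothing\text{ for all }H\in\mathcal H\},$$ and define its external 3-blocker by $\mathsf B(\mathcal H)=\mathsf T_3(\mathcal H)\setminus\mathcal H$. -}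

module Defs where

import Data.Bool.Properties as Bool
open import Data.Fin.Subset
  using (Subset; inside; outside; Nonempty; Empty; _⊆_; _∩_; ⋃; ∣_∣)
open import Data.Fin.Subset.Properties using (nonempty?; _⊆?_)
open import Data.List using (List; []; _∷_; _++_; map; filter; length)
open import Data.List.Membership.Propositional using (_∈_; _∉_)
open import Data.List.Membership.Propositional.Properties
  using (∈-map⁺; ∈-map⁻; ∈-++⁺ˡ; ∈-++⁺ʳ; ∈-filter⁺; ∈-filter⁻)
import Data.List.Membership.DecPropositional as DecMembership
open import Data.List.Relation.Unary.All using (All; []; all?; tabulate)
open import Data.List.Relation.Unary.AllPairs using (AllPairs; []; _∷_)
open import Data.List.Relation.Unary.Any using (here)
open import Data.List.Relation.Unary.Unique.Propositional using (Unique)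
import Data.List.Relation.Unary.Unique.Propositional.Properties as Unique
open import Data.Nat using (ℕ; zero; suc; _≤_; _≟_)
open import Data.Product using (∃-syntax; _×_; _,_; proj₁; proj₂)
open import Data.Vec using ([]; _∷_)
open import Data.Vec.Properties using (≡-dec; ∷-injectiveʳ)
open import Function using (_⇔_; mk⇔)
open import Relation.Binary.PropositionalEquality using (_≡_; refl)
open import Relation.Nullary.Decidable using (_×-dec_)
open import Relation.Unary using (Decidable)

private
  variable
    N : ℕ

-- A 3-graph whose edges live in the finite ground set Fin N.  The ground set
-- may be larger than the support.  The edge list is duplicate-free, so it
-- represents a set of edges and its length is the number of edges.
record 3-Graph (N : ℕ) : Set where
  field
    edges   : List (Subset N)
    unique  : Unique edges
    uniform : All (λ E → ∣ E ∣ ≡ 3) edges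

open 3-Graph public

size : 3-Graph N → ℕ
size G = length (edges G)

support : 3-Graph N → Subset N
support G = ⋃ (edges G)

IsMinimum : (ℕ → Set) → ℕ → Set
IsMinimum P m = P m × (∀ k → P k → m ≤ k)

IsMaximum : (ℕ → Set) → ℕ → Set
IsMaximum P m = P m × (∀ k → P k → k ≤ m)

IsCover : 3-Graph N → Subset N → Set
IsCover G T = All (λ E → Nonempty (T ∩ E)) (edges G)

-- Edges of a 3-graph are nonempty, so pairwise disjointness already forces
-- the members of the list M to be pairwise distinct.
IsMatching : 3-Graph N → List (Subset N) → Set
IsMatching G M = All (_∈ edges G) M × AllPairs (λ E F → Empty (E ∩ F)) M

-- τ(G) = k
HasCoveringNumber : 3-Graph N → ℕ → Set
HasCoveringNumber G = IsMinimum (λ k → ∃[ T ] IsCover G T × ∣ T ∣ ≡ k)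

-- ν(G) = k
HasMatchingNumber : 3-Graph N → ℕ → Set
HasMatchingNumber G = IsMaximum (λ k → ∃[ M ] IsMatching G M × length M ≡ k)

subsets : ∀ N → List (Subset N)
subsets zero    = [] ∷ []
subsets (suc N) = map (outside ∷_) (subsets N) ++ map (inside ∷_) (subsets N)

subsets-unique : ∀ N → Unique (subsets N)
subsets-unique zero    = [] ∷ []
subsets-unique (suc N) =
  Unique.++⁺ (Unique.map⁺ ∷-injectiveʳ (subsets-unique N))
             (Unique.map⁺ ∷-injectiveʳ (subsets-unique N))
             λ (p , q) → disjoint (∈-map⁻ (outside ∷_) p) (∈-map⁻ (inside ∷_) q)
  where
  open import Data.Empty using (⊥)
  disjoint : ∀ {T : Subset (suc N)} →
             ∃[ S ] (S ∈ subsets N × T ≡ outside ∷ S) →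
             ∃[ S ] (S ∈ subsets N × T ≡ inside ∷ S) → ⊥
  disjoint (_ , _ , refl) (_ , _ , ())

∈-subsets : (T : Subset N) → T ∈ subsets N
∈-subsets []            = here refl
∈-subsets (outside ∷ T) = ∈-++⁺ˡ (∈-map⁺ (outside ∷_) (∈-subsets T))
∈-subsets {suc N} (inside ∷ T) =
  ∈-++⁺ʳ (map (outside ∷_) (subsets N)) (∈-map⁺ (inside ∷_) (∈-subsets T))

IsT₃ : 3-Graph N → Subset N → Set
IsT₃ G T = T ⊆ support G × ∣ T ∣ ≡ 3 × IsCover G T

isT₃? : (G : 3-Graph N) → Decidable (IsT₃ G)
isT₃? G T = (T ⊆? support G) ×-dec (∣ T ∣ ≟ 3)
  ×-dec all? (λ E → nonempty? (T ∩ E)) (edges G)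

T₃ : 3-Graph N → 3-Graph N
T₃ {N} G = record
  { edges   = filter (isT₃? G) (subsets N)
  ; unique  = Unique.filter⁺ (isT₃? G) (subsets-unique N)
  ; uniform = tabulate λ T∈ →
      proj₁ (proj₂ (proj₂ (∈-filter⁻ (isT₃? G) {xs = subsets N} T∈)))
  }

infixl 6 _∖_

_∖_ : 3-Graph N → 3-Graph N → 3-Graph N
_∖_ {N} G H = record
  { edges   = filter (_∉? edges H) (edges G)
  ; unique  = Unique.filter⁺ (_∉? edges H) (unique G)
  ; uniform = All-filter⁺ (_∉? edges H) (uniform G)
  }
  where
  open DecMembership (≡-dec {n = N} Bool._≟_) using (_∉?_)
  open import Data.List.Relation.Unary.All.Properties
    using () renaming (filter⁺ to All-filter⁺)

B : 3-Graph N → 3-Graph N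
B G = T₃ G ∖ G

∈-B : (G : 3-Graph N) (T : Subset N) →
      T ∈ edges (B G) ⇔ (IsT₃ G T × T ∉ edges G)
∈-B {N} G T = mk⇔
  (λ T∈B → let T∈T₃ , T∉G = ∈-filter⁻ (_∉? edges G) {xs = edges (T₃ G)} T∈B in
           proj₂ (∈-filter⁻ (isT₃? G) {xs = subsets N} T∈T₃) , T∉G)
  (λ (t , T∉G) →
    ∈-filter⁺ (_∉? edges G) (∈-filter⁺ (isT₃? G) (∈-subsets T) t) T∉G)
  where open DecMembership (≡-dec {n = N} Bool._≟_) using (_∉?_)

-- k is the size of B(G) for some admissible 3-graph G with b edges and
-- matching number n, on a ground set of any finite size.
IsBlockerSize : ℕ → ℕ → ℕ → Set
IsBlockerSize b n k =
  ∃[ N ] ∃[ G ]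
    size {N} G ≡ b × HasMatchingNumber G n × HasCoveringNumber G 3
      × HasCoveringNumber (B G) 3 × size (B G) ≡ k

-- Meaningful only for 4 ≤ b ≤ 11; the value 0 elsewhere is a dummy.
m : ℕ → ℕ
m 4  = 21
m 5  = 19
m 6  = 16
m 7  = 14
m 8  = 12
m 9  = 11
m 10 = 10
m 11 = 9
m _  = 0

{-# OPTIONS --safe #-}
module Submission where

-- Put F = B(G).  Then G and F are disjoint, cross-intersecting families of
-- triples, both of covering number 3.  Suppose that |G| ≥ b, that |F| > m b
-- and that G has two disjoint edges.  Starting from two disjoint edges, grow a
-- configuration of known edges of G on labelled vertices: as long as some pair
-- p meets all known edges, there is an edge of G avoiding p, and it meets the
-- labelled vertices in one of finitely many patterns, its other vertices being
-- new.  Every member of F contains one of the minimal partial covers of the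
-- known edges, and a partial cover with s elements lies in at most 3^(3-s)
-- members of F; this count rules out most patterns, and most others contain a
-- copy of a configuration that has already been refuted.  Once all partial
-- covers have three elements, G and F live on the labelled vertices, and a
-- finite search remains: a triple of F and a triple of G are neither disjoint
-- nor equal, so a matching in the conflict graph bounds |G| + |F|.

open import Defs
open import Data.Bool using (Bool; true; false; T; not; _∧_; _∨_; if_then_else_)
open import Data.Bool.ListAction using (all; any)
open import Data.List
  using (List; []; _∷_; _++_; map; length; filter; filterᵇ; foldr; concat; concatMap;
         take; upTo; applyUpTo)
open import Data.Maybe using (Maybe; just; nothing)
open import Data.Nat
  using (ℕ; zero; suc; _+_; _*_; _∸_; _^_; _/_; _%_; _⊓_; _≤_; _<_; z≤n; s≤s; z<s; s<s;
         s≤s⁻¹; _≡ᵇ_; _≤ᵇ_; _<ᵇ_; _≟_; _≤?_; _<?_)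
open import Data.Nat.ListAction using (sum)
open import Data.Product using (∃-syntax; _×_; _,_; proj₁; proj₂)
open import Function using (_∘_; id; const; Equivalence)


-- Certificates and their checker

-- The role of the pair `p`: as long as some pair meets all known edges, a partial cover may have
-- only one or two labels and its completions in `F` may use unlabelled vertices. Once no such pair
-- is left, every member of `F` is spelled out by labels. The factor 3 comes from the whole of `G`,
-- not from the known edges: a set with fewer than three vertices is avoided by some edge of `G`,
-- and a member of `F` containing the set must take one of the three vertices of that edge. One tree
-- of configurations serves all eight values of `b`. A branch ends only if every pair of bounds `b`
-- and `m b + 1` is impossible in it, so the weight alone cuts only below 10, the smallest
-- `m b + 1`; the final searches have to play the two sizes off against each other. Isomorphic
-- configurations are recognised without canonical forms: the certificate supplies the relabelling,
-- and only its injectivity and the images of the edges are checked. The target may have further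
-- labels and edges, so one refuted configuration disposes of all larger ones.

Labels : Set
Labels = List ℕ

_∈ᵇ_ : ℕ → Labels → Bool
i ∈ᵇ c = any (i ≡ᵇ_) c

meets : Labels → Labels → Bool
meets c e = any (_∈ᵇ e) c

_⊆ᵇ_ : Labels → Labels → Bool
c ⊆ᵇ e = all (_∈ᵇ e) c

sublists≤ : ℕ → Labels → List Labels
sublists≤ n       []       = [] ∷ []
sublists≤ zero    (x ∷ xs) = [] ∷ []
sublists≤ (suc n) (x ∷ xs) = map (x ∷_) (sublists≤ n xs) ++ sublists≤ (suc n) xs

hasLength : ℕ → Labels → Bool
hasLength n c = length c ≡ᵇ n

sublists : ℕ → Labels → List Labels
sublists n xs = filterᵇ (hasLength n) (sublists≤ n xs)

-- The pairs (b , d) for which |G| ≥ b and |F| ≥ d have to be refuted.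
demands : List (ℕ × ℕ)
demands = map (λ b → b , suc (m b)) (4 ∷ 5 ∷ 6 ∷ 7 ∷ 8 ∷ 9 ∷ 10 ∷ 11 ∷ [])

withinᵇ : ℕ → ℕ → ℕ → ℕ × ℕ → Bool
withinᵇ g f t (b , d) = (b ≤ᵇ g) ∧ (d ≤ᵇ f) ∧ (b + d ≤ᵇ t)

feasible : ℕ → ℕ → ℕ → Bool
feasible g f t = any (withinᵇ g f t) demands

-- Triples of labels and the search for two cross-intersecting families of them

data Triple : Set where
  triple : ℕ → ℕ → ℕ → Triple

labels : Triple → Labels
labels (triple a b c) = a ∷ b ∷ c ∷ []

fromLabels : Labels → Triple
fromLabels (a ∷ b ∷ c ∷ []) = triple a b c
fromLabels _                = triple 0 0 0

-- Sublists of `upTo k` are increasing, so every set of three labels has exactly one name in this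
-- list, and equality can be tested position by position.
triples : ℕ → List Triple
triples k = map fromLabels (sublists 3 (upTo k))

sameᵇ : Triple → Triple → Bool
sameᵇ (triple a b c) (triple d e f) = (a ≡ᵇ d) ∧ (b ≡ᵇ e) ∧ (c ≡ᵇ f)

-- A member of `F` and an edge of `G` share a vertex and are different. Agreement in some but not
-- all positions settles both; if no position agrees, the triples differ and the six crossed
-- comparisons decide whether they meet.
compatible : Triple → Triple → Bool
compatible (triple a b c) (triple d e f) with a ≡ᵇ d | b ≡ᵇ e | c ≡ᵇ f
... | true  | true  | r     = not r
... | true  | false | _     = true
... | false | true  | _     = true
... | false | false | true  = true
... | false | false | false =
  (a ≡ᵇ e) ∨ (a ≡ᵇ f) ∨ (b ≡ᵇ d) ∨ (b ≡ᵇ f) ∨ (c ≡ᵇ d) ∨ (c ≡ᵇ e)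

countᵇ : (Triple → Bool) → List Triple → ℕ
countᵇ p []       = 0
countᵇ p (c ∷ cs) with p c
... | true  = suc (countᵇ p cs)
... | false = countᵇ p cs

-- Removes the first triple in conflict with c, so that total counts the
-- vertices of the conflict graph minus the edges of a greedy matching.
strike : Triple → List Triple → List Triple
strike c []       = []
strike c (e ∷ es) with compatible c e
... | true  = e ∷ strike c es
... | false = es

total : List Triple → List Triple → ℕ
total []       es = length es
total (c ∷ cs) es = suc (total cs (strike c es))

-- The least |F| that meets a demand together with |G| ≤ g; the default 100
-- exceeds every demand.
requiredF : ℕ → ℕ
requiredF g = foldr (λ (b , d) n → if b ≤ᵇ g then d ⊓ n else n) 100 demands

requiredG : ℕ → ℕ
requiredG f = foldr (λ (b , d) n → if d ≤ᵇ f then b ⊓ n else n) 100 demands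

-- An edge of `G` is compatible with all of `F`, so a candidate with fewer compatible partners than
-- `F` must have members cannot be an edge. The threshold is passed to `go` as an argument so that
-- all tests can share one value.
pruneG : List Triple → List Triple → List Triple
pruneG cs es = go (requiredF (length es))
  where
  go : ℕ → List Triple
  go r = filterᵇ (λ e → r ≤ᵇ countᵇ (λ c → compatible c e) cs) es

pruneF : List Triple → List Triple → List Triple
pruneF cs es = go (requiredG (length cs))
  where
  go : ℕ → List Triple
  go r = filterᵇ (λ c → r ≤ᵇ countᵇ (compatible c) es) cs

-- Putting the candidate with the most conflicts into `F` removes the most candidates for `G`;
-- afterwards it has no conflict left and does not win the comparison again. The initial
-- `triple 0 0 0` survives only if there is no conflict at all, and since `decide` is sound for
-- every triple, this default does no harm.
hardest : List Triple → List Triple → Triple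
hardest cs es = go cs (triple 0 0 0) 0
  where
  go : List Triple → Triple → ℕ → Triple
  go []       t n = t
  go (c ∷ cs) t n with countᵇ (not ∘ compatible c) es
  ... | n′ with n <ᵇ n′
  ...   | true  = go cs c n′
  ...   | false = go cs t n

contains : ℕ → Triple → Bool
contains i (triple a b c) = (i ≡ᵇ a) ∨ (i ≡ᵇ b) ∨ (i ≡ᵇ c)

-- Two labels that meet every candidate for `F` would give a cover of `F` with at most two vertices,
-- against `τ(F) = 3`. This is how the covering number enters the search.
isCover : List Triple → ℕ → ℕ → Bool
isCover cs i j = all (λ c → contains i c ∨ contains j c) cs

module _ (k : ℕ) where

  -- The first argument bounds the depth of the search, cs lists the candidates
  -- for F and es those for G.
  refuteG : ℕ → List Triple → List Triple → Bool
  refuteF : ℕ → List Triple → List Triple → Bool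
  search  : ℕ → List Triple → List Triple → Bool
  decide  : ℕ → Triple → List Triple → List Triple → Bool

  refuteF n cs es = search n cs (pruneG cs es)
  refuteG n cs es = search n (pruneF cs es) es

  search zero    cs es = false
  search (suc n) cs es =
    (length cs <ᵇ requiredF (length es))
    ∨ not (feasible (length es) (length cs) (total cs es))
    -- The inner list stops below `i`, so each unordered pair of labels is tested once.
    ∨ any (λ i → any (isCover cs i) (upTo i)) (upTo k)
    ∨ decide n (hardest cs es) cs es

  decide n t cs es =
    refuteG n cs (filterᵇ (compatible t) es)
    ∧ refuteF n (filterᵇ (not ∘ sameᵇ t) cs) es

-- Disjoint from an edge, a partial cover of size 3 is a triple outside F.
extensions : Labels → Labels → List Labels
extensions e c = if 3 ≤ᵇ length c then [] else map (_∷ c) e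

-- Testing in one direction keeps the partial covers an antichain. A new one is `i ∷ c` with `i` in
-- the edge and `c` disjoint from it. An old cover containing it would contain `c`; another new one
-- `j ∷ c′` containing it would force `i` and `j` to agree and `c` to lie in `c′`. Both contradict
-- the antichain before the step. The antichain only sharpens the weight: for soundness it is enough
-- that each member of `F` contains some listed set.
insert : Labels → List Labels → List Labels
insert c cs = if any (_⊆ᵇ c) cs then cs else c ∷ cs

refine : Labels → List Labels → List Labels
refine e cs =
  foldr insert (filterᵇ (λ c → meets c e) cs)
    (concatMap (extensions e) (filterᵇ (λ c → not (meets c e)) cs))

covers : List Labels → List Labels
covers = foldr refine ([] ∷ [])

-- Members of F are not edges of G.
live : List Labels → List Labels → List Labels
live es cs = filterᵇ (λ c → not (hasLength 3 c ∧ any (c ⊆ᵇ_) es)) cs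

weight : List Labels → ℕ
weight cs = sum (map (λ c → 3 ^ (3 ∸ length c)) cs)

-- Up to naming its new vertices, an edge that avoids `p` is determined by the old labels on it. New
-- vertices get the next free labels `k`, `k + 1` and so on. The reasons of a `branch` follow the
-- order of this list.
patterns : ℕ → Labels → List (ℕ × Labels)
patterns k p =
  map (λ s → k + (3 ∸ length s) , s ++ applyUpTo (k +_) (3 ∸ length s))
      (sublists≤ 3 (filterᵇ (λ i → not (i ∈ᵇ p)) (upTo k)))

-- A number of labels, and known edges of G on these labels.
State : Set
State = ℕ × List Labels

-- Labels are hexadecimal digits, the least significant one first: 0x210 is the
-- triple 0 ∷ 1 ∷ 2 ∷ [].
digits : ℕ → ℕ → Labels
digits zero    n = []
digits (suc k) n = n % 16 ∷ digits k (n / 16)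

at : {A : Set} → A → List A → ℕ → A
at d []       i       = d
at d (x ∷ xs) zero    = x
at d (x ∷ xs) (suc i) = at d xs i

-- i via x: the i-th known state embeds, its label j going to the j-th digit of x.
infix 6 _via_

data Reason : Set where
  _via_  : ℕ → ℕ → Reason
  closed : Reason

-- close lists edges whose addition gives a state containing a known one.  The
-- reasons in a branch are for those patterns that the weight does not exclude.
data Method : Set where
  close  : List (ℕ × ℕ × ℕ) → Method
  branch : ℕ → List Reason → Method

nth : List State → ℕ → Maybe State
nth []       i       = nothing
nth (x ∷ xs) zero    = just x
nth (x ∷ xs) (suc i) = nth xs i

sameSet : Labels → Labels → Bool
sameSet c e = (c ⊆ᵇ e) ∧ (e ⊆ᵇ c)

injectiveᵇ : ℕ → (ℕ → ℕ) → Bool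
injectiveᵇ k ψ =
  all (λ i → all (λ j → not (ψ i ≡ᵇ ψ j) ∨ (i ≡ᵇ j)) (upTo k)) (upTo k)

-- A labelling that realises the second state, composed with `ψ`, realises the first, so a
-- refutation passes from the first to the second. Edges are compared as sets because relabelling
-- destroys their order.
embeds : State → State → (ℕ → ℕ) → Bool
embeds (k , es) (k′ , es′) ψ =
  all (λ i → ψ i <ᵇ k′) (upTo k)
  ∧ injectiveᵇ k ψ
  ∧ all (λ e → any (sameSet (map ψ e)) es′) es

bounded : State → Bool
bounded (k , es) = all (all (_<ᵇ k)) es

-- As the certificate is common to all `b`, a bound on `F` refutes a pattern only if it lies below
-- every `d` in `demands`, that is, below `suc (m 11)`.
enough : ℕ → Bool
enough f = any (λ (_ , d) → d ≤ᵇ f) demands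

excluded : List (ℕ × ℕ × ℕ) → Triple → Bool
excluded ex t = any (λ (e , _) → sameᵇ t (fromLabels (digits 3 e))) ex

-- When all partial covers have three labels, these are the covers themselves; drawing them from
-- `triples k` makes them increasing and free of repetitions.
candidatesF : ℕ → List Labels → List Triple
candidatesF k cs = filterᵇ (λ t → any (_⊆ᵇ labels t) cs) (triples k)

candidatesG : ℕ → List (ℕ × ℕ × ℕ) → List Triple
candidatesG k ex = filterᵇ (not ∘ excluded ex) (triples k)

module _ (known : List State) where

  checkEmbedding : State → ℕ → ℕ → Bool
  checkEmbedding s i x with nth known i
  ... | nothing       = false
  ... | just (k , es) = embeds (k , es) s (at 0 (digits k x))

  -- Partial covers with three labels leave nothing to add, so `F` consists of some of them, and
  -- then `G` cannot leave the labels either. The list `ex` keeps the remaining search small: an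
  -- edge whose addition produces a refuted configuration is no candidate for `G`.
  checkClosed : State → List (ℕ × ℕ × ℕ) → List Labels → Bool
  checkClosed (k , es) ex cs =
    all (λ (e , i , x) → checkEmbedding (k , digits 3 e ∷ es) i x) ex
    ∧ all (hasLength 3) cs
    -- The number 50 is fuel for termination; a search that used it up would return `false`.
    ∧ refuteF k 50 (candidatesF k cs) (candidatesG k ex)

  checkReason : State → List Labels → Reason → Bool
  checkReason s cs (i via x) = checkEmbedding s i x
  checkReason s cs closed    = checkClosed s [] cs

  checkBranch  : List Labels → List Labels → List (ℕ × Labels) → List Reason → Bool
  checkPattern : List Labels → List Labels → ℕ → Labels → List Labels →
                 List (ℕ × Labels) → List Reason → Bool

  checkBranch es cs []              rs = true
  checkBranch es cs ((k , e) ∷ ps) rs =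
    -- By definition `refine e (covers es)` is `covers (e ∷ es)`, so the partial covers of the old
    -- edges are passed on and shared by all patterns.
    bounded (k , e ∷ es) ∧ checkPattern es cs k e (live (e ∷ es) (refine e cs)) ps rs

  checkPattern es cs k e ds ps rs with enough (weight ds)
  ... | false = checkBranch es cs ps rs
  ... | true with rs
  ...   | []      = false
  ...   | r ∷ rs′ = checkReason (k , e ∷ es) ds r ∧ checkBranch es cs ps rs′

  checkMethod : State → Method → Bool
  checkMethod (k , es) (close ex)    =
    bounded (k , es) ∧ checkClosed (k , es) ex (live es (covers es))
  checkMethod (k , es) (branch p rs) =
    bounded (k , es) ∧ checkBranch es (covers es) (patterns k (digits 2 p)) rs

Lemma : Set
Lemma = ℕ × List ℕ × Method

state : Lemma → State
state (k , es , _) = k , map (digits 3) es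

-- States are appended at the end, so a lemma is cited by its position, and only by later ones.
checkAll : List State → List Lemma → Bool
checkAll known []                  = true
checkAll known (ℓ@(_ , _ , μ) ∷ ls) =
  checkMethod known (state ℓ) μ ∧ checkAll (known ++ state ℓ ∷ []) ls

-- The certificate

-- Every state contains the disjoint edges `0x543` and `0x210`, and comes after the states to which
-- its extensions are reduced. Entries 0 to 64 are settled by `close`, the last of them being three
-- disjoint edges; the others branch. Entry 216, the last, consists of the two disjoint edges alone.
lemmas : List Lemma
lemmas =
  (9 , (0x632 ∷ 0x840 ∷ 0x761 ∷ 0x543 ∷ 0x210 ∷ []) , close []) ∷
  (7 , (0x631 ∷ 0x640 ∷ 0x320 ∷ 0x621 ∷ 0x543 ∷ 0x210 ∷ []) , close []) ∷
  (9 , (0x320 ∷ 0x841 ∷ 0x740 ∷ 0x631 ∷ 0x543 ∷ 0x210 ∷ []) , close []) ∷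
  (7 , (0x541 ∷ 0x650 ∷ 0x420 ∷ 0x631 ∷ 0x543 ∷ 0x210 ∷ []) , close []) ∷
  (7 , (0x530 ∷ 0x421 ∷ 0x640 ∷ 0x631 ∷ 0x543 ∷ 0x210 ∷ []) , close []) ∷
  (7 , (0x630 ∷ 0x641 ∷ 0x640 ∷ 0x631 ∷ 0x543 ∷ 0x210 ∷ []) , close []) ∷
  (9 , (0x630 ∷ 0x840 ∷ 0x761 ∷ 0x543 ∷ 0x210 ∷ []) , close []) ∷
  (8 , (0x730 ∷ 0x640 ∷ 0x761 ∷ 0x543 ∷ 0x210 ∷ []) , close []) ∷
  (7 , (0x652 ∷ 0x640 ∷ 0x631 ∷ 0x543 ∷ 0x210 ∷ []) , close []) ∷
  (8 , (0x653 ∷ 0x430 ∷ 0x540 ∷ 0x761 ∷ 0x543 ∷ 0x210 ∷ []) , close []) ∷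
  (8 , (0x530 ∷ 0x421 ∷ 0x740 ∷ 0x631 ∷ 0x543 ∷ 0x210 ∷ []) , close []) ∷
  (8 , (0x630 ∷ 0x421 ∷ 0x740 ∷ 0x631 ∷ 0x543 ∷ 0x210 ∷ []) , close []) ∷
  (7 , (0x541 ∷ 0x530 ∷ 0x420 ∷ 0x631 ∷ 0x543 ∷ 0x210 ∷ []) , close []) ∷
  (7 , (0x310 ∷ 0x642 ∷ 0x641 ∷ 0x320 ∷ 0x621 ∷ 0x543 ∷ 0x210 ∷ []) , close []) ∷
  (9 , (0x653 ∷ 0x840 ∷ 0x761 ∷ 0x543 ∷ 0x210 ∷ []) , close []) ∷
  (8 , (0x732 ∷ 0x640 ∷ 0x761 ∷ 0x543 ∷ 0x210 ∷ []) , close []) ∷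
  (7 , (0x640 ∷ 0x610 ∷ 0x320 ∷ 0x621 ∷ 0x543 ∷ 0x210 ∷ []) , close []) ∷
  (7 , (0x531 ∷ 0x640 ∷ 0x320 ∷ 0x621 ∷ 0x543 ∷ 0x210 ∷ []) , close []) ∷
  (7 , (0x651 ∷ 0x640 ∷ 0x320 ∷ 0x621 ∷ 0x543 ∷ 0x210 ∷ []) , close []) ∷
  (8 , (0x741 ∷ 0x320 ∷ 0x420 ∷ 0x631 ∷ 0x543 ∷ 0x210 ∷ []) , close []) ∷
  (7 , (0x421 ∷ 0x650 ∷ 0x420 ∷ 0x631 ∷ 0x543 ∷ 0x210 ∷ []) , close []) ∷
  (8 , (0x630 ∷ 0x540 ∷ 0x761 ∷ 0x543 ∷ 0x210 ∷ []) , close []) ∷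
  (8 , (0x630 ∷ 0x640 ∷ 0x761 ∷ 0x543 ∷ 0x210 ∷ []) , close []) ∷
  (7 , (0x641 ∷ 0x530 ∷ 0x420 ∷ 0x631 ∷ 0x543 ∷ 0x210 ∷ []) , close []) ∷
  (7 , (0x530 ∷ 0x654 ∷ 0x641 ∷ 0x320 ∷ 0x621 ∷ 0x543 ∷ 0x210 ∷ []) , close []) ∷
  (8 , (0x630 ∷ 0x420 ∷ 0x761 ∷ 0x543 ∷ 0x210 ∷ []) , close
    ((0x310 , 22 , 0x20761543) ∷ (0x510 , 7 , 0x53761240) ∷ (0x710 , 21 , 0x53716240) ∷
    (0x730 , 22 , 0x20167543) ∷ (0x540 , 21 , 0x76543210) ∷ (0x640 , 22 , 0x76534210) ∷
    (0x740 , 7 , 0x76534210) ∷ (0x650 , 22 , 0x76435210) ∷ (0x321 , 7 , 0x20761543) ∷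
    (0x521 , 15 , 0x20761543) ∷ (0x731 , 21 , 0x20716543) ∷ (0x642 , 7 , 0x20534716) ∷
    (0x742 , 15 , 0x76534210) ∷ (0x752 , 15 , 0x76435210) ∷ (0x654 , 21 , 0x20543716) ∷ [])) ∷
  (8 , (0x632 ∷ 0x540 ∷ 0x761 ∷ 0x543 ∷ 0x210 ∷ []) , close
    ((0x310 , 21 , 0x71540263) ∷ (0x420 , 25 , 0x76543012) ∷ (0x520 , 25 , 0x76453012) ∷
    (0x630 , 21 , 0x76543210) ∷ (0x640 , 7 , 0x20543716) ∷ (0x740 , 15 , 0x67543210) ∷
    (0x650 , 7 , 0x20453716) ∷ (0x750 , 15 , 0x67453210) ∷ (0x421 , 22 , 0x32504761) ∷
    (0x521 , 22 , 0x32405761) ∷ (0x431 , 7 , 0x32504761) ∷ (0x531 , 7 , 0x32405761) ∷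
    (0x541 , 21 , 0x32540761) ∷ (0x741 , 25 , 0x32540761) ∷ (0x751 , 25 , 0x32450761) ∷
    (0x432 , 25 , 0x71540362) ∷ (0x532 , 25 , 0x71450362) ∷ (0x542 , 21 , 0x76543012) ∷
    (0x642 , 22 , 0x76534012) ∷ (0x652 , 22 , 0x76435012) ∷ (0x743 , 15 , 0x32504761) ∷
    (0x753 , 15 , 0x32405761) ∷ (0x654 , 21 , 0x02543716) ∷ (0x764 , 25 , 0x02543716) ∷
    (0x765 , 25 , 0x02453716) ∷ [])) ∷
  (7 , (0x640 ∷ 0x630 ∷ 0x621 ∷ 0x543 ∷ 0x210 ∷ []) , close []) ∷
  (7 , (0x654 ∷ 0x610 ∷ 0x320 ∷ 0x621 ∷ 0x543 ∷ 0x210 ∷ []) , close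
    ((0x410 , 17 , 0x2534160) ∷ (0x510 , 17 , 0x2435160) ∷ (0x420 , 27 , 0x0543612) ∷
    (0x520 , 27 , 0x0453612) ∷ (0x640 , 16 , 0x6543210) ∷ (0x650 , 16 , 0x6453210) ∷
    (0x421 , 17 , 0x0534162) ∷ (0x521 , 17 , 0x0435162) ∷ (0x541 , 27 , 0x1302546) ∷
    (0x642 , 16 , 0x6543012) ∷ (0x652 , 16 , 0x6453012) ∷ [])) ∷
  (7 , (0x541 ∷ 0x320 ∷ 0x420 ∷ 0x631 ∷ 0x543 ∷ 0x210 ∷ []) , close
    ((0x510 , 12 , 0x6541230) ∷ (0x610 , 23 , 0x5631240) ∷ (0x520 , 27 , 0x5613204) ∷
    (0x530 , 12 , 0x6543210) ∷ (0x630 , 23 , 0x6210534) ∷ (0x640 , 4 , 0x6534201) ∷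
    (0x650 , 3 , 0x6543210) ∷ (0x521 , 12 , 0x6541032) ∷ (0x621 , 23 , 0x5631042) ∷
    (0x532 , 12 , 0x6543012) ∷ (0x632 , 23 , 0x6012534) ∷ (0x642 , 4 , 0x6534021) ∷
    (0x652 , 3 , 0x6543012) ∷ [])) ∷
  (7 , (0x650 ∷ 0x430 ∷ 0x621 ∷ 0x543 ∷ 0x210 ∷ []) , close []) ∷
  (8 , (0x653 ∷ 0x420 ∷ 0x761 ∷ 0x543 ∷ 0x210 ∷ []) , close
    ((0x310 , 25 , 0x20761543) ∷ (0x510 , 25 , 0x20761345) ∷ (0x630 , 25 , 0x76543210) ∷
    (0x730 , 25 , 0x67543210) ∷ (0x640 , 21 , 0x20534716) ∷ (0x740 , 26 , 0x20534716) ∷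
    (0x650 , 25 , 0x76345210) ∷ (0x750 , 25 , 0x67345210) ∷ (0x321 , 25 , 0x02761543) ∷
    (0x521 , 25 , 0x02761345) ∷ (0x431 , 21 , 0x53204761) ∷ (0x541 , 21 , 0x35204761) ∷
    (0x641 , 30 , 0x6120534) ∷ (0x632 , 25 , 0x76543012) ∷ (0x732 , 25 , 0x67543012) ∷
    (0x642 , 21 , 0x02534716) ∷ (0x742 , 26 , 0x02534716) ∷ (0x652 , 25 , 0x76345012) ∷
    (0x752 , 25 , 0x67345012) ∷ (0x743 , 26 , 0x53204761) ∷ (0x754 , 26 , 0x35204761) ∷ [])) ∷
  (9 , (0x732 ∷ 0x860 ∷ 0x761 ∷ 0x543 ∷ 0x210 ∷ []) , close []) ∷
  (9 , (0x730 ∷ 0x860 ∷ 0x761 ∷ 0x543 ∷ 0x210 ∷ []) , close []) ∷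
  (9 , (0x720 ∷ 0x860 ∷ 0x761 ∷ 0x543 ∷ 0x210 ∷ []) , close []) ∷
  (9 , (0x432 ∷ 0x860 ∷ 0x761 ∷ 0x543 ∷ 0x210 ∷ []) , close []) ∷
  (9 , (0x320 ∷ 0x860 ∷ 0x761 ∷ 0x543 ∷ 0x210 ∷ []) , close []) ∷
  (9 , (0x860 ∷ 0x761 ∷ 0x543 ∷ 0x210 ∷ []) , close
    ((0x320 , 36 , 0x876543210) ∷ (0x420 , 36 , 0x876534210) ∷ (0x520 , 36 , 0x876435210) ∷
    (0x720 , 34 , 0x876543210) ∷ (0x730 , 33 , 0x876543210) ∷ (0x830 , 36 , 0x271543860) ∷
    (0x740 , 33 , 0x876534210) ∷ (0x840 , 36 , 0x271534860) ∷ (0x750 , 33 , 0x876435210) ∷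
    (0x850 , 36 , 0x271435860) ∷ (0x870 , 34 , 0x271543860) ∷ (0x321 , 36 , 0x786543201) ∷
    (0x421 , 36 , 0x786534201) ∷ (0x521 , 36 , 0x786435201) ∷ (0x821 , 34 , 0x786543201) ∷
    (0x731 , 36 , 0x280543761) ∷ (0x831 , 33 , 0x786543201) ∷ (0x741 , 36 , 0x280534761) ∷
    (0x841 , 33 , 0x786534201) ∷ (0x751 , 36 , 0x280435761) ∷ (0x851 , 33 , 0x786435201) ∷
    (0x871 , 34 , 0x280543761) ∷ (0x432 , 35 , 0x876543210) ∷ (0x532 , 35 , 0x876453210) ∷
    (0x632 , 33 , 0x820543716) ∷ (0x732 , 32 , 0x876543210) ∷ (0x832 , 32 , 0x786543201) ∷
    (0x542 , 35 , 0x876354210) ∷ (0x642 , 33 , 0x820534716) ∷ (0x742 , 32 , 0x876534210) ∷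
    (0x842 , 32 , 0x786534201) ∷ (0x652 , 33 , 0x820435716) ∷ (0x752 , 32 , 0x876435210) ∷
    (0x852 , 32 , 0x786435201) ∷ (0x762 , 34 , 0x820543716) ∷ (0x862 , 34 , 0x721543806) ∷
    (0x743 , 35 , 0x280543761) ∷ (0x843 , 35 , 0x271543860) ∷ (0x753 , 35 , 0x280453761) ∷
    (0x853 , 35 , 0x271453860) ∷ (0x763 , 36 , 0x820543716) ∷ (0x863 , 36 , 0x721543806) ∷
    (0x873 , 32 , 0x280543761) ∷ (0x754 , 35 , 0x280354761) ∷ (0x854 , 35 , 0x271354860) ∷
    (0x764 , 36 , 0x820534716) ∷ (0x864 , 36 , 0x721534806) ∷ (0x874 , 32 , 0x280534761) ∷
    (0x765 , 36 , 0x820435716) ∷ (0x865 , 36 , 0x721435806) ∷ (0x875 , 32 , 0x280435761) ∷ [])) ∷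
  (7 , (0x310 ∷ 0x610 ∷ 0x620 ∷ 0x621 ∷ 0x543 ∷ 0x210 ∷ []) , close
    ((0x410 , 27 , 0x0543621) ∷ (0x510 , 27 , 0x0453621) ∷ (0x420 , 16 , 0x1534260) ∷
    (0x520 , 16 , 0x1435260) ∷ (0x540 , 30 , 0x1354620) ∷ (0x640 , 16 , 0x6543120) ∷
    (0x650 , 16 , 0x6453120) ∷ (0x421 , 16 , 0x0534261) ∷ (0x521 , 16 , 0x0435261) ∷
    (0x541 , 30 , 0x0354621) ∷ (0x641 , 16 , 0x6543021) ∷ (0x651 , 16 , 0x6453021) ∷
    (0x542 , 28 , 0x2543160) ∷ (0x654 , 28 , 0x6543120) ∷ [])) ∷
  (7 , (0x610 ∷ 0x620 ∷ 0x621 ∷ 0x543 ∷ 0x210 ∷ []) , close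
    ((0x310 , 38 , 0x6543210) ∷ (0x410 , 38 , 0x6534210) ∷ (0x510 , 38 , 0x6435210) ∷
    (0x320 , 38 , 0x6543120) ∷ (0x420 , 38 , 0x6534120) ∷ (0x520 , 38 , 0x6435120) ∷
    (0x630 , 38 , 0x1543260) ∷ (0x640 , 38 , 0x1534260) ∷ (0x650 , 38 , 0x1435260) ∷
    (0x321 , 38 , 0x6543021) ∷ (0x421 , 38 , 0x6534021) ∷ (0x521 , 38 , 0x6435021) ∷
    (0x631 , 38 , 0x0543261) ∷ (0x641 , 38 , 0x0534261) ∷ (0x651 , 38 , 0x0435261) ∷
    (0x632 , 38 , 0x0543162) ∷ (0x642 , 38 , 0x0534162) ∷ (0x652 , 38 , 0x0435162) ∷ [])) ∷
  (8 , (0x730 ∷ 0x620 ∷ 0x761 ∷ 0x543 ∷ 0x210 ∷ []) , close []) ∷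
  (8 , (0x310 ∷ 0x620 ∷ 0x761 ∷ 0x543 ∷ 0x210 ∷ []) , close
    ((0x410 , 22 , 0x20534761) ∷ (0x510 , 22 , 0x20435761) ∷ (0x420 , 25 , 0x71543260) ∷
    (0x520 , 25 , 0x71453260) ∷ (0x720 , 40 , 0x17543260) ∷ (0x730 , 40 , 0x76543210) ∷
    (0x540 , 21 , 0x71543260) ∷ (0x740 , 7 , 0x71534260) ∷ (0x750 , 7 , 0x71435260) ∷
    (0x421 , 7 , 0x20534761) ∷ (0x521 , 7 , 0x20435761) ∷ (0x721 , 40 , 0x02543761) ∷
    (0x541 , 21 , 0x20543761) ∷ (0x741 , 25 , 0x20543761) ∷ (0x751 , 25 , 0x20453761) ∷
    (0x542 , 26 , 0x71543062) ∷ (0x742 , 15 , 0x20534761) ∷ (0x752 , 15 , 0x20435761) ∷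
    (0x754 , 26 , 0x20543167) ∷ [])) ∷
  (8 , (0x631 ∷ 0x620 ∷ 0x761 ∷ 0x543 ∷ 0x210 ∷ []) , close
    ((0x310 , 41 , 0x76543210) ∷ (0x410 , 41 , 0x76534210) ∷ (0x510 , 41 , 0x76435210) ∷
    (0x710 , 41 , 0x20543761) ∷ (0x630 , 41 , 0x71543260) ∷ (0x640 , 41 , 0x71534260) ∷
    (0x740 , 40 , 0x76534210) ∷ (0x650 , 41 , 0x71435260) ∷ (0x750 , 40 , 0x76435210) ∷
    (0x760 , 41 , 0x20543716) ∷ (0x321 , 41 , 0x76543012) ∷ (0x421 , 41 , 0x76534012) ∷
    (0x521 , 41 , 0x76435012) ∷ (0x721 , 41 , 0x02543761) ∷ (0x541 , 30 , 0x6354201) ∷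
    (0x641 , 27 , 0x6543201) ∷ (0x741 , 21 , 0x53206741) ∷ (0x651 , 27 , 0x6453201) ∷
    (0x751 , 21 , 0x43206751) ∷ (0x632 , 41 , 0x71543062) ∷ (0x642 , 41 , 0x71534062) ∷
    (0x742 , 40 , 0x76534012) ∷ (0x652 , 41 , 0x71435062) ∷ (0x752 , 40 , 0x76435012) ∷
    (0x762 , 41 , 0x02543716) ∷ (0x743 , 27 , 0x6437201) ∷ (0x753 , 27 , 0x6537201) ∷
    (0x654 , 30 , 0x1354206) ∷ (0x764 , 21 , 0x53201746) ∷ (0x765 , 21 , 0x43201756) ∷ [])) ∷
  (8 , (0x743 ∷ 0x620 ∷ 0x761 ∷ 0x543 ∷ 0x210 ∷ []) , close
    ((0x310 , 41 , 0x76543210) ∷ (0x410 , 41 , 0x76534210) ∷ (0x510 , 26 , 0x20435167) ∷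
    (0x520 , 31 , 0x67453210) ∷ (0x630 , 41 , 0x71543260) ∷ (0x730 , 40 , 0x76543210) ∷
    (0x640 , 41 , 0x71534260) ∷ (0x740 , 40 , 0x76534210) ∷ (0x650 , 26 , 0x20435617) ∷
    (0x321 , 41 , 0x76543012) ∷ (0x421 , 41 , 0x76534012) ∷ (0x521 , 26 , 0x02435167) ∷
    (0x431 , 30 , 0x6743201) ∷ (0x531 , 21 , 0x47206531) ∷ (0x631 , 27 , 0x6437201) ∷
    (0x541 , 21 , 0x37206541) ∷ (0x641 , 27 , 0x6347201) ∷ (0x651 , 42 , 0x76435210) ∷
    (0x632 , 41 , 0x71543062) ∷ (0x732 , 40 , 0x76543012) ∷ (0x642 , 41 , 0x71534062) ∷
    (0x742 , 40 , 0x76534012) ∷ (0x652 , 26 , 0x02435617) ∷ (0x643 , 30 , 0x1743206) ∷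
    (0x653 , 21 , 0x47201536) ∷ (0x654 , 21 , 0x37201546) ∷ [])) ∷
  (8 , (0x430 ∷ 0x620 ∷ 0x761 ∷ 0x543 ∷ 0x210 ∷ []) , close
    ((0x310 , 41 , 0x76543210) ∷ (0x410 , 41 , 0x76534210) ∷ (0x510 , 21 , 0x71435260) ∷
    (0x630 , 41 , 0x71543260) ∷ (0x730 , 40 , 0x76543210) ∷ (0x640 , 41 , 0x71534260) ∷
    (0x740 , 40 , 0x76534210) ∷ (0x650 , 21 , 0x76435210) ∷ (0x750 , 21 , 0x67435210) ∷
    (0x321 , 41 , 0x76543012) ∷ (0x421 , 41 , 0x76534012) ∷ (0x521 , 26 , 0x71435260) ∷
    (0x721 , 43 , 0x02543761) ∷ (0x631 , 42 , 0x76543210) ∷ (0x641 , 42 , 0x76534210) ∷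
    (0x651 , 42 , 0x76435210) ∷ (0x751 , 31 , 0x20453761) ∷ (0x432 , 27 , 0x2761430) ∷
    (0x532 , 22 , 0x52716430) ∷ (0x632 , 41 , 0x71543062) ∷ (0x732 , 40 , 0x76543012) ∷
    (0x542 , 22 , 0x52716340) ∷ (0x642 , 41 , 0x71534062) ∷ (0x742 , 40 , 0x76534012) ∷
    (0x652 , 26 , 0x76435210) ∷ (0x752 , 26 , 0x67435210) ∷ (0x762 , 43 , 0x02543716) ∷
    (0x743 , 43 , 0x76543210) ∷ (0x753 , 43 , 0x76453210) ∷ (0x754 , 43 , 0x76354210) ∷
    (0x765 , 31 , 0x20453716) ∷ [])) ∷
  (8 , (0x431 ∷ 0x620 ∷ 0x761 ∷ 0x543 ∷ 0x210 ∷ []) , close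
    ((0x310 , 41 , 0x76543210) ∷ (0x410 , 41 , 0x76534210) ∷ (0x510 , 21 , 0x20435761) ∷
    (0x710 , 44 , 0x20543761) ∷ (0x520 , 31 , 0x71453260) ∷ (0x720 , 43 , 0x17543260) ∷
    (0x430 , 44 , 0x76543210) ∷ (0x530 , 44 , 0x76453210) ∷ (0x630 , 41 , 0x71543260) ∷
    (0x730 , 40 , 0x76543210) ∷ (0x540 , 44 , 0x76354210) ∷ (0x640 , 41 , 0x71534260) ∷
    (0x740 , 40 , 0x76534210) ∷ (0x650 , 41 , 0x71435260) ∷ (0x750 , 26 , 0x20435761) ∷
    (0x321 , 41 , 0x76543012) ∷ (0x421 , 41 , 0x76534012) ∷ (0x521 , 21 , 0x02435761) ∷
    (0x721 , 44 , 0x02543761) ∷ (0x631 , 42 , 0x76543210) ∷ (0x641 , 42 , 0x76534210) ∷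
    (0x651 , 30 , 0x6543201) ∷ (0x432 , 44 , 0x76543012) ∷ (0x532 , 44 , 0x76453012) ∷
    (0x632 , 41 , 0x71543062) ∷ (0x732 , 40 , 0x76543012) ∷ (0x542 , 44 , 0x76354012) ∷
    (0x642 , 41 , 0x71534062) ∷ (0x742 , 40 , 0x76534012) ∷ (0x652 , 41 , 0x71435062) ∷
    (0x752 , 26 , 0x02435761) ∷ (0x743 , 30 , 0x6743201) ∷ (0x753 , 21 , 0x57206431) ∷
    (0x754 , 21 , 0x57206341) ∷ (0x765 , 31 , 0x76210453) ∷ [])) ∷
  (8 , (0x731 ∷ 0x620 ∷ 0x761 ∷ 0x543 ∷ 0x210 ∷ []) , close
    ((0x310 , 41 , 0x76543210) ∷ (0x410 , 25 , 0x20534761) ∷ (0x510 , 25 , 0x20435761) ∷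
    (0x420 , 31 , 0x54260731) ∷ (0x520 , 31 , 0x45260731) ∷ (0x720 , 42 , 0x67543210) ∷
    (0x430 , 44 , 0x76543210) ∷ (0x530 , 44 , 0x76453210) ∷ (0x630 , 41 , 0x71543260) ∷
    (0x730 , 40 , 0x76543210) ∷ (0x540 , 31 , 0x20534761) ∷ (0x640 , 41 , 0x71534260) ∷
    (0x740 , 25 , 0x20534167) ∷ (0x650 , 41 , 0x71435260) ∷ (0x750 , 25 , 0x20435167) ∷
    (0x760 , 41 , 0x20543617) ∷ (0x321 , 41 , 0x76543012) ∷ (0x421 , 25 , 0x02534761) ∷
    (0x521 , 25 , 0x02435761) ∷ (0x431 , 45 , 0x76543210) ∷ (0x531 , 45 , 0x76453210) ∷
    (0x631 , 42 , 0x76543210) ∷ (0x541 , 45 , 0x76354210) ∷ (0x641 , 21 , 0x54206731) ∷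
    (0x741 , 44 , 0x54620731) ∷ (0x651 , 21 , 0x45206731) ∷ (0x751 , 44 , 0x45620731) ∷
    (0x432 , 44 , 0x76543012) ∷ (0x532 , 44 , 0x76453012) ∷ (0x632 , 41 , 0x71543062) ∷
    (0x732 , 40 , 0x76543012) ∷ (0x542 , 31 , 0x02534761) ∷ (0x642 , 41 , 0x71534062) ∷
    (0x742 , 25 , 0x02534167) ∷ (0x652 , 41 , 0x71435062) ∷ (0x752 , 25 , 0x02435167) ∷
    (0x762 , 41 , 0x02543617) ∷ (0x643 , 45 , 0x71543260) ∷ (0x743 , 43 , 0x76543210) ∷
    (0x653 , 45 , 0x71453260) ∷ (0x753 , 43 , 0x76453210) ∷ (0x654 , 31 , 0x73564210) ∷
    (0x754 , 43 , 0x76354210) ∷ (0x764 , 26 , 0x54206731) ∷ (0x765 , 26 , 0x45206731) ∷ [])) ∷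
  (8 , (0x610 ∷ 0x620 ∷ 0x761 ∷ 0x543 ∷ 0x210 ∷ []) , close
    ((0x310 , 41 , 0x76543210) ∷ (0x410 , 41 , 0x76534210) ∷ (0x510 , 41 , 0x76435210) ∷
    (0x430 , 44 , 0x76543210) ∷ (0x530 , 44 , 0x76453210) ∷ (0x630 , 41 , 0x71543260) ∷
    (0x730 , 40 , 0x76543210) ∷ (0x540 , 44 , 0x76354210) ∷ (0x640 , 41 , 0x71534260) ∷
    (0x740 , 40 , 0x76534210) ∷ (0x650 , 41 , 0x71435260) ∷ (0x750 , 40 , 0x76435210) ∷
    (0x321 , 41 , 0x76543012) ∷ (0x421 , 41 , 0x76534012) ∷ (0x521 , 41 , 0x76435012) ∷
    (0x621 , 39 , 0x6543210) ∷ (0x431 , 45 , 0x76543210) ∷ (0x531 , 45 , 0x76453210) ∷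
    (0x631 , 42 , 0x76543210) ∷ (0x731 , 46 , 0x76543210) ∷ (0x541 , 45 , 0x76354210) ∷
    (0x641 , 42 , 0x76534210) ∷ (0x741 , 46 , 0x76534210) ∷ (0x651 , 42 , 0x76435210) ∷
    (0x751 , 46 , 0x76435210) ∷ (0x432 , 44 , 0x76543012) ∷ (0x532 , 44 , 0x76453012) ∷
    (0x632 , 41 , 0x71543062) ∷ (0x732 , 40 , 0x76543012) ∷ (0x542 , 44 , 0x76354012) ∷
    (0x642 , 41 , 0x71534062) ∷ (0x742 , 40 , 0x76534012) ∷ (0x652 , 41 , 0x71435062) ∷
    (0x752 , 40 , 0x76435012) ∷ (0x643 , 45 , 0x71543260) ∷ (0x743 , 43 , 0x76543210) ∷
    (0x653 , 45 , 0x71453260) ∷ (0x753 , 43 , 0x76453210) ∷ (0x763 , 46 , 0x71543260) ∷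
    (0x654 , 45 , 0x71354260) ∷ (0x754 , 43 , 0x76354210) ∷ (0x764 , 46 , 0x71534260) ∷
    (0x765 , 46 , 0x71435260) ∷ [])) ∷
  (8 , (0x620 ∷ 0x761 ∷ 0x543 ∷ 0x210 ∷ []) , close
    ((0x310 , 41 , 0x76543210) ∷ (0x410 , 41 , 0x76534210) ∷ (0x510 , 41 , 0x76435210) ∷
    (0x610 , 47 , 0x76543210) ∷ (0x430 , 44 , 0x76543210) ∷ (0x530 , 44 , 0x76453210) ∷
    (0x630 , 41 , 0x71543260) ∷ (0x730 , 40 , 0x76543210) ∷ (0x540 , 44 , 0x76354210) ∷
    (0x640 , 41 , 0x71534260) ∷ (0x740 , 40 , 0x76534210) ∷ (0x650 , 41 , 0x71435260) ∷
    (0x750 , 40 , 0x76435210) ∷ (0x321 , 41 , 0x76543012) ∷ (0x421 , 41 , 0x76534012) ∷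
    (0x521 , 41 , 0x76435012) ∷ (0x621 , 47 , 0x76543012) ∷ (0x431 , 45 , 0x76543210) ∷
    (0x531 , 45 , 0x76453210) ∷ (0x631 , 42 , 0x76543210) ∷ (0x731 , 46 , 0x76543210) ∷
    (0x541 , 45 , 0x76354210) ∷ (0x641 , 42 , 0x76534210) ∷ (0x741 , 46 , 0x76534210) ∷
    (0x651 , 42 , 0x76435210) ∷ (0x751 , 46 , 0x76435210) ∷ (0x432 , 44 , 0x76543012) ∷
    (0x532 , 44 , 0x76453012) ∷ (0x632 , 41 , 0x71543062) ∷ (0x732 , 40 , 0x76543012) ∷
    (0x542 , 44 , 0x76354012) ∷ (0x642 , 41 , 0x71534062) ∷ (0x742 , 40 , 0x76534012) ∷
    (0x652 , 41 , 0x71435062) ∷ (0x752 , 40 , 0x76435012) ∷ (0x643 , 45 , 0x71543260) ∷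
    (0x743 , 43 , 0x76543210) ∷ (0x653 , 45 , 0x71453260) ∷ (0x753 , 43 , 0x76453210) ∷
    (0x763 , 46 , 0x71543260) ∷ (0x654 , 45 , 0x71354260) ∷ (0x754 , 43 , 0x76354210) ∷
    (0x764 , 46 , 0x71534260) ∷ (0x765 , 46 , 0x71435260) ∷ [])) ∷
  (9 , (0x740 ∷ 0x630 ∷ 0x876 ∷ 0x543 ∷ 0x210 ∷ []) , close []) ∷
  (9 , (0x540 ∷ 0x630 ∷ 0x876 ∷ 0x543 ∷ 0x210 ∷ []) , close []) ∷
  (9 , (0x741 ∷ 0x630 ∷ 0x876 ∷ 0x543 ∷ 0x210 ∷ []) , close []) ∷
  (9 , (0x730 ∷ 0x630 ∷ 0x876 ∷ 0x543 ∷ 0x210 ∷ []) , close []) ∷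
  (9 , (0x421 ∷ 0x630 ∷ 0x876 ∷ 0x543 ∷ 0x210 ∷ []) , close []) ∷
  (9 , (0x410 ∷ 0x630 ∷ 0x876 ∷ 0x543 ∷ 0x210 ∷ []) , close []) ∷
  (9 , (0x630 ∷ 0x876 ∷ 0x543 ∷ 0x210 ∷ []) , close
    ((0x410 , 54 , 0x876543210) ∷ (0x510 , 54 , 0x876453210) ∷ (0x710 , 54 , 0x543876210) ∷
    (0x810 , 54 , 0x543786210) ∷ (0x420 , 54 , 0x876543120) ∷ (0x520 , 54 , 0x876453120) ∷
    (0x720 , 54 , 0x543876120) ∷ (0x820 , 54 , 0x543786120) ∷ (0x730 , 52 , 0x876543210) ∷
    (0x830 , 52 , 0x786543210) ∷ (0x540 , 50 , 0x876543210) ∷ (0x640 , 52 , 0x543876210) ∷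
    (0x740 , 49 , 0x876543210) ∷ (0x840 , 49 , 0x786543210) ∷ (0x650 , 52 , 0x453876210) ∷
    (0x750 , 49 , 0x876453210) ∷ (0x850 , 49 , 0x786453210) ∷ (0x870 , 50 , 0x543876210) ∷
    (0x321 , 50 , 0x876210543) ∷ (0x421 , 53 , 0x876543210) ∷ (0x521 , 53 , 0x876453210) ∷
    (0x621 , 50 , 0x543210876) ∷ (0x721 , 53 , 0x543876210) ∷ (0x821 , 53 , 0x543786210) ∷
    (0x431 , 54 , 0x876210543) ∷ (0x531 , 54 , 0x876210453) ∷ (0x631 , 52 , 0x210876543) ∷
    (0x731 , 49 , 0x876210543) ∷ (0x831 , 49 , 0x786210543) ∷ (0x541 , 53 , 0x876210543) ∷
    (0x641 , 49 , 0x543210876) ∷ (0x741 , 51 , 0x876543210) ∷ (0x841 , 51 , 0x786543210) ∷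
    (0x651 , 49 , 0x453210876) ∷ (0x751 , 51 , 0x876453210) ∷ (0x851 , 51 , 0x786453210) ∷
    (0x761 , 54 , 0x543210876) ∷ (0x861 , 54 , 0x543210786) ∷ (0x871 , 53 , 0x543210876) ∷
    (0x432 , 54 , 0x876120543) ∷ (0x532 , 54 , 0x876120453) ∷ (0x632 , 52 , 0x120876543) ∷
    (0x732 , 49 , 0x876120543) ∷ (0x832 , 49 , 0x786120543) ∷ (0x542 , 53 , 0x876120543) ∷
    (0x642 , 49 , 0x543120876) ∷ (0x742 , 51 , 0x876543120) ∷ (0x842 , 51 , 0x786543120) ∷
    (0x652 , 49 , 0x453120876) ∷ (0x752 , 51 , 0x876453120) ∷ (0x852 , 51 , 0x786453120) ∷
    (0x762 , 54 , 0x543120876) ∷ (0x862 , 54 , 0x543120786) ∷ (0x872 , 53 , 0x543120876) ∷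
    (0x743 , 54 , 0x210876543) ∷ (0x843 , 54 , 0x210786543) ∷ (0x753 , 54 , 0x210876453) ∷
    (0x853 , 54 , 0x210786453) ∷ (0x873 , 50 , 0x210876543) ∷ (0x654 , 50 , 0x210543876) ∷
    (0x754 , 53 , 0x210876543) ∷ (0x854 , 53 , 0x210786543) ∷ (0x764 , 54 , 0x210543876) ∷
    (0x864 , 54 , 0x210543786) ∷ (0x874 , 53 , 0x210543876) ∷ (0x765 , 54 , 0x210453876) ∷
    (0x865 , 54 , 0x210453786) ∷ (0x875 , 53 , 0x210453876) ∷ [])) ∷
  (9 , (0x320 ∷ 0x310 ∷ 0x876 ∷ 0x543 ∷ 0x210 ∷ []) , close []) ∷
  (9 , (0x620 ∷ 0x310 ∷ 0x876 ∷ 0x543 ∷ 0x210 ∷ []) , close []) ∷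
  (9 , (0x542 ∷ 0x310 ∷ 0x876 ∷ 0x543 ∷ 0x210 ∷ []) , close []) ∷
  (9 , (0x762 ∷ 0x310 ∷ 0x876 ∷ 0x543 ∷ 0x210 ∷ []) , close []) ∷
  (9 , (0x764 ∷ 0x310 ∷ 0x876 ∷ 0x543 ∷ 0x210 ∷ []) , close
    ((0x410 , 45 , 0x53876140) ∷ (0x510 , 43 , 0x45876130) ∷ (0x810 , 31 , 0x54786130) ∷
    (0x320 , 56 , 0x876543210) ∷ (0x420 , 37 , 0x120876543) ∷ (0x520 , 35 , 0x120876453) ∷
    (0x620 , 57 , 0x876543210) ∷ (0x720 , 57 , 0x867543210) ∷ (0x820 , 14 , 0x254786130) ∷
    (0x530 , 59 , 0x876210453) ∷ (0x630 , 54 , 0x210543876) ∷ (0x730 , 54 , 0x210543867) ∷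
    (0x830 , 53 , 0x210543768) ∷ (0x540 , 44 , 0x10876534) ∷ (0x640 , 54 , 0x876534210) ∷
    (0x740 , 54 , 0x867534210) ∷ (0x650 , 54 , 0x876435210) ∷ (0x750 , 54 , 0x867435210) ∷
    (0x850 , 26 , 0x10768534) ∷ (0x860 , 57 , 0x210534876) ∷ (0x870 , 57 , 0x210534867) ∷
    (0x321 , 56 , 0x876543201) ∷ (0x421 , 37 , 0x021876543) ∷ (0x521 , 35 , 0x021876453) ∷
    (0x621 , 57 , 0x876543201) ∷ (0x721 , 57 , 0x867543201) ∷ (0x821 , 14 , 0x254786031) ∷
    (0x531 , 59 , 0x876201453) ∷ (0x631 , 54 , 0x201543876) ∷ (0x731 , 54 , 0x201543867) ∷
    (0x831 , 53 , 0x201543768) ∷ (0x541 , 44 , 0x01876534) ∷ (0x641 , 54 , 0x876534201) ∷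
    (0x741 , 54 , 0x867534201) ∷ (0x651 , 54 , 0x876435201) ∷ (0x751 , 54 , 0x867435201) ∷
    (0x851 , 26 , 0x01768534) ∷ (0x861 , 57 , 0x201534876) ∷ (0x871 , 57 , 0x201534867) ∷
    (0x432 , 43 , 0x43876120) ∷ (0x532 , 46 , 0x52764130) ∷ (0x542 , 58 , 0x876543210) ∷
    (0x642 , 53 , 0x876534102) ∷ (0x742 , 53 , 0x867534102) ∷ (0x652 , 26 , 0x76102543) ∷
    (0x752 , 26 , 0x67102543) ∷ (0x762 , 31 , 0x54726130) ∷ (0x862 , 14 , 0x582130764) ∷
    (0x872 , 14 , 0x582130674) ∷ (0x843 , 43 , 0x34210786) ∷ (0x653 , 44 , 0x76210543) ∷
    (0x753 , 44 , 0x67210543) ∷ (0x853 , 58 , 0x210768453) ∷ (0x763 , 45 , 0x54210736) ∷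
    (0x863 , 37 , 0x876210543) ∷ (0x873 , 37 , 0x867210543) ∷ (0x654 , 59 , 0x210876354) ∷
    (0x754 , 59 , 0x210867354) ∷ (0x854 , 46 , 0x58103746) ∷ (0x864 , 56 , 0x210534876) ∷
    (0x874 , 56 , 0x210534867) ∷ (0x765 , 43 , 0x35210746) ∷ (0x865 , 35 , 0x786210354) ∷
    (0x875 , 35 , 0x687210354) ∷ [])) ∷
  (9 , (0x760 ∷ 0x310 ∷ 0x876 ∷ 0x543 ∷ 0x210 ∷ []) , close
    ((0x410 , 44 , 0x54876130) ∷ (0x510 , 44 , 0x45876130) ∷ (0x810 , 46 , 0x18543706) ∷
    (0x320 , 56 , 0x876543210) ∷ (0x420 , 37 , 0x120876543) ∷ (0x520 , 37 , 0x120876453) ∷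
    (0x620 , 57 , 0x876543210) ∷ (0x720 , 57 , 0x867543210) ∷ (0x820 , 48 , 0x20543786) ∷
    (0x630 , 55 , 0x876543210) ∷ (0x730 , 55 , 0x867543210) ∷ (0x830 , 50 , 0x543768210) ∷
    (0x540 , 45 , 0x13876504) ∷ (0x640 , 54 , 0x876534210) ∷ (0x740 , 54 , 0x867534210) ∷
    (0x840 , 21 , 0x54768130) ∷ (0x650 , 54 , 0x876435210) ∷ (0x750 , 54 , 0x867435210) ∷
    (0x850 , 21 , 0x45768130) ∷ (0x860 , 56 , 0x543210876) ∷ (0x870 , 56 , 0x543210867) ∷
    (0x321 , 56 , 0x876543201) ∷ (0x421 , 35 , 0x254876031) ∷ (0x521 , 35 , 0x245876031) ∷
    (0x621 , 41 , 0x76543201) ∷ (0x721 , 41 , 0x67543201) ∷ (0x821 , 53 , 0x543281760) ∷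
    (0x431 , 60 , 0x876201543) ∷ (0x531 , 60 , 0x876201453) ∷ (0x631 , 54 , 0x543201876) ∷
    (0x731 , 54 , 0x543201867) ∷ (0x831 , 53 , 0x543201768) ∷ (0x541 , 43 , 0x01876534) ∷
    (0x641 , 54 , 0x876534201) ∷ (0x741 , 54 , 0x867534201) ∷ (0x841 , 26 , 0x54768130) ∷
    (0x651 , 54 , 0x876435201) ∷ (0x751 , 54 , 0x867435201) ∷ (0x851 , 26 , 0x45768130) ∷
    (0x761 , 42 , 0x21543706) ∷ (0x861 , 37 , 0x786543210) ∷ (0x871 , 37 , 0x687543210) ∷
    (0x432 , 44 , 0x43876120) ∷ (0x532 , 44 , 0x53876120) ∷ (0x632 , 50 , 0x876102543) ∷
    (0x732 , 50 , 0x867102543) ∷ (0x542 , 58 , 0x876543210) ∷ (0x642 , 53 , 0x876534102) ∷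
    (0x742 , 53 , 0x867534102) ∷ (0x652 , 53 , 0x876435102) ∷ (0x752 , 53 , 0x867435102) ∷
    (0x762 , 46 , 0x12543706) ∷ (0x862 , 36 , 0x786543120) ∷ (0x872 , 36 , 0x687543120) ∷
    (0x843 , 59 , 0x543210876) ∷ (0x853 , 59 , 0x453210876) ∷ (0x863 , 57 , 0x543210876) ∷
    (0x873 , 57 , 0x543210867) ∷ (0x654 , 59 , 0x210876354) ∷ (0x754 , 59 , 0x210867354) ∷
    (0x854 , 31 , 0x10786534) ∷ (0x764 , 60 , 0x876543210) ∷ (0x864 , 57 , 0x534210876) ∷
    (0x874 , 57 , 0x534210867) ∷ (0x765 , 60 , 0x876453210) ∷ (0x865 , 57 , 0x435210876) ∷
    (0x875 , 57 , 0x435210867) ∷ [])) ∷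
  (9 , (0x763 ∷ 0x310 ∷ 0x876 ∷ 0x543 ∷ 0x210 ∷ []) , close
    ((0x410 , 45 , 0x54876130) ∷ (0x510 , 45 , 0x45876130) ∷ (0x610 , 61 , 0x210543876) ∷
    (0x710 , 61 , 0x210543867) ∷ (0x810 , 59 , 0x210543876) ∷ (0x320 , 56 , 0x876543210) ∷
    (0x420 , 37 , 0x120876543) ∷ (0x520 , 37 , 0x120876453) ∷ (0x620 , 57 , 0x876543210) ∷
    (0x720 , 57 , 0x867543210) ∷ (0x820 , 57 , 0x768543210) ∷ (0x430 , 61 , 0x876210543) ∷
    (0x530 , 61 , 0x876210453) ∷ (0x630 , 55 , 0x876543210) ∷ (0x730 , 55 , 0x867543210) ∷
    (0x830 , 50 , 0x210768543) ∷ (0x540 , 45 , 0x10876534) ∷ (0x640 , 54 , 0x876534210) ∷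
    (0x740 , 54 , 0x867534210) ∷ (0x840 , 53 , 0x210534768) ∷ (0x650 , 54 , 0x876435210) ∷
    (0x750 , 54 , 0x867435210) ∷ (0x850 , 53 , 0x210435768) ∷ (0x760 , 61 , 0x876543210) ∷
    (0x860 , 57 , 0x210543876) ∷ (0x870 , 57 , 0x210543867) ∷ (0x321 , 56 , 0x876543201) ∷
    (0x421 , 37 , 0x021876543) ∷ (0x521 , 37 , 0x021876453) ∷ (0x621 , 57 , 0x876543201) ∷
    (0x721 , 57 , 0x867543201) ∷ (0x821 , 57 , 0x768543201) ∷ (0x431 , 61 , 0x876201543) ∷
    (0x531 , 61 , 0x876201453) ∷ (0x631 , 55 , 0x876543201) ∷ (0x731 , 55 , 0x867543201) ∷
    (0x831 , 50 , 0x201768543) ∷ (0x541 , 45 , 0x01876534) ∷ (0x641 , 54 , 0x876534201) ∷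
    (0x741 , 54 , 0x867534201) ∷ (0x841 , 53 , 0x201534768) ∷ (0x651 , 54 , 0x876435201) ∷
    (0x751 , 54 , 0x867435201) ∷ (0x851 , 53 , 0x201435768) ∷ (0x761 , 61 , 0x876543201) ∷
    (0x861 , 57 , 0x201543876) ∷ (0x871 , 57 , 0x201543867) ∷ (0x432 , 45 , 0x42876130) ∷
    (0x532 , 45 , 0x52876130) ∷ (0x632 , 50 , 0x876102543) ∷ (0x732 , 50 , 0x867102543) ∷
    (0x542 , 58 , 0x876543210) ∷ (0x642 , 53 , 0x876534102) ∷ (0x742 , 53 , 0x867534102) ∷
    (0x652 , 53 , 0x876435102) ∷ (0x752 , 53 , 0x867435102) ∷ (0x762 , 59 , 0x876543210) ∷
    (0x862 , 57 , 0x102543876) ∷ (0x872 , 57 , 0x102543867) ∷ (0x643 , 61 , 0x210876543) ∷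
    (0x743 , 61 , 0x210867543) ∷ (0x843 , 45 , 0x48210736) ∷ (0x653 , 61 , 0x210876453) ∷
    (0x753 , 61 , 0x210867453) ∷ (0x853 , 45 , 0x58210736) ∷ (0x863 , 56 , 0x210543876) ∷
    (0x873 , 56 , 0x210543867) ∷ (0x654 , 45 , 0x76210534) ∷ (0x754 , 45 , 0x67210534) ∷
    (0x854 , 58 , 0x210768354) ∷ (0x764 , 45 , 0x54210736) ∷ (0x864 , 37 , 0x786210543) ∷
    (0x874 , 37 , 0x687210543) ∷ (0x765 , 45 , 0x45210736) ∷ (0x865 , 37 , 0x786210453) ∷
    (0x875 , 37 , 0x687210453) ∷ [])) ∷
  (9 , (0x310 ∷ 0x876 ∷ 0x543 ∷ 0x210 ∷ []) , close
    ((0x410 , 48 , 0x54876130) ∷ (0x510 , 48 , 0x45876130) ∷ (0x320 , 56 , 0x876543210) ∷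
    (0x420 , 37 , 0x120876543) ∷ (0x520 , 37 , 0x120876453) ∷ (0x620 , 57 , 0x876543210) ∷
    (0x720 , 57 , 0x867543210) ∷ (0x820 , 57 , 0x768543210) ∷ (0x630 , 55 , 0x876543210) ∷
    (0x730 , 55 , 0x867543210) ∷ (0x830 , 55 , 0x768543210) ∷ (0x540 , 48 , 0x10876534) ∷
    (0x640 , 54 , 0x876534210) ∷ (0x740 , 54 , 0x867534210) ∷ (0x840 , 54 , 0x768534210) ∷
    (0x650 , 54 , 0x876435210) ∷ (0x750 , 54 , 0x867435210) ∷ (0x850 , 54 , 0x768435210) ∷
    (0x760 , 61 , 0x876543210) ∷ (0x860 , 61 , 0x786543210) ∷ (0x870 , 61 , 0x687543210) ∷
    (0x321 , 56 , 0x876543201) ∷ (0x421 , 37 , 0x021876543) ∷ (0x521 , 37 , 0x021876453) ∷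
    (0x621 , 57 , 0x876543201) ∷ (0x721 , 57 , 0x867543201) ∷ (0x821 , 57 , 0x768543201) ∷
    (0x631 , 55 , 0x876543201) ∷ (0x731 , 55 , 0x867543201) ∷ (0x831 , 55 , 0x768543201) ∷
    (0x541 , 48 , 0x01876534) ∷ (0x641 , 54 , 0x876534201) ∷ (0x741 , 54 , 0x867534201) ∷
    (0x841 , 54 , 0x768534201) ∷ (0x651 , 54 , 0x876435201) ∷ (0x751 , 54 , 0x867435201) ∷
    (0x851 , 54 , 0x768435201) ∷ (0x761 , 61 , 0x876543201) ∷ (0x861 , 61 , 0x786543201) ∷
    (0x871 , 61 , 0x687543201) ∷ (0x432 , 48 , 0x43876120) ∷ (0x532 , 48 , 0x53876120) ∷
    (0x632 , 50 , 0x876102543) ∷ (0x732 , 50 , 0x867102543) ∷ (0x832 , 50 , 0x768102543) ∷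
    (0x542 , 58 , 0x876543210) ∷ (0x642 , 53 , 0x876534102) ∷ (0x742 , 53 , 0x867534102) ∷
    (0x842 , 53 , 0x768534102) ∷ (0x652 , 53 , 0x876435102) ∷ (0x752 , 53 , 0x867435102) ∷
    (0x852 , 53 , 0x768435102) ∷ (0x762 , 59 , 0x876543210) ∷ (0x862 , 59 , 0x786543210) ∷
    (0x872 , 59 , 0x687543210) ∷ (0x643 , 61 , 0x210876543) ∷ (0x743 , 61 , 0x210867543) ∷
    (0x843 , 61 , 0x210768543) ∷ (0x653 , 61 , 0x210876453) ∷ (0x753 , 61 , 0x210867453) ∷
    (0x853 , 61 , 0x210768453) ∷ (0x763 , 62 , 0x876543210) ∷ (0x863 , 62 , 0x786543210) ∷
    (0x873 , 62 , 0x687543210) ∷ (0x654 , 59 , 0x210876354) ∷ (0x754 , 59 , 0x210867354) ∷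
    (0x854 , 59 , 0x210768354) ∷ (0x764 , 60 , 0x876543210) ∷ (0x864 , 60 , 0x786543210) ∷
    (0x874 , 60 , 0x687543210) ∷ (0x765 , 60 , 0x876453210) ∷ (0x865 , 60 , 0x786453210) ∷
    (0x875 , 60 , 0x687453210) ∷ [])) ∷
  (9 , (0x876 ∷ 0x543 ∷ 0x210 ∷ []) , close
    ((0x310 , 63 , 0x876543210) ∷ (0x410 , 63 , 0x876534210) ∷ (0x510 , 63 , 0x876435210) ∷
    (0x610 , 63 , 0x543876210) ∷ (0x710 , 63 , 0x543867210) ∷ (0x810 , 63 , 0x543768210) ∷
    (0x320 , 63 , 0x876543120) ∷ (0x420 , 63 , 0x876534120) ∷ (0x520 , 63 , 0x876435120) ∷
    (0x620 , 63 , 0x543876120) ∷ (0x720 , 63 , 0x543867120) ∷ (0x820 , 63 , 0x543768120) ∷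
    (0x430 , 63 , 0x876210543) ∷ (0x530 , 63 , 0x876210453) ∷ (0x630 , 55 , 0x876543210) ∷
    (0x730 , 55 , 0x867543210) ∷ (0x830 , 55 , 0x768543210) ∷ (0x540 , 63 , 0x876210354) ∷
    (0x640 , 55 , 0x876534210) ∷ (0x740 , 55 , 0x867534210) ∷ (0x840 , 55 , 0x768534210) ∷
    (0x650 , 55 , 0x876435210) ∷ (0x750 , 55 , 0x867435210) ∷ (0x850 , 55 , 0x768435210) ∷
    (0x760 , 63 , 0x543210876) ∷ (0x860 , 63 , 0x543210786) ∷ (0x870 , 63 , 0x543210687) ∷
    (0x321 , 63 , 0x876543021) ∷ (0x421 , 63 , 0x876534021) ∷ (0x521 , 63 , 0x876435021) ∷
    (0x621 , 63 , 0x543876021) ∷ (0x721 , 63 , 0x543867021) ∷ (0x821 , 63 , 0x543768021) ∷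
    (0x431 , 63 , 0x876201543) ∷ (0x531 , 63 , 0x876201453) ∷ (0x631 , 55 , 0x876543201) ∷
    (0x731 , 55 , 0x867543201) ∷ (0x831 , 55 , 0x768543201) ∷ (0x541 , 63 , 0x876201354) ∷
    (0x641 , 55 , 0x876534201) ∷ (0x741 , 55 , 0x867534201) ∷ (0x841 , 55 , 0x768534201) ∷
    (0x651 , 55 , 0x876435201) ∷ (0x751 , 55 , 0x867435201) ∷ (0x851 , 55 , 0x768435201) ∷
    (0x761 , 63 , 0x543201876) ∷ (0x861 , 63 , 0x543201786) ∷ (0x871 , 63 , 0x543201687) ∷
    (0x432 , 63 , 0x876102543) ∷ (0x532 , 63 , 0x876102453) ∷ (0x632 , 55 , 0x876543102) ∷
    (0x732 , 55 , 0x867543102) ∷ (0x832 , 55 , 0x768543102) ∷ (0x542 , 63 , 0x876102354) ∷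
    (0x642 , 55 , 0x876534102) ∷ (0x742 , 55 , 0x867534102) ∷ (0x842 , 55 , 0x768534102) ∷
    (0x652 , 55 , 0x876435102) ∷ (0x752 , 55 , 0x867435102) ∷ (0x852 , 55 , 0x768435102) ∷
    (0x762 , 63 , 0x543102876) ∷ (0x862 , 63 , 0x543102786) ∷ (0x872 , 63 , 0x543102687) ∷
    (0x643 , 63 , 0x210876543) ∷ (0x743 , 63 , 0x210867543) ∷ (0x843 , 63 , 0x210768543) ∷
    (0x653 , 63 , 0x210876453) ∷ (0x753 , 63 , 0x210867453) ∷ (0x853 , 63 , 0x210768453) ∷
    (0x763 , 63 , 0x210543876) ∷ (0x863 , 63 , 0x210543786) ∷ (0x873 , 63 , 0x210543687) ∷
    (0x654 , 63 , 0x210876354) ∷ (0x754 , 63 , 0x210867354) ∷ (0x854 , 63 , 0x210768354) ∷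
    (0x764 , 63 , 0x210534876) ∷ (0x864 , 63 , 0x210534786) ∷ (0x874 , 63 , 0x210534687) ∷
    (0x765 , 63 , 0x210435876) ∷ (0x865 , 63 , 0x210435786) ∷ (0x875 , 63 , 0x210435687) ∷ [])) ∷
  (10 , (0x984 ∷ 0x761 ∷ 0x543 ∷ 0x210 ∷ []) , branch 0x41
    ([])) ∷
  (9 , (0x840 ∷ 0x761 ∷ 0x543 ∷ 0x210 ∷ []) , branch 0x41
    (36 via 0x854761230 ∷ 36 via 0x834761250 ∷ 48 via 0x76543210 ∷ 48 via 0x67543210 ∷
    57 via 0x534761820 ∷ 63 via 0x543761920 ∷ 48 via 0x80761543 ∷ 6 via 0x876543210 ∷
    6 via 0x867543210 ∷ 48 via 0x53761840 ∷ 37 via 0x980761543 ∷ 6 via 0x876345210 ∷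
    6 via 0x867345210 ∷ 48 via 0x35761840 ∷ 37 via 0x890761354 ∷ 48 via 0x20543716 ∷
    36 via 0x271534860 ∷ 37 via 0x976543210 ∷ 36 via 0x261534870 ∷ 37 via 0x967543210 ∷
    63 via 0x761534980 ∷ 64 via 0xa90761543 ∷ 53 via 0x761840532 ∷ 0 via 0x876543210 ∷
    0 via 0x867543210 ∷ 32 via 0x523761084 ∷ 0 via 0x876345210 ∷ 0 via 0x867345210 ∷
    32 via 0x325761084 ∷ 48 via 0x02543716 ∷ 32 via 0x786534021 ∷ 32 via 0x687534021 ∷
    14 via 0x876543210 ∷ 14 via 0x867543210 ∷ 48 via 0x08761543 ∷ 63 via 0x761804953 ∷
    14 via 0x253716840 ∷ 0 via 0x253716840 ∷ closed ∷ 0 via 0x253617840 ∷ closed ∷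
    14 via 0x235716840 ∷ 0 via 0x235716840 ∷ closed ∷ 0 via 0x235617840 ∷ closed ∷
    53 via 0x534210768 ∷ 63 via 0x543201976 ∷ [])) ∷
  (9 , (0x420 ∷ 0x854 ∷ 0x761 ∷ 0x543 ∷ 0x210 ∷ []) , branch 0x41
    (48 via 0x53761240 ∷ 48 via 0x35761240 ∷ 48 via 0x76543210 ∷ 48 via 0x67543210 ∷
    48 via 0x58761240 ∷ 63 via 0x543761920 ∷ 36 via 0x385761240 ∷ 25 via 0x76543210 ∷
    25 via 0x67543210 ∷ 25 via 0x76345210 ∷ 25 via 0x67345210 ∷ 36 via 0x835761240 ∷
    36 via 0x935761240 ∷ 46 via 0x21534706 ∷ 25 via 0x76548210 ∷ 36 via 0x976534210 ∷
    25 via 0x67548210 ∷ 36 via 0x967534210 ∷ 36 via 0x385761042 ∷ 25 via 0x76543012 ∷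
    25 via 0x67543012 ∷ 25 via 0x76345012 ∷ 25 via 0x67345012 ∷ 36 via 0x835761042 ∷
    36 via 0x935761042 ∷ 46 via 0x01534726 ∷ 25 via 0x76548012 ∷ 36 via 0x976534012 ∷
    25 via 0x67548012 ∷ 36 via 0x967534012 ∷ 14 via 0x871240365 ∷ 14 via 0x861240375 ∷
    31 via 0x53716240 ∷ 31 via 0x35716240 ∷ 14 via 0x371240865 ∷ 14 via 0x371240965 ∷
    14 via 0x361240875 ∷ 14 via 0x361240975 ∷ 31 via 0x58716240 ∷ 59 via 0x976534120 ∷ [])) ∷
  (9 , (0x640 ∷ 0x854 ∷ 0x761 ∷ 0x543 ∷ 0x210 ∷ []) , branch 0x41
    (25 via 0x76534210 ∷ 25 via 0x76354210 ∷ 41 via 0x71534260 ∷ 40 via 0x67534210 ∷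
    25 via 0x76584210 ∷ 54 via 0x534716920 ∷ 22 via 0x76543210 ∷ 41 via 0x21534706 ∷
    22 via 0x76548210 ∷ 37 via 0x976543210 ∷ 0 via 0x376854012 ∷ 15 via 0x76345210 ∷
    0 via 0x876354012 ∷ 0 via 0x976354012 ∷ 40 via 0x02534716 ∷ 0 via 0x320854617 ∷
    25 via 0x20534716 ∷ 25 via 0x20354716 ∷ 0 via 0x820354617 ∷ 0 via 0x920354617 ∷
    25 via 0x20584716 ∷ 54 via 0x534210976 ∷ [])) ∷
  (9 , (0x843 ∷ 0x854 ∷ 0x761 ∷ 0x543 ∷ 0x210 ∷ []) , branch 0x41
    ([])) ∷
  (9 , (0x854 ∷ 0x761 ∷ 0x543 ∷ 0x210 ∷ []) , branch 0x51
    (59 via 0x854761320 ∷ 67 via 0x876543210 ∷ 48 via 0x76543210 ∷ 48 via 0x67543210 ∷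
    59 via 0x354761820 ∷ 63 via 0x543761920 ∷ 66 via 0x376845210 ∷ 35 via 0x271854360 ∷
    35 via 0x261854370 ∷ 48 via 0x08761534 ∷ 63 via 0x761903854 ∷ 68 via 0x876543210 ∷
    68 via 0x867543210 ∷ 66 via 0x876543210 ∷ 66 via 0x976543210 ∷ 48 via 0x20543716 ∷
    35 via 0x271354860 ∷ 37 via 0x976543210 ∷ 35 via 0x261354870 ∷ 37 via 0x967543210 ∷
    63 via 0x761908354 ∷ 64 via 0xa90761543 ∷ 66 via 0x376845012 ∷ 35 via 0x071854362 ∷
    35 via 0x061854372 ∷ 48 via 0x28761534 ∷ 63 via 0x761923854 ∷ 68 via 0x876543012 ∷
    68 via 0x867543012 ∷ 66 via 0x876543012 ∷ 66 via 0x976543012 ∷ 48 via 0x02543716 ∷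
    35 via 0x071354862 ∷ 37 via 0x796543021 ∷ 35 via 0x061354872 ∷ 37 via 0x697543021 ∷
    63 via 0x761928354 ∷ 64 via 0xa92761543 ∷ 66 via 0x320845716 ∷ 66 via 0x320845617 ∷
    69 via 0x876543210 ∷ 65 via 0x9376845210 ∷ 59 via 0x854201376 ∷ 48 via 0x68210534 ∷
    63 via 0x210963854 ∷ 48 via 0x78210534 ∷ 63 via 0x210973854 ∷ 67 via 0x820543716 ∷
    66 via 0x820543716 ∷ 66 via 0x920543716 ∷ 66 via 0x820543617 ∷ 66 via 0x920543617 ∷
    65 via 0x9876543210 ∷ 59 via 0x354201876 ∷ 63 via 0x543201976 ∷ 63 via 0x210968354 ∷
    64 via 0xa96543210 ∷ 63 via 0x210978354 ∷ 64 via 0xa97543210 ∷ [])) ∷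
  (8 , (0x420 ∷ 0x761 ∷ 0x543 ∷ 0x210 ∷ []) , branch 0x41
    (48 via 0x53761240 ∷ 48 via 0x35761240 ∷ 48 via 0x76543210 ∷ 48 via 0x67543210 ∷
    63 via 0x543761820 ∷ 46 via 0x24761503 ∷ 25 via 0x76543210 ∷ 25 via 0x67543210 ∷
    36 via 0x853761240 ∷ 25 via 0x76345210 ∷ 25 via 0x67345210 ∷ 36 via 0x835761240 ∷
    46 via 0x21534706 ∷ 36 via 0x876534210 ∷ 36 via 0x867534210 ∷ 64 via 0x980761543 ∷
    46 via 0x04761523 ∷ 25 via 0x76543012 ∷ 25 via 0x67543012 ∷ 36 via 0x853761042 ∷
    25 via 0x76345012 ∷ 25 via 0x67345012 ∷ 36 via 0x835761042 ∷ 46 via 0x01534726 ∷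
    36 via 0x876534012 ∷ 36 via 0x867534012 ∷ 64 via 0x982761543 ∷ 31 via 0x76543210 ∷
    31 via 0x67543210 ∷ 59 via 0x853761420 ∷ 31 via 0x53716240 ∷ 14 via 0x571240863 ∷
    14 via 0x561240873 ∷ 31 via 0x35716240 ∷ 14 via 0x371240865 ∷ 14 via 0x361240875 ∷
    59 via 0x876534120 ∷ [])) ∷
  (8 , (0x430 ∷ 0x540 ∷ 0x761 ∷ 0x543 ∷ 0x210 ∷ []) , branch 0x41
    (46 via 0x23761504 ∷ 46 via 0x25761403 ∷ 44 via 0x76354210 ∷ 44 via 0x67354210 ∷
    56 via 0x761820534 ∷ 39 via 0x0761543 ∷ 21 via 0x76543210 ∷ 21 via 0x67543210 ∷
    47 via 0x80761534 ∷ 21 via 0x76435210 ∷ 21 via 0x67435210 ∷ 47 via 0x80761354 ∷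
    45 via 0x21354706 ∷ 37 via 0x876543210 ∷ 37 via 0x867543210 ∷ 56 via 0x761980534 ∷
    40 via 0x23761450 ∷ 26 via 0x76543210 ∷ 26 via 0x67543210 ∷ 26 via 0x76435210 ∷
    26 via 0x67435210 ∷ 43 via 0x02354716 ∷ 9 via 0x76543210 ∷ 9 via 0x67543210 ∷
    47 via 0x83761054 ∷ 31 via 0x20534716 ∷ 14 via 0x283504761 ∷ 14 via 0x283504671 ∷
    31 via 0x20453716 ∷ 14 via 0x285403761 ∷ 14 via 0x285403671 ∷ 56 via 0x876210534 ∷ [])) ∷
  (8 , (0x640 ∷ 0x540 ∷ 0x761 ∷ 0x543 ∷ 0x210 ∷ []) , branch 0x41
    (25 via 0x76534210 ∷ 25 via 0x76354210 ∷ 41 via 0x71534260 ∷ 40 via 0x67534210 ∷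
    54 via 0x534716820 ∷ 21 via 0x76534210 ∷ 21 via 0x76543210 ∷ 7 via 0x76543210 ∷
    6 via 0x876534210 ∷ 22 via 0x76345210 ∷ 7 via 0x76345210 ∷ 6 via 0x876354210 ∷
    41 via 0x21534706 ∷ 37 via 0x876543210 ∷ 33 via 0x867534210 ∷ 55 via 0x716980534 ∷
    25 via 0x32761450 ∷ 7 via 0x20543716 ∷ 15 via 0x76543210 ∷ 7 via 0x20345716 ∷
    15 via 0x76345210 ∷ 0 via 0x876354012 ∷ 40 via 0x02534716 ∷ 21 via 0x20534716 ∷
    26 via 0x20534617 ∷ 35 via 0x271853460 ∷ 25 via 0x20534716 ∷ 6 via 0x820534716 ∷
    25 via 0x20354716 ∷ 6 via 0x820354716 ∷ 0 via 0x820354617 ∷ 54 via 0x534210876 ∷ [])) ∷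
  (8 , (0x432 ∷ 0x540 ∷ 0x761 ∷ 0x543 ∷ 0x210 ∷ []) , branch 0x41
    (41 via 0x54761302 ∷ 41 via 0x34761520 ∷ 22 via 0x32716540 ∷ 22 via 0x32617540 ∷
    37 via 0x832761540 ∷ 40 via 0x23761540 ∷ 7 via 0x32716540 ∷ 7 via 0x32617540 ∷
    25 via 0x32761540 ∷ 25 via 0x32671540 ∷ 53 via 0x761850432 ∷ 21 via 0x32761540 ∷
    6 via 0x832761540 ∷ 6 via 0x832671540 ∷ 40 via 0x05761342 ∷ 25 via 0x50761342 ∷
    25 via 0x50671342 ∷ 53 via 0x761832540 ∷ 7 via 0x50716342 ∷ 7 via 0x50617342 ∷
    21 via 0x50761342 ∷ 6 via 0x850761342 ∷ 6 via 0x850671342 ∷ 15 via 0x32716540 ∷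
    15 via 0x32617540 ∷ 32 via 0x823761045 ∷ 26 via 0x54763201 ∷ 0 via 0x754863201 ∷
    0 via 0x654873201 ∷ 26 via 0x34765021 ∷ 0 via 0x734865021 ∷ 0 via 0x634875021 ∷
    35 via 0x534876120 ∷ [])) ∷
  (8 , (0x642 ∷ 0x540 ∷ 0x761 ∷ 0x543 ∷ 0x210 ∷ []) , branch 0x41
    (25 via 0x76534012 ∷ 25 via 0x76354012 ∷ 41 via 0x71534062 ∷ 40 via 0x67534012 ∷
    54 via 0x716802354 ∷ 26 via 0x76534210 ∷ 7 via 0x20354716 ∷ 15 via 0x67354210 ∷
    0 via 0x876354210 ∷ 40 via 0x20534716 ∷ 7 via 0x40716352 ∷ 22 via 0x76543012 ∷
    22 via 0x76345012 ∷ 41 via 0x01534726 ∷ 35 via 0x786354021 ∷ 21 via 0x02534716 ∷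
    15 via 0x64357120 ∷ 25 via 0x76102534 ∷ 25 via 0x02354716 ∷ 6 via 0x802354716 ∷
    0 via 0x802354617 ∷ 54 via 0x876102354 ∷ [])) ∷
  (8 , (0x643 ∷ 0x540 ∷ 0x761 ∷ 0x543 ∷ 0x210 ∷ []) , branch 0x41
    (41 via 0x20716534 ∷ 31 via 0x76453210 ∷ 44 via 0x76354210 ∷ 43 via 0x67543210 ∷
    57 via 0x820716534 ∷ 9 via 0x76453210 ∷ 21 via 0x76543210 ∷ 21 via 0x67543210 ∷
    41 via 0x80716534 ∷ 21 via 0x20435716 ∷ 26 via 0x20435716 ∷ 14 via 0x876453210 ∷
    44 via 0x20543716 ∷ 37 via 0x876543210 ∷ 35 via 0x280543671 ∷ 15 via 0x32716450 ∷
    26 via 0x76543210 ∷ 15 via 0x32504671 ∷ 51 via 0x832540761 ∷ 21 via 0x02435716 ∷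
    15 via 0x75346120 ∷ 43 via 0x02354716 ∷ 35 via 0x786354021 ∷ 9 via 0x20435716 ∷
    15 via 0x75201634 ∷ 0 via 0x283716450 ∷ 31 via 0x20534716 ∷ 14 via 0x283504761 ∷
    41 via 0x76210354 ∷ 41 via 0x86210354 ∷ 51 via 0x875364210 ∷ 57 via 0x210876534 ∷ [])) ∷
  (8 , (0x540 ∷ 0x761 ∷ 0x543 ∷ 0x210 ∷ []) , branch 0x51
    (46 via 0x23761504 ∷ 71 via 0x76543210 ∷ 44 via 0x76354210 ∷ 44 via 0x67354210 ∷
    61 via 0x354761820 ∷ 72 via 0x76543210 ∷ 21 via 0x76543210 ∷ 21 via 0x67543210 ∷
    48 via 0x80761534 ∷ 73 via 0x76543210 ∷ 73 via 0x67543210 ∷ 66 via 0x876543210 ∷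
    45 via 0x21354706 ∷ 37 via 0x876543210 ∷ 37 via 0x867543210 ∷ 63 via 0x761980354 ∷
    74 via 0x76543210 ∷ 26 via 0x76543210 ∷ 26 via 0x67543210 ∷ 53 via 0x761832540 ∷
    75 via 0x76543210 ∷ 75 via 0x67543210 ∷ 66 via 0x876543012 ∷ 43 via 0x02354716 ∷
    35 via 0x786354021 ∷ 35 via 0x687354021 ∷ 55 via 0x982540761 ∷ 76 via 0x76543210 ∷
    76 via 0x67543210 ∷ 66 via 0x576843210 ∷ 31 via 0x20534716 ∷ 14 via 0x283504761 ∷
    14 via 0x283504671 ∷ 71 via 0x20543716 ∷ 66 via 0x820543716 ∷ 66 via 0x820543617 ∷
    60 via 0x876210354 ∷ 63 via 0x986210354 ∷ 63 via 0x987210354 ∷ [])) ∷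
  (8 , (0x640 ∷ 0x761 ∷ 0x543 ∷ 0x210 ∷ []) , branch 0x41
    (25 via 0x76534210 ∷ 25 via 0x76354210 ∷ 41 via 0x71534260 ∷ 40 via 0x67534210 ∷
    54 via 0x534716820 ∷ 21 via 0x76534210 ∷ 22 via 0x76543210 ∷ 7 via 0x76543210 ∷
    6 via 0x876534210 ∷ 22 via 0x76345210 ∷ 7 via 0x76345210 ∷ 6 via 0x876354210 ∷
    41 via 0x21534706 ∷ 37 via 0x876543210 ∷ 33 via 0x867534210 ∷ 55 via 0x716980534 ∷
    26 via 0x76534012 ∷ 7 via 0x20543716 ∷ 15 via 0x76543210 ∷ 0 via 0x876534012 ∷
    7 via 0x20345716 ∷ 15 via 0x76345210 ∷ 0 via 0x876354012 ∷ 40 via 0x02534716 ∷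
    33 via 0x802534716 ∷ 32 via 0x867534012 ∷ 21 via 0x20534716 ∷ 26 via 0x20534617 ∷
    35 via 0x271853460 ∷ 25 via 0x20534716 ∷ 6 via 0x820534716 ∷ 0 via 0x820534617 ∷
    25 via 0x20354716 ∷ 6 via 0x820354716 ∷ 0 via 0x820354617 ∷ 54 via 0x534210876 ∷
    55 via 0x986534210 ∷ [])) ∷
  (8 , (0x761 ∷ 0x543 ∷ 0x210 ∷ []) , branch 0x31
    (71 via 0x76543210 ∷ 71 via 0x76453210 ∷ 48 via 0x76543210 ∷ 48 via 0x67543210 ∷
    63 via 0x543761820 ∷ 77 via 0x76543210 ∷ 78 via 0x76543210 ∷ 78 via 0x67543210 ∷
    66 via 0x876543210 ∷ 78 via 0x76453210 ∷ 78 via 0x67453210 ∷ 66 via 0x876453210 ∷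
    48 via 0x20543716 ∷ 37 via 0x876543210 ∷ 37 via 0x867543210 ∷ 64 via 0x980761543 ∷
    77 via 0x76543012 ∷ 78 via 0x76543012 ∷ 78 via 0x67543012 ∷ 66 via 0x876543012 ∷
    78 via 0x76453012 ∷ 78 via 0x67453012 ∷ 66 via 0x876453012 ∷ 48 via 0x02543716 ∷
    37 via 0x786543021 ∷ 37 via 0x687543021 ∷ 64 via 0x982761543 ∷ 77 via 0x20543716 ∷
    77 via 0x20543617 ∷ 70 via 0x876543210 ∷ 71 via 0x20543716 ∷ 66 via 0x820543716 ∷
    66 via 0x820543617 ∷ 65 via 0x9876543210 ∷ 71 via 0x20453716 ∷ 66 via 0x820453716 ∷
    66 via 0x820453617 ∷ 65 via 0x9876453210 ∷ 63 via 0x543201876 ∷ 64 via 0x986543210 ∷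
    64 via 0x987543210 ∷ [])) ∷
  (10 , (0x942 ∷ 0x841 ∷ 0x732 ∷ 0x621 ∷ 0x543 ∷ 0x210 ∷ []) , branch 0x42
    (37 via 0x792810543 ∷ 2 via 0x978021543 ∷ 2 via 0x905723841 ∷ 21 via 0x73815924 ∷
    37 via 0x792861543 ∷ 6 via 0x987543012 ∷ 37 via 0x792a81543 ∷ 37 via 0x894753021 ∷ [])) ∷
  (9 , (0x420 ∷ 0x841 ∷ 0x732 ∷ 0x621 ∷ 0x543 ∷ 0x210 ∷ []) , branch 0x42
    (2 via 0x078621543 ∷ 2 via 0x065723841 ∷ 21 via 0x73815024 ∷ 36 via 0x753861042 ∷
    6 via 0x087543612 ∷ 36 via 0x753981042 ∷ 37 via 0x804753621 ∷ [])) ∷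
  (9 , (0x542 ∷ 0x841 ∷ 0x732 ∷ 0x621 ∷ 0x543 ∷ 0x210 ∷ []) , branch 0x42
    (2 via 0x087612534 ∷ 44 via 0x72081534 ∷ 2 via 0x687012534 ∷ 11 via 0x05814732 ∷
    11 via 0x78021543 ∷ 2 via 0x987012534 ∷ 27 via 0x5723814 ∷ 44 via 0x72681534 ∷
    21 via 0x87543012 ∷ 44 via 0x72981534 ∷ 21 via 0x84735012 ∷ 25 via 0x78021534 ∷ [])) ∷
  (9 , (0x742 ∷ 0x841 ∷ 0x732 ∷ 0x621 ∷ 0x543 ∷ 0x210 ∷ []) , branch 0x42
    (2 via 0x065814732 ∷ 21 via 0x05723814 ∷ 44 via 0x54810732 ∷ 25 via 0x50841732 ∷
    11 via 0x87012534 ∷ 2 via 0x605814732 ∷ 10 via 0x50841723 ∷ 2 via 0x905814732 ∷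
    21 via 0x65723814 ∷ 30 via 0x5372814 ∷ 21 via 0x95723814 ∷ 44 via 0x54861732 ∷
    22 via 0x87534012 ∷ 45 via 0x53981742 ∷ 25 via 0x56841732 ∷ 21 via 0x02537814 ∷
    21 via 0x01538724 ∷ 36 via 0x081953742 ∷ [])) ∷
  (9 , (0x842 ∷ 0x841 ∷ 0x732 ∷ 0x621 ∷ 0x543 ∷ 0x210 ∷ []) , branch 0x42
    (11 via 0x05723841 ∷ 44 via 0x02753814 ∷ [])) ∷
  (9 , (0x752 ∷ 0x841 ∷ 0x732 ∷ 0x621 ∷ 0x543 ∷ 0x210 ∷ []) , branch 0x42
    (21 via 0x84725013 ∷ 21 via 0x84723015 ∷ 43 via 0x45081732 ∷ 40 via 0x05841732 ∷
    27 via 0x5814723 ∷ 21 via 0x84725613 ∷ 30 via 0x5481723 ∷ 21 via 0x84725913 ∷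
    21 via 0x84723615 ∷ 30 via 0x3481725 ∷ 21 via 0x84723915 ∷ 43 via 0x45681732 ∷
    22 via 0x87435012 ∷ 43 via 0x45981732 ∷ 40 via 0x65841732 ∷ 9 via 0x84375012 ∷
    27 via 0x5184723 ∷ 42 via 0x95814732 ∷ 15 via 0x78012534 ∷ 15 via 0x87021453 ∷ [])) ∷
  (9 , (0x754 ∷ 0x841 ∷ 0x732 ∷ 0x621 ∷ 0x543 ∷ 0x210 ∷ []) , branch 0x42
    (22 via 0x05237814 ∷ 43 via 0x27810534 ∷ 21 via 0x02547813 ∷ 22 via 0x65237814 ∷
    27 via 0x5273814 ∷ 22 via 0x95237814 ∷ 43 via 0x27861534 ∷ 21 via 0x02543817 ∷
    44 via 0x27981534 ∷ 9 via 0x02357814 ∷ [])) ∷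
  (9 , (0x841 ∷ 0x732 ∷ 0x621 ∷ 0x543 ∷ 0x210 ∷ []) , branch 0x31
    (81 via 0x876543210 ∷ 78 via 0x05841723 ∷ 66 via 0x870543621 ∷ 66 via 0x873540621 ∷
    0 via 0x807612354 ∷ 0 via 0x708621453 ∷ 15 via 0x78543201 ∷ 82 via 0x876543210 ∷
    81 via 0x870543216 ∷ 83 via 0x876543210 ∷ 84 via 0x876543210 ∷ 80 via 0x9876543210 ∷
    78 via 0x65841723 ∷ 85 via 0x876543210 ∷ 78 via 0x95841723 ∷ 66 via 0x876543021 ∷
    78 via 0x78543021 ∷ 66 via 0x897543021 ∷ 66 via 0x873645021 ∷ 86 via 0x876543210 ∷
    76 via 0x73845021 ∷ 66 via 0x873945021 ∷ 68 via 0x687120543 ∷ 0 via 0x867012354 ∷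
    0 via 0x768021453 ∷ 15 via 0x87021453 ∷ 0 via 0x897012354 ∷ 0 via 0x798021453 ∷
    15 via 0x78543261 ∷ 51 via 0x978534021 ∷ [])) ∷
  (9 , (0x831 ∷ 0x410 ∷ 0x732 ∷ 0x621 ∷ 0x543 ∷ 0x210 ∷ []) , branch 0x31
    (2 via 0x856732014 ∷ closed ∷ 6 via 0x870534621 ∷ 37 via 0x873540621 ∷ 6 via 0x807612543 ∷
    2 via 0x807612534 ∷ 2 via 0x786534021 ∷ 2 via 0x865014732 ∷ 6 via 0x865014723 ∷
    21 via 0x04725813 ∷ 36 via 0x853762041 ∷ 36 via 0x853972041 ∷ 6 via 0x856732041 ∷ [])) ∷
  (8 , (0x310 ∷ 0x410 ∷ 0x732 ∷ 0x621 ∷ 0x543 ∷ 0x210 ∷ []) , branch 0x31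
    (22 via 0x70543621 ∷ 21 via 0x61540723 ∷ 7 via 0x70612543 ∷ 11 via 0x70621543 ∷
    11 via 0x56732014 ∷ 10 via 0x56041723 ∷ 2 via 0x865723041 ∷ 21 via 0x65104723 ∷
    30 via 0x5410723 ∷ 21 via 0x85104723 ∷ 44 via 0x53762041 ∷ 44 via 0x53862041 ∷
    45 via 0x54872130 ∷ 25 via 0x56732041 ∷ 21 via 0x62547013 ∷ 36 via 0x672854031 ∷ [])) ∷
  (8 , (0x510 ∷ 0x410 ∷ 0x732 ∷ 0x621 ∷ 0x543 ∷ 0x210 ∷ []) , branch 0x31
    (closed ∷ closed ∷ 27 via 0x0354621 ∷ 22 via 0x70345621 ∷ 22 via 0x80345621 ∷
    9 via 0x73405621 ∷ 15 via 0x46723501 ∷ 15 via 0x07621543 ∷ 0 via 0x780621543 ∷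
    15 via 0x56723401 ∷ 15 via 0x07621453 ∷ 0 via 0x780621453 ∷ 27 via 0x5723104 ∷
    21 via 0x73105624 ∷ 30 via 0x5372104 ∷ 21 via 0x73105824 ∷ 21 via 0x73104625 ∷
    30 via 0x4372105 ∷ 21 via 0x73104825 ∷ 43 via 0x35672140 ∷ 44 via 0x35862041 ∷
    43 via 0x35872140 ∷ 40 via 0x65732041 ∷ 27 via 0x5273104 ∷ 42 via 0x85723140 ∷ [])) ∷
  (8 , (0x530 ∷ 0x410 ∷ 0x732 ∷ 0x621 ∷ 0x543 ∷ 0x210 ∷ []) , branch 0x31
    (closed ∷ 30 via 0x4162530 ∷ 21 via 0x61534720 ∷ 21 via 0x61534820 ∷ 9 via 0x61450723 ∷
    40 via 0x70612543 ∷ 15 via 0x56723401 ∷ 15 via 0x07621453 ∷ 0 via 0x780621453 ∷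
    11 via 0x65723104 ∷ 21 via 0x61530724 ∷ 22 via 0x65140723 ∷ 27 via 0x5104723 ∷
    22 via 0x85140723 ∷ 43 via 0x10762543 ∷ 43 via 0x10862543 ∷ 44 via 0x10872543 ∷
    15 via 0x65732140 ∷ [])) ∷
  (8 , (0x531 ∷ 0x410 ∷ 0x732 ∷ 0x621 ∷ 0x543 ∷ 0x210 ∷ []) , branch 0x31
    (11 via 0x65723041 ∷ 30 via 0x0453621 ∷ 21 via 0x70534621 ∷ 21 via 0x80534621 ∷
    21 via 0x73405621 ∷ 21 via 0x72406531 ∷ 25 via 0x07612543 ∷ 36 via 0x762804513 ∷
    10 via 0x07612534 ∷ 11 via 0x07612534 ∷ 2 via 0x870621543 ∷ 22 via 0x65041723 ∷
    27 via 0x5014723 ∷ 44 via 0x01672543 ∷ 45 via 0x04862513 ∷ 44 via 0x01872543 ∷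
    7 via 0x65732041 ∷ [])) ∷
  (8 , (0x631 ∷ 0x410 ∷ 0x732 ∷ 0x621 ∷ 0x543 ∷ 0x210 ∷ []) , branch 0x31
    (11 via 0x70534612 ∷ closed ∷ 25 via 0x70534621 ∷ 41 via 0x73540621 ∷ 21 via 0x07612543 ∷
    10 via 0x70621543 ∷ 11 via 0x56041723 ∷ 21 via 0x04725613 ∷ 21 via 0x01726543 ∷
    36 via 0x653872041 ∷ [])) ∷
  (8 , (0x731 ∷ 0x410 ∷ 0x732 ∷ 0x621 ∷ 0x543 ∷ 0x210 ∷ []) , branch 0x31
    (10 via 0x65014732 ∷ closed ∷ 7 via 0x70543621 ∷ 42 via 0x61540723 ∷ 11 via 0x65014732 ∷
    11 via 0x67543012 ∷ 25 via 0x65014723 ∷ 21 via 0x53627041 ∷ 21 via 0x56732041 ∷ [])) ∷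
  (8 , (0x410 ∷ 0x732 ∷ 0x621 ∷ 0x543 ∷ 0x210 ∷ []) , branch 0x42
    (89 via 0x76543210 ∷ 90 via 0x76543210 ∷ 72 via 0x54016732 ∷ 78 via 0x07534612 ∷
    66 via 0x780534612 ∷ 91 via 0x76543210 ∷ 73 via 0x54216730 ∷ 15 via 0x56723401 ∷
    15 via 0x07621453 ∷ 0 via 0x780621453 ∷ 15 via 0x70543261 ∷ 51 via 0x807612543 ∷
    92 via 0x76543210 ∷ 93 via 0x76543210 ∷ 94 via 0x76543210 ∷ 88 via 0x876543210 ∷
    78 via 0x65732014 ∷ 78 via 0x85732014 ∷ 78 via 0x67534012 ∷ 66 via 0x786534012 ∷
    73 via 0x56014732 ∷ 76 via 0x04735612 ∷ 66 via 0x740835612 ∷ 76 via 0x76012534 ∷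
    66 via 0x087612534 ∷ 15 via 0x56014372 ∷ 51 via 0x856041732 ∷ 0 via 0x087612354 ∷ [])) ∷
  (8 , (0x640 ∷ 0x732 ∷ 0x621 ∷ 0x543 ∷ 0x210 ∷ []) , branch 0x42
    (closed ∷ 15 via 0x15732604 ∷ 9 via 0x54016732 ∷ 15 via 0x07534612 ∷ 0 via 0x780534612 ∷
    30 via 0x6453210 ∷ 27 via 0x6534210 ∷ 21 via 0x54216730 ∷ 21 via 0x54216830 ∷
    27 via 0x6354210 ∷ 40 via 0x76543102 ∷ 42 via 0x86534201 ∷ 22 via 0x51406732 ∷ closed ∷
    27 via 0x1460732 ∷ 22 via 0x81406732 ∷ 15 via 0x51723460 ∷ 15 via 0x76543210 ∷
    0 via 0x786534012 ∷ 30 via 0x0453216 ∷ 43 via 0x46753201 ∷ 43 via 0x46853201 ∷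
    21 via 0x54210736 ∷ 21 via 0x54210836 ∷ 44 via 0x46873102 ∷ [])) ∷
  (9 , (0x831 ∷ 0x541 ∷ 0x732 ∷ 0x621 ∷ 0x543 ∷ 0x210 ∷ []) , branch 0x31
    (2 via 0x708621534 ∷ 2 via 0x708621435 ∷ 45 via 0x81072534 ∷ 21 via 0x72540831 ∷
    19 via 0x87012534 ∷ 2 via 0x768021534 ∷ 11 via 0x87012543 ∷ 2 via 0x798021534 ∷
    2 via 0x768021435 ∷ 11 via 0x87012453 ∷ 2 via 0x798021435 ∷ 45 via 0x81672534 ∷
    21 via 0x78543021 ∷ 45 via 0x81972534 ∷ 21 via 0x72546831 ∷ 21 via 0x02547813 ∷
    21 via 0x73548021 ∷ 37 via 0x873954021 ∷ [])) ∷
  (8 , (0x310 ∷ 0x541 ∷ 0x732 ∷ 0x621 ∷ 0x543 ∷ 0x210 ∷ []) , branch 0x31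
    (21 via 0x70543621 ∷ 21 via 0x73540621 ∷ 19 via 0x07612534 ∷ 11 via 0x06732541 ∷
    11 via 0x07612543 ∷ 2 via 0x780621534 ∷ 11 via 0x06732451 ∷ 11 via 0x07612453 ∷
    2 via 0x780621435 ∷ 45 via 0x01672534 ∷ 45 via 0x01872534 ∷ 21 via 0x72546031 ∷
    21 via 0x62547013 ∷ 37 via 0x073854621 ∷ [])) ∷
  (8 , (0x752 ∷ 0x431 ∷ 0x541 ∷ 0x732 ∷ 0x621 ∷ 0x543 ∷ 0x210 ∷ []) , branch 0x42
    (11 via 0x07612453 ∷ 11 via 0x07612435 ∷ 11 via 0x67012453 ∷ 11 via 0x87012453 ∷
    11 via 0x67012435 ∷ 11 via 0x87012435 ∷ 13 via 0x7021534 ∷ [])) ∷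
  (8 , (0x431 ∷ 0x541 ∷ 0x732 ∷ 0x621 ∷ 0x543 ∷ 0x210 ∷ []) , branch 0x31
    (72 via 0x70543621 ∷ 20 via 0x7210453 ∷ 99 via 0x76543210 ∷ 72 via 0x76543021 ∷
    72 via 0x87543021 ∷ 20 via 0x7216453 ∷ 25 via 0x87012453 ∷ [])) ∷
  (8 , (0x731 ∷ 0x541 ∷ 0x732 ∷ 0x621 ∷ 0x543 ∷ 0x210 ∷ []) , branch 0x31
    (11 via 0x65024731 ∷ 11 via 0x64025731 ∷ 21 via 0x07543621 ∷ 30 via 0x0273541 ∷
    29 via 0x0732514 ∷ 11 via 0x05624731 ∷ 11 via 0x05824731 ∷ 11 via 0x04625731 ∷
    11 via 0x04825731 ∷ 21 via 0x67543021 ∷ 21 via 0x87543021 ∷ 30 via 0x6273541 ∷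
    27 via 0x7012543 ∷ 44 via 0x01854723 ∷ [])) ∷
  (8 , (0x754 ∷ 0x743 ∷ 0x541 ∷ 0x732 ∷ 0x621 ∷ 0x543 ∷ 0x210 ∷ []) , branch 0x42
    (9 via 0x62347015 ∷ 27 via 0x7102543 ∷ 9 via 0x02347615 ∷ 9 via 0x02347815 ∷ 38 via 0x7201354 ∷
    27 via 0x7162543 ∷ 42 via 0x87102534 ∷ [])) ∷
  (8 , (0x743 ∷ 0x541 ∷ 0x732 ∷ 0x621 ∷ 0x543 ∷ 0x210 ∷ []) , branch 0x31
    (76 via 0x07543621 ∷ 71 via 0x61540723 ∷ 18 via 0x7201435 ∷ 101 via 0x56734120 ∷
    100 via 0x56374120 ∷ 76 via 0x67543021 ∷ 76 via 0x87543021 ∷ 71 via 0x10645723 ∷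
    102 via 0x76543210 ∷ 67 via 0x685120743 ∷ 18 via 0x7261435 ∷ 41 via 0x87201354 ∷ [])) ∷
  (8 , (0x541 ∷ 0x732 ∷ 0x621 ∷ 0x543 ∷ 0x210 ∷ []) , branch 0x52
    (98 via 0x76543210 ∷ 95 via 0x76543210 ∷ 71 via 0x72610534 ∷ 78 via 0x07534612 ∷
    66 via 0x780534612 ∷ 71 via 0x70612534 ∷ 75 via 0x53126740 ∷ 26 via 0x67543201 ∷
    26 via 0x87543201 ∷ 100 via 0x76543210 ∷ 98 via 0x70543216 ∷ 101 via 0x76543210 ∷
    97 via 0x876543210 ∷ 95 via 0x70543216 ∷ 87 via 0x876543210 ∷ 78 via 0x67534012 ∷
    66 via 0x786534012 ∷ 78 via 0x87534012 ∷ 66 via 0x798534012 ∷ 103 via 0x76543210 ∷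
    71 via 0x76210534 ∷ 67 via 0x687210534 ∷ 75 via 0x53120746 ∷ 68 via 0x687120543 ∷
    26 via 0x87543261 ∷ 53 via 0x987012543 ∷ [])) ∷
  (8 , (0x743 ∷ 0x754 ∷ 0x732 ∷ 0x621 ∷ 0x543 ∷ 0x210 ∷ []) , branch 0x42
    (9 via 0x62347015 ∷ 27 via 0x7102543 ∷ 9 via 0x02347615 ∷ 9 via 0x02347815 ∷ 38 via 0x5102473 ∷
    27 via 0x7162543 ∷ 42 via 0x87102534 ∷ [])) ∷
  (8 , (0x754 ∷ 0x732 ∷ 0x621 ∷ 0x543 ∷ 0x210 ∷ []) , branch 0x52
    (21 via 0x62547013 ∷ 95 via 0x76543210 ∷ 43 via 0x27610534 ∷ 21 via 0x62543017 ∷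
    43 via 0x27810534 ∷ 27 via 0x7102543 ∷ 21 via 0x02547613 ∷ 27 via 0x7012543 ∷
    21 via 0x02547813 ∷ 95 via 0x70543216 ∷ 86 via 0x876543210 ∷ 21 via 0x02543617 ∷
    43 via 0x27861534 ∷ 21 via 0x02543817 ∷ 48 via 0x27981534 ∷ 105 via 0x76543210 ∷
    27 via 0x7162543 ∷ 42 via 0x87102534 ∷ [])) ∷
  (8 , (0x732 ∷ 0x621 ∷ 0x543 ∷ 0x210 ∷ []) , branch 0x32
    (95 via 0x76543210 ∷ 95 via 0x76453210 ∷ 72 via 0x54016732 ∷ 78 via 0x07534612 ∷
    66 via 0x780534612 ∷ 77 via 0x61540723 ∷ 96 via 0x76543210 ∷ 75 via 0x53126740 ∷
    66 via 0x780621543 ∷ 96 via 0x76453210 ∷ 75 via 0x43126750 ∷ 66 via 0x780621453 ∷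
    40 via 0x76543102 ∷ 48 via 0x86543201 ∷ 54 via 0x543807612 ∷ 63 via 0x543980621 ∷
    104 via 0x76543210 ∷ 95 via 0x70543216 ∷ 87 via 0x876543210 ∷ 95 via 0x70453216 ∷
    87 via 0x876453210 ∷ 78 via 0x67534012 ∷ 66 via 0x786534012 ∷ 78 via 0x87534012 ∷
    66 via 0x798534012 ∷ 77 via 0x10546723 ∷ 106 via 0x76543210 ∷ 77 via 0x10548723 ∷
    75 via 0x53120746 ∷ 66 via 0x786120543 ∷ 68 via 0x687120543 ∷ 66 via 0x798120543 ∷
    75 via 0x43120756 ∷ 66 via 0x786120453 ∷ 68 via 0x687120453 ∷ 66 via 0x798120453 ∷
    54 via 0x543867012 ∷ 63 via 0x543986021 ∷ 55 via 0x987543102 ∷ 64 via 0xa98543210 ∷ [])) ∷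
  (8 , (0x620 ∷ 0x743 ∷ 0x621 ∷ 0x543 ∷ 0x210 ∷ []) , branch 0x42
    (105 via 0x17620345 ∷ 43 via 0x50743612 ∷ 39 via 0x6543210 ∷ 43 via 0x70543612 ∷
    47 via 0x80543612 ∷ 72 via 0x74126530 ∷ 105 via 0x67120345 ∷ 72 via 0x54126730 ∷
    72 via 0x54126830 ∷ 43 via 0x56743201 ∷ 43 via 0x07621453 ∷ 56 via 0x743850612 ∷
    43 via 0x76543201 ∷ 47 via 0x86543102 ∷ 56 via 0x543870612 ∷ 56 via 0x543980612 ∷
    72 via 0x74026531 ∷ 105 via 0x67021345 ∷ 72 via 0x54026731 ∷ 72 via 0x54026831 ∷
    43 via 0x56743210 ∷ 43 via 0x17620453 ∷ 56 via 0x743851602 ∷ 43 via 0x76543210 ∷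
    47 via 0x86543012 ∷ 56 via 0x543871602 ∷ 56 via 0x543981602 ∷ 72 via 0x74120536 ∷
    72 via 0x54120736 ∷ 72 via 0x54120836 ∷ 43 via 0x67021453 ∷ 56 via 0x743856102 ∷
    56 via 0x543876102 ∷ 56 via 0x543986102 ∷ [])) ∷
  (8 , (0x743 ∷ 0x621 ∷ 0x543 ∷ 0x210 ∷ []) , branch 0x31
    (107 via 0x07612435 ∷ 77 via 0x61437025 ∷ 108 via 0x76543210 ∷ 77 via 0x61435027 ∷
    70 via 0x780435621 ∷ 77 via 0x73216540 ∷ 106 via 0x67210435 ∷ 77 via 0x53216740 ∷
    77 via 0x53216840 ∷ 43 via 0x56743201 ∷ 43 via 0x07621453 ∷ 60 via 0x743850621 ∷
    43 via 0x76543201 ∷ 48 via 0x86543201 ∷ 60 via 0x621807543 ∷ 63 via 0x543980621 ∷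
    107 via 0x56734210 ∷ 107 via 0x67102435 ∷ 107 via 0x76534210 ∷ 107 via 0x86534210 ∷
    77 via 0x10437625 ∷ 106 via 0x76435210 ∷ 77 via 0x10437825 ∷ 77 via 0x10435627 ∷
    70 via 0x786435120 ∷ 77 via 0x10435827 ∷ 70 via 0x798435120 ∷ 77 via 0x73210546 ∷
    108 via 0x67021453 ∷ 70 via 0x685210743 ∷ 77 via 0x53210746 ∷ 77 via 0x53210846 ∷
    70 via 0x687210543 ∷ 70 via 0x698210543 ∷ 43 via 0x67021453 ∷ 60 via 0x743856021 ∷
    48 via 0x87210453 ∷ 63 via 0x210985743 ∷ 60 via 0x543876021 ∷ 63 via 0x543986021 ∷
    63 via 0x210987543 ∷ 64 via 0xa98543210 ∷ [])) ∷
  (7 , (0x310 ∷ 0x420 ∷ 0x320 ∷ 0x621 ∷ 0x543 ∷ 0x210 ∷ []) , branch 0x32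
    (5 via 0x0612543 ∷ closed ∷ 27 via 0x0543612 ∷ 22 via 0x70534612 ∷ 27 via 0x0612543 ∷
    22 via 0x70621543 ∷ 12 via 0x6032514 ∷ 12 via 0x5023641 ∷ 17 via 0x4651023 ∷
    90 via 0x76435120 ∷ 41 via 0x54761230 ∷ 17 via 0x1564032 ∷ 41 via 0x61754320 ∷ [])) ∷
  (7 , (0x540 ∷ 0x430 ∷ 0x420 ∷ 0x320 ∷ 0x621 ∷ 0x543 ∷ 0x210 ∷ []) , branch 0x42
    (27 via 0x0612543 ∷ 16 via 0x5612340 ∷ 27 via 0x0543612 ∷ 21 via 0x62543710 ∷
    38 via 0x5612430 ∷ 27 via 0x0162543 ∷ 41 via 0x73612504 ∷ 41 via 0x75612403 ∷
    16 via 0x0621543 ∷ 30 via 0x0261543 ∷ 28 via 0x5612340 ∷ 9 via 0x75304612 ∷ 43 via 0x20761534 ∷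
    16 via 0x0126543 ∷ 41 via 0x75612430 ∷ [])) ∷
  (7 , (0x541 ∷ 0x430 ∷ 0x420 ∷ 0x320 ∷ 0x621 ∷ 0x543 ∷ 0x210 ∷ []) , branch 0x42
    (12 via 0x6032514 ∷ closed ∷ 27 via 0x0543612 ∷ 22 via 0x70534612 ∷ 16 via 0x0621534 ∷
    17 via 0x6534210 ∷ 25 via 0x70612534 ∷ 13 via 0x0621435 ∷ 23 via 0x0534621 ∷ 28 via 0x2615403 ∷
    9 via 0x75304612 ∷ 44 via 0x54761032 ∷ 18 via 0x4356201 ∷ 25 via 0x61735024 ∷ [])) ∷
  (7 , (0x641 ∷ 0x430 ∷ 0x420 ∷ 0x320 ∷ 0x621 ∷ 0x543 ∷ 0x210 ∷ []) , branch 0x42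
    (12 via 0x5023641 ∷ 27 via 0x0543612 ∷ 22 via 0x70534612 ∷ 30 via 0x0261534 ∷ 1 via 0x6534210 ∷
    21 via 0x70612534 ∷ 23 via 0x0543621 ∷ 29 via 0x5614230 ∷ 11 via 0x56731024 ∷
    28 via 0x2615403 ∷ 44 via 0x54761032 ∷ 23 via 0x0543126 ∷ 41 via 0x61753240 ∷
    11 via 0x51736024 ∷ [])) ∷
  (7 , (0x654 ∷ 0x430 ∷ 0x420 ∷ 0x320 ∷ 0x621 ∷ 0x543 ∷ 0x210 ∷ []) , branch 0x42
    (17 via 0x1564032 ∷ 27 via 0x0543612 ∷ 16 via 0x0126534 ∷ 12 via 0x1032564 ∷
    25 via 0x70162534 ∷ 18 via 0x3456201 ∷ 23 via 0x0534126 ∷ 24 via 0x6453210 ∷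
    31 via 0x76534210 ∷ 13 via 0x0126435 ∷ 25 via 0x16735024 ∷ 9 via 0x75304162 ∷ [])) ∷
  (7 , (0x430 ∷ 0x420 ∷ 0x320 ∷ 0x621 ∷ 0x543 ∷ 0x210 ∷ []) , branch 0x32
    (110 via 0x6534210 ∷ closed ∷ 27 via 0x0543612 ∷ 22 via 0x70534612 ∷ 111 via 0x6543210 ∷
    110 via 0x5162430 ∷ 73 via 0x53126740 ∷ 30 via 0x6543210 ∷ 41 via 0x75612403 ∷
    22 via 0x70534162 ∷ 52 via 0x543870612 ∷ 112 via 0x6543210 ∷ 113 via 0x6543210 ∷
    89 via 0x76534120 ∷ 28 via 0x2615403 ∷ 9 via 0x75304612 ∷ 44 via 0x54761032 ∷
    47 via 0x54871230 ∷ 114 via 0x6543210 ∷ 71 via 0x61745320 ∷ 76 via 0x76021543 ∷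
    9 via 0x75304162 ∷ [])) ∷
  (7 , (0x630 ∷ 0x420 ∷ 0x320 ∷ 0x621 ∷ 0x543 ∷ 0x210 ∷ []) , branch 0x32
    (16 via 0x6534210 ∷ 27 via 0x0162543 ∷ 5 via 0x0162543 ∷ 21 via 0x53216740 ∷
    22 via 0x70534162 ∷ 17 via 0x6534210 ∷ 1 via 0x6534210 ∷ 17 via 0x4156023 ∷ 15 via 0x36715402 ∷
    25 via 0x76543210 ∷ 12 via 0x1032564 ∷ 41 via 0x36754102 ∷ [])) ∷
  (7 , (0x540 ∷ 0x431 ∷ 0x420 ∷ 0x320 ∷ 0x621 ∷ 0x543 ∷ 0x210 ∷ []) , branch 0x42
    (30 via 0x0261543 ∷ 12 via 0x6435210 ∷ [])) ∷
  (7 , (0x541 ∷ 0x431 ∷ 0x420 ∷ 0x320 ∷ 0x621 ∷ 0x543 ∷ 0x210 ∷ []) , branch 0x42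
    (23 via 0x0534621 ∷ 27 via 0x4615203 ∷ [])) ∷
  (7 , (0x641 ∷ 0x431 ∷ 0x420 ∷ 0x320 ∷ 0x621 ∷ 0x543 ∷ 0x210 ∷ []) , branch 0x42
    (27 via 0x0543612 ∷ 30 via 0x0261534 ∷ 23 via 0x0543621 ∷ 29 via 0x5614230 ∷
    11 via 0x56731024 ∷ 27 via 0x4615203 ∷ 42 via 0x54761230 ∷ 12 via 0x5146032 ∷ [])) ∷
  (7 , (0x654 ∷ 0x431 ∷ 0x420 ∷ 0x320 ∷ 0x621 ∷ 0x543 ∷ 0x210 ∷ []) , branch 0x42
    (12 via 0x5136042 ∷ 27 via 0x4615203 ∷ [])) ∷
  (7 , (0x431 ∷ 0x420 ∷ 0x320 ∷ 0x621 ∷ 0x543 ∷ 0x210 ∷ []) , branch 0x32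
    (27 via 0x0543612 ∷ 22 via 0x70534612 ∷ 117 via 0x6543210 ∷ 17 via 0x6453210 ∷
    25 via 0x70612453 ∷ 118 via 0x6543210 ∷ 119 via 0x6543210 ∷ 89 via 0x76534120 ∷
    27 via 0x4615203 ∷ 27 via 0x4715203 ∷ 42 via 0x54761230 ∷ 42 via 0x54871230 ∷
    120 via 0x6543210 ∷ 40 via 0x14756032 ∷ [])) ∷
  (7 , (0x631 ∷ 0x420 ∷ 0x320 ∷ 0x621 ∷ 0x543 ∷ 0x210 ∷ []) , branch 0x32
    (12 via 0x5024631 ∷ 3 via 0x5024631 ∷ 27 via 0x0543612 ∷ 22 via 0x70534612 ∷ 30 via 0x0261543 ∷
    1 via 0x6543210 ∷ 21 via 0x70612543 ∷ 1 via 0x6453210 ∷ 21 via 0x70612453 ∷ 22 via 0x70534162 ∷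
    23 via 0x0534621 ∷ 29 via 0x5614230 ∷ 11 via 0x56741023 ∷ 30 via 0x4561203 ∷
    21 via 0x75204613 ∷ 44 via 0x54761032 ∷ 23 via 0x0534126 ∷ 45 via 0x61754230 ∷
    11 via 0x51746023 ∷ 21 via 0x76201453 ∷ [])) ∷
  (7 , (0x540 ∷ 0x643 ∷ 0x420 ∷ 0x320 ∷ 0x621 ∷ 0x543 ∷ 0x210 ∷ []) , branch 0x42
    (18 via 0x0126453 ∷ 16 via 0x0126453 ∷ 8 via 0x3450621 ∷ 30 via 0x0261543 ∷ 17 via 0x0126453 ∷
    41 via 0x20716534 ∷ 28 via 0x6210534 ∷ 21 via 0x12540763 ∷ [])) ∷
  (7 , (0x541 ∷ 0x643 ∷ 0x420 ∷ 0x320 ∷ 0x621 ∷ 0x543 ∷ 0x210 ∷ []) , branch 0x42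
    (3 via 0x6203541 ∷ 8 via 0x4350621 ∷ 1 via 0x6514032 ∷ 4 via 0x6541023 ∷ 12 via 0x5631042 ∷
    27 via 0x4165203 ∷ 40 via 0x64751032 ∷ 21 via 0x76203514 ∷ 3 via 0x1635042 ∷
    25 via 0x76541032 ∷ [])) ∷
  (7 , (0x654 ∷ 0x643 ∷ 0x420 ∷ 0x320 ∷ 0x621 ∷ 0x543 ∷ 0x210 ∷ []) , branch 0x42
    (28 via 0x6210543 ∷ 3 via 0x1645032 ∷ 23 via 0x0534126 ∷ 27 via 0x4165203 ∷ 31 via 0x76534210 ∷
    39 via 0x6210543 ∷ 11 via 0x70162543 ∷ [])) ∷
  (7 , (0x643 ∷ 0x420 ∷ 0x320 ∷ 0x621 ∷ 0x543 ∷ 0x210 ∷ []) , branch 0x32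
    (closed ∷ 27 via 0x0543612 ∷ 22 via 0x70534612 ∷ 123 via 0x6543210 ∷ 116 via 0x6534210 ∷
    73 via 0x53126740 ∷ 25 via 0x70162453 ∷ 22 via 0x70534162 ∷ 124 via 0x6543210 ∷
    122 via 0x6534210 ∷ 27 via 0x4165203 ∷ 40 via 0x64751032 ∷ 42 via 0x54716230 ∷
    125 via 0x6543210 ∷ 73 via 0x16547023 ∷ 76 via 0x76021543 ∷ 27 via 0x4765203 ∷
    42 via 0x54876230 ∷ [])) ∷
  (7 , (0x420 ∷ 0x320 ∷ 0x621 ∷ 0x543 ∷ 0x210 ∷ []) , branch 0x52
    (110 via 0x6543210 ∷ 110 via 0x6534210 ∷ 27 via 0x0543612 ∷ 22 via 0x70534612 ∷
    115 via 0x6543210 ∷ 116 via 0x6543210 ∷ 73 via 0x54126730 ∷ 116 via 0x6534210 ∷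
    73 via 0x53126740 ∷ 22 via 0x70534162 ∷ 52 via 0x543870612 ∷ 121 via 0x6543210 ∷
    122 via 0x6543210 ∷ 89 via 0x76543120 ∷ 122 via 0x6534210 ∷ 89 via 0x76534120 ∷
    44 via 0x54761032 ∷ 48 via 0x54871230 ∷ 126 via 0x6543210 ∷ 107 via 0x07612435 ∷
    76 via 0x76021534 ∷ 66 via 0x087621534 ∷ 76 via 0x76021543 ∷ 66 via 0x087621543 ∷
    48 via 0x54876230 ∷ [])) ∷
  (7 , (0x410 ∷ 0x620 ∷ 0x320 ∷ 0x621 ∷ 0x543 ∷ 0x210 ∷ []) , branch 0x42
    (27 via 0x0534621 ∷ 27 via 0x0354621 ∷ 16 via 0x1543260 ∷ 41 via 0x71543602 ∷
    30 via 0x1453620 ∷ 16 via 0x6534120 ∷ 21 via 0x54621730 ∷ 8 via 0x0621543 ∷ 7 via 0x43621750 ∷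
    7 via 0x21543760 ∷ 30 via 0x0453621 ∷ 1 via 0x0543621 ∷ 16 via 0x6354021 ∷ 21 via 0x34620751 ∷
    25 via 0x54761230 ∷ 17 via 0x1543260 ∷ 41 via 0x41753602 ∷ 9 via 0x34120756 ∷ [])) ∷
  (7 , (0x430 ∷ 0x540 ∷ 0x620 ∷ 0x320 ∷ 0x621 ∷ 0x543 ∷ 0x210 ∷ []) , branch 0x42
    (27 via 0x0612543 ∷ 16 via 0x3621540 ∷ 30 via 0x3261540 ∷ 21 via 0x62543710 ∷
    38 via 0x5612430 ∷ 27 via 0x0162543 ∷ 42 via 0x70612534 ∷ 16 via 0x3126540 ∷
    41 via 0x75612403 ∷ 21 via 0x12543760 ∷ 50 via 0x612543870 ∷ 16 via 0x0621543 ∷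
    28 via 0x0543621 ∷ 28 via 0x0435621 ∷ 16 via 0x0126543 ∷ [])) ∷
  (7 , (0x431 ∷ 0x540 ∷ 0x620 ∷ 0x320 ∷ 0x621 ∷ 0x543 ∷ 0x210 ∷ []) , branch 0x42
    (16 via 0x0621453 ∷ 17 via 0x6453210 ∷ 25 via 0x70612453 ∷ 28 via 0x0543621 ∷
    12 via 0x6435210 ∷ [])) ∷
  (7 , (0x641 ∷ 0x540 ∷ 0x620 ∷ 0x320 ∷ 0x621 ∷ 0x543 ∷ 0x210 ∷ []) , branch 0x42
    (16 via 0x6345021 ∷ 30 via 0x3261540 ∷ 21 via 0x62543710 ∷ 28 via 0x0534621 ∷
    16 via 0x0354126 ∷ 9 via 0x34126750 ∷ 21 via 0x12543760 ∷ 12 via 0x6534210 ∷ 23 via 0x6534210 ∷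
    27 via 0x6354201 ∷ 42 via 0x76534210 ∷ 12 via 0x1534260 ∷ [])) ∷
  (7 , (0x540 ∷ 0x620 ∷ 0x320 ∷ 0x621 ∷ 0x543 ∷ 0x210 ∷ []) , branch 0x52
    (27 via 0x0612543 ∷ 128 via 0x6543210 ∷ 30 via 0x3261540 ∷ 21 via 0x62543710 ∷
    129 via 0x6543210 ∷ 27 via 0x0162543 ∷ 42 via 0x70612534 ∷ 128 via 0x1543260 ∷
    72 via 0x53126740 ∷ 21 via 0x12543760 ∷ 50 via 0x612543870 ∷ 130 via 0x6543210 ∷
    28 via 0x0543621 ∷ 21 via 0x62540713 ∷ 131 via 0x6543210 ∷ 43 via 0x20761534 ∷
    130 via 0x1543260 ∷ 21 via 0x12540763 ∷ [])) ∷
  (7 , (0x430 ∷ 0x541 ∷ 0x620 ∷ 0x320 ∷ 0x621 ∷ 0x543 ∷ 0x210 ∷ []) , branch 0x42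
    (30 via 0x0354621 ∷ 30 via 0x1543620 ∷ 28 via 0x1543260 ∷ 41 via 0x71543602 ∷
    28 via 0x0621534 ∷ 28 via 0x1543620 ∷ 31 via 0x70612534 ∷ 18 via 0x0261435 ∷
    41 via 0x70621354 ∷ 26 via 0x70543261 ∷ 28 via 0x1620453 ∷ 30 via 0x6354201 ∷
    24 via 0x1260453 ∷ 31 via 0x71602453 ∷ 31 via 0x71534260 ∷ 18 via 0x6154023 ∷
    26 via 0x73620451 ∷ [])) ∷
  (7 , (0x431 ∷ 0x541 ∷ 0x620 ∷ 0x320 ∷ 0x621 ∷ 0x543 ∷ 0x210 ∷ []) , branch 0x42
    (30 via 0x0354621 ∷ 30 via 0x0543621 ∷ 28 via 0x1543260 ∷ 41 via 0x71543602 ∷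
    28 via 0x1620543 ∷ 28 via 0x1543620 ∷ 31 via 0x70612534 ∷ 17 via 0x6453210 ∷ 39 via 0x1620543 ∷
    30 via 0x6354201 ∷ 45 via 0x71620534 ∷ 28 via 0x3206541 ∷ 44 via 0x71620453 ∷
    31 via 0x71534260 ∷ 28 via 0x1206543 ∷ [])) ∷
  (7 , (0x641 ∷ 0x541 ∷ 0x620 ∷ 0x320 ∷ 0x621 ∷ 0x543 ∷ 0x210 ∷ []) , branch 0x42
    (16 via 0x6543021 ∷ 16 via 0x6345021 ∷ 28 via 0x1543260 ∷ 41 via 0x70534216 ∷
    24 via 0x1260543 ∷ 16 via 0x0534126 ∷ 9 via 0x54126730 ∷ 16 via 0x0354126 ∷ 9 via 0x34126750 ∷
    26 via 0x70543261 ∷ 28 via 0x3206451 ∷ 27 via 0x6534201 ∷ 27 via 0x6354201 ∷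
    21 via 0x34206751 ∷ 31 via 0x71534260 ∷ 30 via 0x1453206 ∷ 31 via 0x75461230 ∷ [])) ∷
  (7 , (0x643 ∷ 0x541 ∷ 0x620 ∷ 0x320 ∷ 0x621 ∷ 0x543 ∷ 0x210 ∷ []) , branch 0x42
    (17 via 0x1453260 ∷ 28 via 0x1543260 ∷ 18 via 0x6145023 ∷ 16 via 0x3541206 ∷
    25 via 0x54703216 ∷ 28 via 0x1206453 ∷ 27 via 0x6514203 ∷ 30 via 0x1543206 ∷
    31 via 0x75463210 ∷ 21 via 0x54203716 ∷ 27 via 0x6154203 ∷ 31 via 0x76210534 ∷ [])) ∷
  (7 , (0x541 ∷ 0x620 ∷ 0x320 ∷ 0x621 ∷ 0x543 ∷ 0x210 ∷ []) , branch 0x52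
    (30 via 0x0354621 ∷ 128 via 0x6543210 ∷ 28 via 0x1543260 ∷ 41 via 0x71543602 ∷
    133 via 0x6543210 ∷ 28 via 0x1543620 ∷ 31 via 0x70612534 ∷ 128 via 0x1543260 ∷
    72 via 0x53126740 ∷ 26 via 0x70543261 ∷ 53 via 0x870612543 ∷ 134 via 0x6543210 ∷
    30 via 0x6354201 ∷ 45 via 0x71620534 ∷ 135 via 0x6543210 ∷ 72 via 0x53026741 ∷
    31 via 0x71534260 ∷ 56 via 0x543871602 ∷ 136 via 0x6543210 ∷ 72 via 0x73026541 ∷
    31 via 0x76210534 ∷ [])) ∷
  (7 , (0x641 ∷ 0x620 ∷ 0x320 ∷ 0x621 ∷ 0x543 ∷ 0x210 ∷ []) , branch 0x42
    (16 via 0x6543021 ∷ 16 via 0x6345021 ∷ 38 via 0x6543120 ∷ 41 via 0x70534216 ∷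
    28 via 0x0534621 ∷ 16 via 0x0534126 ∷ 9 via 0x54126730 ∷ 16 via 0x0354126 ∷ 9 via 0x34126750 ∷
    41 via 0x76543102 ∷ 30 via 0x6453201 ∷ 27 via 0x6534201 ∷ 21 via 0x54206731 ∷
    27 via 0x6354201 ∷ 21 via 0x34206751 ∷ 42 via 0x76534210 ∷ 30 via 0x1453206 ∷
    43 via 0x46753210 ∷ 21 via 0x54201736 ∷ 21 via 0x34201756 ∷ [])) ∷
  (7 , (0x620 ∷ 0x320 ∷ 0x621 ∷ 0x543 ∷ 0x210 ∷ []) , branch 0x32
    (128 via 0x6543210 ∷ 128 via 0x6453210 ∷ 38 via 0x6543120 ∷ 41 via 0x71543602 ∷
    132 via 0x6543210 ∷ 128 via 0x1543260 ∷ 72 via 0x53126740 ∷ 128 via 0x1453260 ∷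
    72 via 0x43126750 ∷ 41 via 0x76543102 ∷ 55 via 0x612870543 ∷ 137 via 0x6543210 ∷
    138 via 0x6543210 ∷ 72 via 0x53026741 ∷ 138 via 0x6453210 ∷ 72 via 0x43026751 ∷
    47 via 0x76543012 ∷ 56 via 0x543871602 ∷ 137 via 0x1543260 ∷ 77 via 0x61547023 ∷
    72 via 0x53120746 ∷ 72 via 0x43120756 ∷ 56 via 0x543876102 ∷ [])) ∷
  (7 , (0x410 ∷ 0x540 ∷ 0x320 ∷ 0x621 ∷ 0x543 ∷ 0x210 ∷ []) , branch 0x42
    (27 via 0x0612543 ∷ 115 via 0x6354120 ∷ 30 via 0x3261540 ∷ 21 via 0x62543710 ∷
    16 via 0x3621450 ∷ 27 via 0x0162543 ∷ 41 via 0x73621504 ∷ 8 via 0x0621543 ∷ 7 via 0x43621750 ∷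
    1 via 0x0621543 ∷ 30 via 0x0261543 ∷ 17 via 0x3621450 ∷ 91 via 0x76435120 ∷ 41 via 0x23761504 ∷
    18 via 0x0126543 ∷ 25 via 0x73612450 ∷ 15 via 0x41765302 ∷ [])) ∷
  (7 , (0x430 ∷ 0x540 ∷ 0x320 ∷ 0x621 ∷ 0x543 ∷ 0x210 ∷ []) , branch 0x42
    (27 via 0x0612543 ∷ 16 via 0x3621540 ∷ 30 via 0x3261540 ∷ 21 via 0x62543710 ∷
    38 via 0x5612430 ∷ 27 via 0x0162543 ∷ 42 via 0x70612534 ∷ 16 via 0x3126540 ∷
    41 via 0x75612403 ∷ 21 via 0x12543760 ∷ 50 via 0x612543870 ∷ 16 via 0x0621543 ∷
    30 via 0x0261543 ∷ 21 via 0x62540713 ∷ 28 via 0x5612340 ∷ 9 via 0x62340715 ∷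
    43 via 0x20761534 ∷ 16 via 0x0126543 ∷ 41 via 0x75612430 ∷ 21 via 0x12540763 ∷
    9 via 0x12340765 ∷ [])) ∷
  (7 , (0x640 ∷ 0x540 ∷ 0x320 ∷ 0x621 ∷ 0x543 ∷ 0x210 ∷ []) , branch 0x42
    (8 via 0x0126543 ∷ 16 via 0x6543210 ∷ 7 via 0x62534710 ∷ 16 via 0x3126450 ∷ 27 via 0x6534210 ∷
    21 via 0x54216730 ∷ 7 via 0x43126750 ∷ 21 via 0x12543760 ∷ 17 via 0x6543210 ∷ 1 via 0x6543210 ∷
    17 via 0x3126450 ∷ 15 via 0x46715302 ∷ 25 via 0x76534210 ∷ 1 via 0x0126543 ∷
    25 via 0x73162450 ∷ [])) ∷
  (7 , (0x431 ∷ 0x540 ∷ 0x320 ∷ 0x621 ∷ 0x543 ∷ 0x210 ∷ []) , branch 0x42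
    (27 via 0x0612543 ∷ 1 via 0x0621453 ∷ 30 via 0x3261540 ∷ 21 via 0x62543710 ∷ 16 via 0x0621453 ∷
    41 via 0x70621534 ∷ 17 via 0x6453210 ∷ 25 via 0x70612453 ∷ 30 via 0x0261543 ∷
    21 via 0x62540713 ∷ 12 via 0x6435210 ∷ 41 via 0x20761534 ∷ 8 via 0x3540621 ∷ [])) ∷
  (7 , (0x641 ∷ 0x540 ∷ 0x320 ∷ 0x621 ∷ 0x543 ∷ 0x210 ∷ []) , branch 0x42
    (27 via 0x0612543 ∷ 17 via 0x3621540 ∷ 30 via 0x3261540 ∷ 21 via 0x62543710 ∷
    28 via 0x4612350 ∷ 27 via 0x0162543 ∷ 42 via 0x70612534 ∷ 17 via 0x3126540 ∷
    26 via 0x70612354 ∷ 21 via 0x12543760 ∷ 12 via 0x6534210 ∷ 23 via 0x6534210 ∷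
    11 via 0x75614203 ∷ 27 via 0x5203614 ∷ 22 via 0x75230614 ∷ 43 via 0x20761534 ∷
    17 via 0x0126543 ∷ 25 via 0x64735210 ∷ 21 via 0x12540763 ∷ 22 via 0x75230164 ∷ [])) ∷
  (7 , (0x643 ∷ 0x540 ∷ 0x320 ∷ 0x621 ∷ 0x543 ∷ 0x210 ∷ []) , branch 0x42
    (27 via 0x0612543 ∷ 18 via 0x0126453 ∷ 30 via 0x3261540 ∷ 21 via 0x62543710 ∷
    16 via 0x0126453 ∷ 27 via 0x0162543 ∷ 41 via 0x70216534 ∷ 1 via 0x0126453 ∷ 25 via 0x70162453 ∷
    8 via 0x3450621 ∷ 30 via 0x0261543 ∷ 17 via 0x0126453 ∷ 15 via 0x64751230 ∷ 41 via 0x20716534 ∷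
    28 via 0x6210534 ∷ 7 via 0x40126753 ∷ 21 via 0x12540763 ∷ [])) ∷
  (7 , (0x540 ∷ 0x320 ∷ 0x621 ∷ 0x543 ∷ 0x210 ∷ []) , branch 0x52
    (27 via 0x0612543 ∷ 140 via 0x6543210 ∷ 30 via 0x3261540 ∷ 21 via 0x62543710 ∷
    141 via 0x6543210 ∷ 27 via 0x0162543 ∷ 42 via 0x70612534 ∷ 142 via 0x6543210 ∷
    73 via 0x53126740 ∷ 21 via 0x12543760 ∷ 50 via 0x612543870 ∷ 143 via 0x6543210 ∷
    30 via 0x0261543 ∷ 21 via 0x62540713 ∷ 144 via 0x6543210 ∷ 91 via 0x76534120 ∷
    43 via 0x20761534 ∷ 46 via 0x23871504 ∷ 145 via 0x6543210 ∷ 73 via 0x73126540 ∷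
    21 via 0x12540763 ∷ 50 via 0x612540873 ∷ 76 via 0x76021543 ∷ [])) ∷
  (7 , (0x640 ∷ 0x320 ∷ 0x621 ∷ 0x543 ∷ 0x210 ∷ []) , branch 0x42
    (closed ∷ 8 via 0x0126543 ∷ 16 via 0x6543210 ∷ 7 via 0x62534710 ∷ 30 via 0x6453210 ∷
    27 via 0x6534210 ∷ 21 via 0x54216730 ∷ 27 via 0x6354210 ∷ 7 via 0x43126750 ∷
    41 via 0x76543102 ∷ 17 via 0x6543210 ∷ 1 via 0x6543210 ∷ 96 via 0x76543120 ∷ 18 via 0x6543210 ∷
    15 via 0x46715302 ∷ 25 via 0x76534210 ∷ 30 via 0x0453216 ∷ 41 via 0x46753102 ∷
    21 via 0x54210736 ∷ 21 via 0x34210756 ∷ [])) ∷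
  (7 , (0x410 ∷ 0x542 ∷ 0x320 ∷ 0x621 ∷ 0x543 ∷ 0x210 ∷ []) , branch 0x42
    (12 via 0x6031524 ∷ 30 via 0x0354612 ∷ 21 via 0x70543612 ∷ 1 via 0x0612534 ∷ 3 via 0x1036524 ∷
    25 via 0x70621534 ∷ 4 via 0x0621543 ∷ 3 via 0x0453621 ∷ 40 via 0x02761534 ∷ 8 via 0x2536410 ∷
    [])) ∷
  (7 , (0x431 ∷ 0x541 ∷ 0x542 ∷ 0x320 ∷ 0x621 ∷ 0x543 ∷ 0x210 ∷ []) , branch 0x42
    (29 via 0x6031524 ∷ 29 via 0x6021534 ∷ [])) ∷
  (7 , (0x541 ∷ 0x542 ∷ 0x320 ∷ 0x621 ∷ 0x543 ∷ 0x210 ∷ []) , branch 0x52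
    (29 via 0x6031524 ∷ 148 via 0x6543210 ∷ 30 via 0x0354612 ∷ 21 via 0x70543612 ∷
    122 via 0x0612435 ∷ 27 via 0x1360542 ∷ 42 via 0x61730524 ∷ 73 via 0x53126740 ∷
    21 via 0x70543162 ∷ 42 via 0x61870524 ∷ 149 via 0x6543210 ∷ 29 via 0x6021534 ∷
    19 via 0x07621534 ∷ 122 via 0x6032415 ∷ 89 via 0x67032145 ∷ 45 via 0x03761524 ∷
    46 via 0x03871524 ∷ 124 via 0x6021435 ∷ 89 via 0x07612345 ∷ 21 via 0x76541032 ∷ [])) ∷
  (7 , (0x641 ∷ 0x542 ∷ 0x320 ∷ 0x621 ∷ 0x543 ∷ 0x210 ∷ []) , branch 0x42
    (23 via 0x0621534 ∷ 3 via 0x0543621 ∷ 30 via 0x0354612 ∷ 21 via 0x70543612 ∷ 30 via 0x4530612 ∷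
    17 via 0x0534126 ∷ 41 via 0x54730621 ∷ 12 via 0x6534012 ∷ 23 via 0x6534012 ∷
    11 via 0x75614023 ∷ 27 via 0x5023614 ∷ 22 via 0x75032614 ∷ 44 via 0x02761534 ∷
    12 via 0x0543126 ∷ 21 via 0x75614032 ∷ 11 via 0x01736542 ∷ [])) ∷
  (7 , (0x654 ∷ 0x542 ∷ 0x320 ∷ 0x621 ∷ 0x543 ∷ 0x210 ∷ []) , branch 0x42
    (28 via 0x3546201 ∷ 148 via 0x6453210 ∷ 28 via 0x6543210 ∷ 21 via 0x70543612 ∷
    122 via 0x0162534 ∷ 29 via 0x1036524 ∷ 31 via 0x73564201 ∷ 145 via 0x3120546 ∷
    73 via 0x43126750 ∷ 21 via 0x70543162 ∷ 46 via 0x16870524 ∷ 145 via 0x6021543 ∷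
    29 via 0x0162534 ∷ 21 via 0x71546032 ∷ 122 via 0x1032564 ∷ 73 via 0x46023751 ∷
    31 via 0x76534210 ∷ 46 via 0x03871524 ∷ 139 via 0x6102534 ∷ 76 via 0x73120456 ∷
    19 via 0x07126534 ∷ 76 via 0x76021453 ∷ [])) ∷
  (7 , (0x542 ∷ 0x320 ∷ 0x621 ∷ 0x543 ∷ 0x210 ∷ []) , branch 0x32
    (148 via 0x6543210 ∷ 148 via 0x6453210 ∷ 30 via 0x0354612 ∷ 21 via 0x70543612 ∷
    146 via 0x6543210 ∷ 147 via 0x6543210 ∷ 73 via 0x53126740 ∷ 147 via 0x6453210 ∷
    73 via 0x43126750 ∷ 21 via 0x70543162 ∷ 50 via 0x870543612 ∷ 150 via 0x6543210 ∷
    151 via 0x6543210 ∷ 92 via 0x76534120 ∷ 151 via 0x6453210 ∷ 92 via 0x76435120 ∷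
    45 via 0x03761524 ∷ 46 via 0x03871524 ∷ 152 via 0x6543210 ∷ 77 via 0x61547023 ∷
    76 via 0x76021543 ∷ 66 via 0x087621543 ∷ 76 via 0x76021453 ∷ 66 via 0x087621453 ∷
    48 via 0x02876534 ∷ [])) ∷
  (7 , (0x310 ∷ 0x642 ∷ 0x320 ∷ 0x621 ∷ 0x543 ∷ 0x210 ∷ []) , branch 0x32
    (12 via 0x5013642 ∷ 17 via 0x5642013 ∷ 16 via 0x6543012 ∷ 25 via 0x70543612 ∷
    27 via 0x0612543 ∷ 147 via 0x6543210 ∷ 22 via 0x70621543 ∷ 23 via 0x0612534 ∷
    13 via 0x6543210 ∷ 11 via 0x70543621 ∷ 20 via 0x6534021 ∷ 25 via 0x64715023 ∷
    25 via 0x76534012 ∷ 28 via 0x3546201 ∷ 44 via 0x61754023 ∷ 9 via 0x76201543 ∷ [])) ∷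
  (7 , (0x410 ∷ 0x642 ∷ 0x320 ∷ 0x621 ∷ 0x543 ∷ 0x210 ∷ []) , branch 0x42
    (12 via 0x5013642 ∷ 3 via 0x3015642 ∷ 1 via 0x0534612 ∷ 25 via 0x70543612 ∷ 30 via 0x0162534 ∷
    21 via 0x70621534 ∷ 4 via 0x0612534 ∷ 8 via 0x4516320 ∷ 3 via 0x0261543 ∷ 40 via 0x04753612 ∷
    [])) ∷
  (7 , (0x531 ∷ 0x430 ∷ 0x642 ∷ 0x320 ∷ 0x621 ∷ 0x543 ∷ 0x210 ∷ []) , branch 0x32
    (17 via 0x5612340 ∷ 17 via 0x6543210 ∷ 12 via 0x6032541 ∷ 12 via 0x5023614 ∷ 17 via 0x4561032 ∷
    41 via 0x64751320 ∷ 17 via 0x1654023 ∷ 41 via 0x53746012 ∷ [])) ∷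
  (7 , (0x430 ∷ 0x642 ∷ 0x320 ∷ 0x621 ∷ 0x543 ∷ 0x210 ∷ []) , branch 0x42
    (112 via 0x5621340 ∷ 17 via 0x5612340 ∷ 16 via 0x6543012 ∷ 25 via 0x70543612 ∷
    139 via 0x5612340 ∷ 117 via 0x5126340 ∷ 76 via 0x70621534 ∷ 41 via 0x75612403 ∷
    41 via 0x76543102 ∷ 54 via 0x870543162 ∷ 156 via 0x6543210 ∷ 18 via 0x4561032 ∷
    41 via 0x64751320 ∷ 25 via 0x76534012 ∷ 145 via 0x0534216 ∷ 73 via 0x10537624 ∷
    25 via 0x76102354 ∷ [])) ∷
  (7 , (0x431 ∷ 0x642 ∷ 0x320 ∷ 0x621 ∷ 0x543 ∷ 0x210 ∷ []) , branch 0x42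
    (154 via 0x6543210 ∷ 3 via 0x0345612 ∷ 25 via 0x70543612 ∷ 145 via 0x0621354 ∷
    3 via 0x6435012 ∷ 25 via 0x76534012 ∷ [])) ∷
  (7 , (0x642 ∷ 0x320 ∷ 0x621 ∷ 0x543 ∷ 0x210 ∷ []) , branch 0x52
    (154 via 0x6543210 ∷ 155 via 0x6543210 ∷ 16 via 0x6543012 ∷ 25 via 0x70543612 ∷
    157 via 0x6543210 ∷ 147 via 0x0534216 ∷ 76 via 0x70621534 ∷ 147 via 0x6543210 ∷
    73 via 0x53126740 ∷ 41 via 0x76543102 ∷ 54 via 0x870543162 ∷ 158 via 0x6543210 ∷
    155 via 0x0534216 ∷ 93 via 0x70543126 ∷ 154 via 0x0534216 ∷ 93 via 0x76534120 ∷
    25 via 0x76534012 ∷ 36 via 0x654871032 ∷ 157 via 0x0534216 ∷ 107 via 0x67102435 ∷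
    73 via 0x54120736 ∷ 66 via 0x687120534 ∷ 76 via 0x76021543 ∷ 66 via 0x087621543 ∷
    54 via 0x876534102 ∷ [])) ∷
  (7 , (0x410 ∷ 0x654 ∷ 0x320 ∷ 0x621 ∷ 0x543 ∷ 0x210 ∷ []) , branch 0x42
    (17 via 0x2564031 ∷ 126 via 0x6354120 ∷ 17 via 0x2534160 ∷ 26 via 0x70543216 ∷
    18 via 0x0216534 ∷ 3 via 0x1032564 ∷ 25 via 0x70261534 ∷ 8 via 0x0621543 ∷ 7 via 0x43621750 ∷
    8 via 0x1546320 ∷ 3 via 0x0162534 ∷ 18 via 0x1203564 ∷ 7 via 0x64302751 ∷ 25 via 0x20761534 ∷
    20 via 0x0261543 ∷ 15 via 0x40735612 ∷ 15 via 0x41765302 ∷ [])) ∷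
  (7 , (0x430 ∷ 0x654 ∷ 0x320 ∷ 0x621 ∷ 0x543 ∷ 0x210 ∷ []) , branch 0x42
    (28 via 0x3546201 ∷ 18 via 0x0216435 ∷ 28 via 0x6543210 ∷ 26 via 0x70543216 ∷
    28 via 0x0216534 ∷ 30 via 0x0354216 ∷ 31 via 0x73564201 ∷ 30 via 0x6543210 ∷
    41 via 0x70216354 ∷ 41 via 0x76543102 ∷ 18 via 0x3456201 ∷ 30 via 0x6120543 ∷
    41 via 0x73546012 ∷ 24 via 0x6453210 ∷ 26 via 0x75304612 ∷ 31 via 0x76534210 ∷
    28 via 0x6210453 ∷ 26 via 0x73210456 ∷ 41 via 0x76210534 ∷ 31 via 0x76201453 ∷ [])) ∷
  (7 , (0x643 ∷ 0x654 ∷ 0x320 ∷ 0x621 ∷ 0x543 ∷ 0x210 ∷ []) , branch 0x42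
    (28 via 0x3546201 ∷ 20 via 0x0261453 ∷ 28 via 0x6543210 ∷ 26 via 0x70543216 ∷
    28 via 0x6210543 ∷ 30 via 0x0354216 ∷ 31 via 0x73564201 ∷ 30 via 0x0543216 ∷
    25 via 0x70162453 ∷ 41 via 0x76543102 ∷ 30 via 0x1564203 ∷ 30 via 0x6120543 ∷
    41 via 0x73546012 ∷ 28 via 0x3201645 ∷ 25 via 0x71032456 ∷ 31 via 0x76534210 ∷
    39 via 0x6210543 ∷ 44 via 0x73021456 ∷ 45 via 0x76120534 ∷ 44 via 0x76120453 ∷ [])) ∷
  (7 , (0x654 ∷ 0x320 ∷ 0x621 ∷ 0x543 ∷ 0x210 ∷ []) , branch 0x52
    (28 via 0x3546201 ∷ 160 via 0x6543210 ∷ 28 via 0x6543210 ∷ 26 via 0x70543216 ∷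
    161 via 0x6543210 ∷ 30 via 0x0354216 ∷ 31 via 0x73564201 ∷ 145 via 0x3120456 ∷
    73 via 0x53126740 ∷ 41 via 0x76543102 ∷ 53 via 0x870162543 ∷ 145 via 0x6021453 ∷
    30 via 0x6120543 ∷ 41 via 0x73546012 ∷ 161 via 0x3546201 ∷ 73 via 0x56023741 ∷
    31 via 0x76534210 ∷ 53 via 0x871032546 ∷ 162 via 0x6543210 ∷ 76 via 0x73120546 ∷
    45 via 0x76120534 ∷ 57 via 0x546873102 ∷ 76 via 0x76021543 ∷ 57 via 0x876543102 ∷ [])) ∷
  (7 , (0x320 ∷ 0x621 ∷ 0x543 ∷ 0x210 ∷ []) , branch 0x31
    (127 via 0x6543210 ∷ 127 via 0x6453210 ∷ 139 via 0x6543210 ∷ 79 via 0x70543621 ∷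
    146 via 0x6543210 ∷ 147 via 0x6543210 ∷ 73 via 0x53126740 ∷ 147 via 0x6453210 ∷
    73 via 0x43126750 ∷ 41 via 0x76543102 ∷ 55 via 0x612870543 ∷ 153 via 0x6543210 ∷
    159 via 0x6543210 ∷ 107 via 0x76534210 ∷ 159 via 0x6453210 ∷ 107 via 0x76435210 ∷
    79 via 0x76543120 ∷ 79 via 0x87543120 ∷ 163 via 0x6543210 ∷ 77 via 0x61547023 ∷
    76 via 0x76021543 ∷ 66 via 0x087621543 ∷ 76 via 0x76021453 ∷ 66 via 0x087621453 ∷
    57 via 0x876543102 ∷ 63 via 0x987543120 ∷ [])) ∷
  (7 , (0x540 ∷ 0x430 ∷ 0x620 ∷ 0x621 ∷ 0x543 ∷ 0x210 ∷ []) , branch 0x42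
    (30 via 0x1354620 ∷ 30 via 0x1543620 ∷ 39 via 0x6543210 ∷ 45 via 0x71543602 ∷
    39 via 0x0621543 ∷ 30 via 0x6354210 ∷ 45 via 0x73621504 ∷ 30 via 0x6543210 ∷
    45 via 0x75621403 ∷ 45 via 0x76543201 ∷ 56 via 0x621870534 ∷ 28 via 0x0621543 ∷
    28 via 0x0543621 ∷ 31 via 0x71602534 ∷ 28 via 0x0435621 ∷ 31 via 0x71602453 ∷
    44 via 0x76543210 ∷ 28 via 0x0216543 ∷ 44 via 0x75621430 ∷ 31 via 0x76201534 ∷
    31 via 0x76201453 ∷ [])) ∷
  (7 , (0x430 ∷ 0x620 ∷ 0x621 ∷ 0x543 ∷ 0x210 ∷ []) , branch 0x32
    (141 via 0x5621430 ∷ 30 via 0x1543620 ∷ 39 via 0x6543210 ∷ 45 via 0x71543602 ∷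
    165 via 0x6543210 ∷ 141 via 0x5126430 ∷ 72 via 0x53126740 ∷ 30 via 0x6543210 ∷
    45 via 0x75621403 ∷ 45 via 0x76543201 ∷ 56 via 0x543870612 ∷ 162 via 0x1620453 ∷
    164 via 0x0534621 ∷ 72 via 0x53026741 ∷ 28 via 0x0435621 ∷ 31 via 0x71602453 ∷
    44 via 0x76543210 ∷ 56 via 0x543871602 ∷ 162 via 0x6120453 ∷ 72 via 0x75126340 ∷
    72 via 0x53120746 ∷ 31 via 0x76201453 ∷ 56 via 0x543876102 ∷ [])) ∷
  (7 , (0x620 ∷ 0x621 ∷ 0x543 ∷ 0x210 ∷ []) , branch 0x52
    (164 via 0x6543120 ∷ 164 via 0x6534120 ∷ 39 via 0x6543210 ∷ 47 via 0x70543612 ∷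
    166 via 0x6543210 ∷ 164 via 0x1543620 ∷ 72 via 0x54126730 ∷ 164 via 0x1534620 ∷
    72 via 0x53126740 ∷ 47 via 0x76543102 ∷ 56 via 0x543870612 ∷ 166 via 0x6543201 ∷
    164 via 0x0543621 ∷ 72 via 0x54026731 ∷ 164 via 0x0534621 ∷ 72 via 0x53026741 ∷
    47 via 0x76543012 ∷ 56 via 0x543871602 ∷ 166 via 0x0543216 ∷ 108 via 0x76543210 ∷
    72 via 0x54120736 ∷ 69 via 0x687120534 ∷ 72 via 0x53120746 ∷ 69 via 0x687120543 ∷
    56 via 0x543876102 ∷ [])) ∷
  (7 , (0x430 ∷ 0x621 ∷ 0x543 ∷ 0x210 ∷ []) , branch 0x42
    (164 via 0x6543120 ∷ 146 via 0x6435120 ∷ 166 via 0x6543120 ∷ 77 via 0x62435710 ∷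
    166 via 0x5621340 ∷ 146 via 0x5216340 ∷ 77 via 0x54216730 ∷ 30 via 0x6543210 ∷
    45 via 0x75621403 ∷ 45 via 0x76543201 ∷ 62 via 0x621870543 ∷ 164 via 0x0621345 ∷
    164 via 0x0543126 ∷ 107 via 0x76543120 ∷ 163 via 0x5430162 ∷ 77 via 0x62430715 ∷
    77 via 0x76435210 ∷ 70 via 0x087435612 ∷ 163 via 0x6210354 ∷ 77 via 0x75216430 ∷
    77 via 0x54210736 ∷ 70 via 0x687210534 ∷ 31 via 0x76201453 ∷ 59 via 0x621875043 ∷
    59 via 0x543876021 ∷ 63 via 0x987210543 ∷ [])) ∷
  (7 , (0x542 ∷ 0x630 ∷ 0x621 ∷ 0x543 ∷ 0x210 ∷ []) , branch 0x32
    (17 via 0x6534120 ∷ 17 via 0x6435120 ∷ 28 via 0x2543610 ∷ 26 via 0x70543612 ∷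
    30 via 0x6354210 ∷ 27 via 0x6543210 ∷ 21 via 0x53216740 ∷ 27 via 0x6453210 ∷
    21 via 0x43216750 ∷ 42 via 0x76543201 ∷ 27 via 0x1360542 ∷ 17 via 0x0534126 ∷
    22 via 0x71306542 ∷ 17 via 0x0435126 ∷ 22 via 0x71306452 ∷ 26 via 0x76543012 ∷
    30 via 0x0354216 ∷ 43 via 0x36754201 ∷ 21 via 0x53210746 ∷ 21 via 0x43210756 ∷ [])) ∷
  (7 , (0x630 ∷ 0x621 ∷ 0x543 ∷ 0x210 ∷ []) , branch 0x31
    (147 via 0x6534210 ∷ 147 via 0x6435210 ∷ 164 via 0x1543620 ∷ 78 via 0x70534126 ∷
    30 via 0x6354210 ∷ 27 via 0x6543210 ∷ 21 via 0x53216740 ∷ 27 via 0x6453210 ∷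
    21 via 0x43216750 ∷ 42 via 0x76543201 ∷ 50 via 0x543216870 ∷ 169 via 0x6543210 ∷
    147 via 0x0534216 ∷ 96 via 0x76534210 ∷ 147 via 0x0435216 ∷ 96 via 0x76435210 ∷
    78 via 0x76534120 ∷ 30 via 0x0354216 ∷ 43 via 0x36754201 ∷ 21 via 0x53210746 ∷
    48 via 0x36874201 ∷ 21 via 0x43210756 ∷ 48 via 0x36875201 ∷ 50 via 0x543210876 ∷ [])) ∷
  (7 , (0x542 ∷ 0x431 ∷ 0x432 ∷ 0x621 ∷ 0x543 ∷ 0x210 ∷ []) , branch 0x42
    (164 via 0x6543120 ∷ 149 via 0x6345120 ∷ 139 via 0x2601453 ∷ 72 via 0x70345612 ∷
    27 via 0x1560432 ∷ 41 via 0x61705324 ∷ 22 via 0x52706341 ∷ 37 via 0x354870621 ∷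
    164 via 0x0543126 ∷ 149 via 0x0345126 ∷ 72 via 0x76345012 ∷ 72 via 0x87345012 ∷
    41 via 0x01765324 ∷ 41 via 0x01875324 ∷ 37 via 0x354876021 ∷ [])) ∷
  (7 , (0x431 ∷ 0x432 ∷ 0x621 ∷ 0x543 ∷ 0x210 ∷ []) , branch 0x31
    (164 via 0x6534210 ∷ 150 via 0x6435210 ∷ 166 via 0x6543201 ∷ 77 via 0x70435621 ∷
    126 via 0x0612453 ∷ 170 via 0x6534210 ∷ 77 via 0x53216740 ∷ 27 via 0x1560432 ∷
    42 via 0x61750423 ∷ 27 via 0x1760432 ∷ 42 via 0x61870423 ∷ 171 via 0x6543210 ∷
    164 via 0x0534216 ∷ 107 via 0x76534210 ∷ 150 via 0x0435216 ∷ 104 via 0x76435210 ∷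
    77 via 0x76435021 ∷ 77 via 0x87435021 ∷ 126 via 0x6012453 ∷ 107 via 0x36754210 ∷
    77 via 0x53210746 ∷ 70 via 0x687210543 ∷ 42 via 0x01756423 ∷ 48 via 0x01875423 ∷
    42 via 0x01876423 ∷ 48 via 0x01987423 ∷ [])) ∷
  (7 , (0x432 ∷ 0x621 ∷ 0x543 ∷ 0x210 ∷ []) , branch 0x52
    (164 via 0x6543120 ∷ 164 via 0x6534120 ∷ 166 via 0x6543102 ∷ 77 via 0x70435612 ∷
    168 via 0x6543210 ∷ 170 via 0x6543210 ∷ 77 via 0x54216730 ∷ 170 via 0x6534210 ∷
    77 via 0x53216740 ∷ 44 via 0x76543102 ∷ 61 via 0x543870612 ∷ 172 via 0x6543210 ∷
    164 via 0x0543126 ∷ 107 via 0x76543120 ∷ 164 via 0x0534126 ∷ 107 via 0x76534120 ∷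
    77 via 0x76435012 ∷ 77 via 0x87435012 ∷ 168 via 0x0543216 ∷ 109 via 0x76543210 ∷
    77 via 0x54210736 ∷ 70 via 0x687210534 ∷ 77 via 0x53210746 ∷ 70 via 0x687210543 ∷
    61 via 0x543876012 ∷ 63 via 0x987102543 ∷ [])) ∷
  (7 , (0x621 ∷ 0x543 ∷ 0x210 ∷ []) , branch 0x51
    (164 via 0x6543210 ∷ 164 via 0x6534210 ∷ 167 via 0x6543210 ∷ 79 via 0x70543621 ∷
    168 via 0x6543210 ∷ 170 via 0x6543210 ∷ 77 via 0x54216730 ∷ 170 via 0x6534210 ∷
    77 via 0x53216740 ∷ 48 via 0x76543201 ∷ 63 via 0x543870621 ∷ 173 via 0x6543210 ∷
    164 via 0x0543216 ∷ 107 via 0x76543210 ∷ 164 via 0x0534216 ∷ 107 via 0x76534210 ∷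
    79 via 0x76543120 ∷ 79 via 0x87543120 ∷ 168 via 0x0543216 ∷ 109 via 0x76543210 ∷
    77 via 0x54210736 ∷ 70 via 0x687210534 ∷ 77 via 0x53210746 ∷ 70 via 0x687210543 ∷
    63 via 0x543876021 ∷ 64 via 0x987543210 ∷ [])) ∷
  (9 , (0x841 ∷ 0x740 ∷ 0x631 ∷ 0x543 ∷ 0x210 ∷ []) , branch 0x41
    (2 via 0x876543210 ∷ 6 via 0x825613704 ∷ 21 via 0x53206841 ∷ 37 via 0x681720543 ∷
    37 via 0x681920543 ∷ 2 via 0x867210543 ∷ 2 via 0x852740613 ∷ 2 via 0x825613740 ∷ closed ∷
    closed ∷ 21 via 0x63705814 ∷ 6 via 0x876543201 ∷ 37 via 0x681970543 ∷ 6 via 0x852740631 ∷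
    21 via 0x70632841 ∷ closed ∷ 37 via 0x784653210 ∷ 21 via 0x20537814 ∷ 37 via 0x784953210 ∷
    6 via 0x867210534 ∷ 37 via 0x784963210 ∷ [])) ∷
  (8 , (0x421 ∷ 0x740 ∷ 0x631 ∷ 0x543 ∷ 0x210 ∷ []) , branch 0x41
    (closed ∷ 7 via 0x52613704 ∷ 96 via 0x76534021 ∷ 21 via 0x61702534 ∷ 6 via 0x761802534 ∷
    10 via 0x76543210 ∷ 11 via 0x76543210 ∷ 11 via 0x52631704 ∷ 2 via 0x867534201 ∷ closed ∷
    21 via 0x63705214 ∷ 25 via 0x76543201 ∷ 36 via 0x653870241 ∷ 22 via 0x52704631 ∷
    27 via 0x2740631 ∷ 44 via 0x74563201 ∷ 30 via 0x7021534 ∷ 45 via 0x70853241 ∷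
    21 via 0x67210534 ∷ 44 via 0x74863201 ∷ 21 via 0x87210534 ∷ [])) ∷
  (8 , (0x751 ∷ 0x740 ∷ 0x631 ∷ 0x543 ∷ 0x210 ∷ []) , branch 0x41
    (176 via 0x67534201 ∷ 21 via 0x45207631 ∷ 176 via 0x25704631 ∷ 175 via 0x687435210 ∷
    96 via 0x25631074 ∷ 7 via 0x76435201 ∷ 6 via 0x687435201 ∷ 7 via 0x52407631 ∷
    21 via 0x47635201 ∷ 96 via 0x67201354 ∷ 6 via 0x647835201 ∷ [])) ∷
  (8 , (0x740 ∷ 0x631 ∷ 0x543 ∷ 0x210 ∷ []) , branch 0x30
    (176 via 0x76543210 ∷ 78 via 0x25740613 ∷ 76 via 0x70612543 ∷ 96 via 0x67543120 ∷
    66 via 0x670812543 ∷ 176 via 0x67210543 ∷ 176 via 0x52740613 ∷ 176 via 0x25613740 ∷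
    175 via 0x876543210 ∷ 96 via 0x25740163 ∷ 177 via 0x76543210 ∷ 78 via 0x85740613 ∷
    78 via 0x67543210 ∷ 66 via 0x786543210 ∷ 78 via 0x87543210 ∷ 78 via 0x52613740 ∷
    177 via 0x67210543 ∷ 96 via 0x52613470 ∷ 78 via 0x82613740 ∷ 15 via 0x52704361 ∷
    15 via 0x52613470 ∷ 51 via 0x852740631 ∷ 15 via 0x67543120 ∷ 0 via 0x786543120 ∷
    0 via 0x687534021 ∷ 96 via 0x76210453 ∷ 76 via 0x63745210 ∷ 66 via 0x763845210 ∷
    78 via 0x76210543 ∷ 78 via 0x86210543 ∷ 66 via 0x687210543 ∷ 15 via 0x76210453 ∷
    0 via 0x786201354 ∷ 0 via 0x687210453 ∷ 51 via 0x867534210 ∷ [])) ∷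
  (8 , (0x421 ∷ 0x730 ∷ 0x420 ∷ 0x631 ∷ 0x543 ∷ 0x210 ∷ []) , branch 0x32
    (11 via 0x72534610 ∷ 11 via 0x62534701 ∷ 2 via 0x758631204 ∷ 11 via 0x72631540 ∷
    11 via 0x52631704 ∷ 2 via 0x768534201 ∷ 11 via 0x62730541 ∷ 11 via 0x52730614 ∷
    2 via 0x678534210 ∷ [])) ∷
  (8 , (0x730 ∷ 0x420 ∷ 0x631 ∷ 0x543 ∷ 0x210 ∷ []) , branch 0x30
    (179 via 0x76543210 ∷ 177 via 0x57420631 ∷ 73 via 0x54126730 ∷ 11 via 0x62730541 ∷
    11 via 0x52730614 ∷ 2 via 0x678534210 ∷ 21 via 0x24615703 ∷ 7 via 0x75240613 ∷
    6 via 0x785204613 ∷ 21 via 0x20617543 ∷ 36 via 0x753861240 ∷ 36 via 0x753981240 ∷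
    73 via 0x61425730 ∷ 177 via 0x67120534 ∷ 21 via 0x21546703 ∷ 21 via 0x20547613 ∷
    36 via 0x763854210 ∷ 7 via 0x76210543 ∷ 6 via 0x786201543 ∷ 36 via 0x763984210 ∷ [])) ∷
  (7 , (0x421 ∷ 0x320 ∷ 0x420 ∷ 0x631 ∷ 0x543 ∷ 0x210 ∷ []) , branch 0x32
    (12 via 0x5204631 ∷ 12 via 0x6201534 ∷ 8 via 0x3560421 ∷ 29 via 0x6543210 ∷ 29 via 0x5613240 ∷
    19 via 0x76543210 ∷ 30 via 0x5420613 ∷ 41 via 0x53761042 ∷ 30 via 0x6120543 ∷
    41 via 0x63754012 ∷ [])) ∷
  (7 , (0x521 ∷ 0x320 ∷ 0x420 ∷ 0x631 ∷ 0x543 ∷ 0x210 ∷ []) , branch 0x32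
    (3 via 0x5204631 ∷ 1 via 0x5613042 ∷ 8 via 0x3460521 ∷ 7 via 0x52704613 ∷ 12 via 0x6541032 ∷
    4 via 0x5042613 ∷ 30 via 0x5420613 ∷ 21 via 0x75204613 ∷ 40 via 0x53761042 ∷ 3 via 0x1546032 ∷
    25 via 0x75631042 ∷ [])) ∷
  (7 , (0x652 ∷ 0x320 ∷ 0x420 ∷ 0x631 ∷ 0x543 ∷ 0x210 ∷ []) , branch 0x32
    (8 via 0x3104652 ∷ 1 via 0x6453012 ∷ 1 via 0x5163042 ∷ 3 via 0x6543012 ∷ 3 via 0x5613042 ∷
    12 via 0x4615032 ∷ 25 via 0x76345012 ∷ 12 via 0x1546032 ∷ 25 via 0x36745012 ∷
    21 via 0x76201453 ∷ [])) ∷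
  (7 , (0x320 ∷ 0x420 ∷ 0x631 ∷ 0x543 ∷ 0x210 ∷ []) , branch 0x30
    (181 via 0x6543210 ∷ 182 via 0x6543210 ∷ 122 via 0x6543210 ∷ 89 via 0x67543120 ∷
    29 via 0x6543210 ∷ 29 via 0x5613240 ∷ 19 via 0x76543210 ∷ 30 via 0x5420613 ∷
    21 via 0x75204613 ∷ 45 via 0x54761230 ∷ 48 via 0x53871240 ∷ 122 via 0x5613240 ∷
    182 via 0x5613240 ∷ 89 via 0x57613420 ∷ 183 via 0x6543210 ∷ 78 via 0x75631024 ∷
    78 via 0x76534021 ∷ 30 via 0x6120543 ∷ 45 via 0x61754230 ∷ 21 via 0x76201543 ∷
    48 via 0x63874210 ∷ 21 via 0x76201453 ∷ 48 via 0x63875210 ∷ 48 via 0x53876240 ∷ [])) ∷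
  (7 , (0x421 ∷ 0x530 ∷ 0x420 ∷ 0x631 ∷ 0x543 ∷ 0x210 ∷ []) , branch 0x32
    (closed ∷ 12 via 0x6503214 ∷ 23 via 0x2601543 ∷ 11 via 0x75613240 ∷ 13 via 0x5631402 ∷
    4 via 0x6543210 ∷ 10 via 0x76543210 ∷ 17 via 0x6214503 ∷ 25 via 0x75613204 ∷ 12 via 0x6543210 ∷
    23 via 0x6543210 ∷ 11 via 0x75613204 ∷ 27 via 0x5204613 ∷ 22 via 0x75240613 ∷
    44 via 0x20761543 ∷ 17 via 0x6210543 ∷ 25 via 0x63745210 ∷ [])) ∷
  (7 , (0x521 ∷ 0x530 ∷ 0x420 ∷ 0x631 ∷ 0x543 ∷ 0x210 ∷ []) , branch 0x32
    (3 via 0x2534601 ∷ 147 via 0x2613405 ∷ 3 via 0x6354201 ∷ 3 via 0x2530641 ∷ 27 via 0x5204613 ∷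
    22 via 0x75240613 ∷ 40 via 0x20761345 ∷ [])) ∷
  (7 , (0x642 ∷ 0x530 ∷ 0x420 ∷ 0x631 ∷ 0x543 ∷ 0x210 ∷ []) , branch 0x32
    (3 via 0x6102543 ∷ 17 via 0x1264503 ∷ 17 via 0x2543106 ∷ 25 via 0x26701543 ∷ 20 via 0x6102543 ∷
    3 via 0x1642503 ∷ 94 via 0x57613402 ∷ 8 via 0x6453210 ∷ 15 via 0x42705361 ∷ 8 via 0x1426530 ∷
    17 via 0x2503641 ∷ 27 via 0x5204613 ∷ 26 via 0x76534210 ∷ 17 via 0x6210543 ∷
    15 via 0x63754210 ∷ 25 via 0x76201543 ∷ [])) ∷
  (7 , (0x530 ∷ 0x420 ∷ 0x631 ∷ 0x543 ∷ 0x210 ∷ []) , branch 0x30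
    (185 via 0x6543210 ∷ 186 via 0x6543210 ∷ 144 via 0x6534210 ∷ 91 via 0x67543120 ∷
    12 via 0x6543210 ∷ 23 via 0x6543210 ∷ 11 via 0x75613204 ∷ 27 via 0x5204613 ∷
    22 via 0x75240613 ∷ 44 via 0x20761543 ∷ 46 via 0x24871503 ∷ 147 via 0x5631240 ∷
    187 via 0x6543210 ∷ 73 via 0x61427530 ∷ 17 via 0x6210543 ∷ 25 via 0x63745210 ∷
    25 via 0x76201543 ∷ 36 via 0x563874210 ∷ 22 via 0x75240163 ∷ 52 via 0x204875613 ∷ [])) ∷
  (7 , (0x650 ∷ 0x420 ∷ 0x631 ∷ 0x543 ∷ 0x210 ∷ []) , branch 0x30
    (20 via 0x6543210 ∷ 8 via 0x5024631 ∷ 18 via 0x6354210 ∷ 15 via 0x06712453 ∷ 3 via 0x6543210 ∷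
    3 via 0x5613240 ∷ 176 via 0x76345201 ∷ 17 via 0x3240615 ∷ 7 via 0x63240715 ∷
    25 via 0x76345210 ∷ 18 via 0x5361240 ∷ 8 via 0x6453210 ∷ 15 via 0x50724361 ∷ closed ∷
    7 via 0x40163725 ∷ 7 via 0x10453726 ∷ 17 via 0x3210546 ∷ 25 via 0x36745210 ∷ 7 via 0x53210746 ∷
    26 via 0x76201354 ∷ [])) ∷
  (7 , (0x420 ∷ 0x631 ∷ 0x543 ∷ 0x210 ∷ []) , branch 0x41
    (184 via 0x6543210 ∷ 170 via 0x5613204 ∷ 170 via 0x6543201 ∷ 77 via 0x61207534 ∷
    188 via 0x6543210 ∷ 188 via 0x5613240 ∷ 180 via 0x76543210 ∷ 189 via 0x6543210 ∷
    78 via 0x75631204 ∷ 78 via 0x76534201 ∷ 66 via 0x687534201 ∷ 188 via 0x6543012 ∷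
    188 via 0x5613042 ∷ 180 via 0x76543012 ∷ 189 via 0x6543012 ∷ 78 via 0x75631024 ∷
    78 via 0x76534021 ∷ 66 via 0x687534021 ∷ 163 via 0x1204365 ∷ 77 via 0x75204631 ∷
    77 via 0x76201534 ∷ 26 via 0x76201354 ∷ 53 via 0x875613204 ∷ 53 via 0x876543201 ∷ [])) ∷
  (8 , (0x741 ∷ 0x640 ∷ 0x631 ∷ 0x543 ∷ 0x210 ∷ []) , branch 0x41
    (7 via 0x63250714 ∷ 21 via 0x53206741 ∷ 176 via 0x25714630 ∷ 7 via 0x60523741 ∷
    21 via 0x20536714 ∷ [])) ∷
  (7 , (0x421 ∷ 0x640 ∷ 0x631 ∷ 0x543 ∷ 0x210 ∷ []) , branch 0x41
    (8 via 0x4025631 ∷ 1 via 0x6534201 ∷ 7 via 0x61720534 ∷ 4 via 0x6543210 ∷ 12 via 0x5603241 ∷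
    3 via 0x3605241 ∷ 25 via 0x76543201 ∷ 3 via 0x6120543 ∷ 30 via 0x6021534 ∷ 40 via 0x64753201 ∷
    21 via 0x76210534 ∷ [])) ∷
  (7 , (0x641 ∷ 0x640 ∷ 0x631 ∷ 0x543 ∷ 0x210 ∷ []) , branch 0x41
    (12 via 0x5614230 ∷ 17 via 0x3250614 ∷ 27 via 0x6543201 ∷ 41 via 0x53720146 ∷
    12 via 0x2641503 ∷ 5 via 0x6543210 ∷ 176 via 0x25703641 ∷ closed ∷ 96 via 0x24750163 ∷
    22 via 0x76534201 ∷ 17 via 0x0523641 ∷ closed ∷ 96 via 0x51723460 ∷ 15 via 0x40725361 ∷
    27 via 0x6210534 ∷ 41 via 0x20753416 ∷ 22 via 0x76201534 ∷ [])) ∷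
  (7 , (0x651 ∷ 0x640 ∷ 0x631 ∷ 0x543 ∷ 0x210 ∷ []) , branch 0x41
    (3 via 0x4615230 ∷ 3 via 0x4613250 ∷ 27 via 0x6453201 ∷ 40 via 0x45720136 ∷ 193 via 0x6435210 ∷
    193 via 0x6453210 ∷ 22 via 0x76435201 ∷ 189 via 0x6120543 ∷ 147 via 0x4201536 ∷
    22 via 0x46735201 ∷ 7 via 0x54201736 ∷ 7 via 0x43210756 ∷ [])) ∷
  (7 , (0x640 ∷ 0x631 ∷ 0x543 ∷ 0x210 ∷ []) , branch 0x30
    (192 via 0x6543210 ∷ 189 via 0x6354201 ∷ 147 via 0x0543126 ∷ 75 via 0x53217640 ∷
    192 via 0x6210543 ∷ 193 via 0x6543210 ∷ 191 via 0x76543210 ∷ 194 via 0x6543210 ∷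
    177 via 0x67345210 ∷ 78 via 0x76543210 ∷ 189 via 0x6021534 ∷ 194 via 0x6210543 ∷
    177 via 0x67012543 ∷ 8 via 0x6543210 ∷ 15 via 0x40725361 ∷ 7 via 0x10543726 ∷
    32 via 0x504872163 ∷ 147 via 0x3210456 ∷ 75 via 0x20547613 ∷ 78 via 0x76210543 ∷
    7 via 0x43210756 ∷ 32 via 0x240875361 ∷ 49 via 0x543201876 ∷ [])) ∷
  (7 , (0x631 ∷ 0x543 ∷ 0x210 ∷ []) , branch 0x31
    (190 via 0x6543210 ∷ 190 via 0x6453210 ∷ 170 via 0x6543201 ∷ 77 via 0x54207631 ∷
    190 via 0x6201534 ∷ 195 via 0x6543210 ∷ 178 via 0x76543210 ∷ 195 via 0x6453210 ∷
    178 via 0x76453210 ∷ 78 via 0x76534201 ∷ 66 via 0x687534201 ∷ 190 via 0x6021534 ∷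
    195 via 0x6534021 ∷ 178 via 0x67534021 ∷ 195 via 0x6435021 ∷ 178 via 0x67435021 ∷
    78 via 0x76534021 ∷ 66 via 0x687534021 ∷ 170 via 0x6201543 ∷ 77 via 0x20547613 ∷
    78 via 0x76210543 ∷ 66 via 0x687210543 ∷ 78 via 0x76210453 ∷ 66 via 0x687210453 ∷
    55 via 0x876543201 ∷ 64 via 0x987543210 ∷ [])) ∷
  (6 , (0x540 ∷ 0x410 ∷ 0x320 ∷ 0x421 ∷ 0x321 ∷ 0x543 ∷ 0x210 ∷ []) , branch 0x42
    (closed ∷ 16 via 0x4653210 ∷ [])) ∷
  (6 , (0x410 ∷ 0x320 ∷ 0x421 ∷ 0x321 ∷ 0x543 ∷ 0x210 ∷ []) , branch 0x31
    (197 via 0x543210 ∷ 1 via 0x4650213 ∷ 139 via 0x3654201 ∷ [])) ∷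
  (6 , (0x530 ∷ 0x540 ∷ 0x320 ∷ 0x421 ∷ 0x321 ∷ 0x543 ∷ 0x210 ∷ []) , branch 0x52
    (closed ∷ 197 via 0x543210 ∷ 12 via 0x6231504 ∷ closed ∷ 29 via 0x6543201 ∷ 29 via 0x6534201 ∷
    197 via 0x540213 ∷ 12 via 0x6201534 ∷ 13 via 0x5641302 ∷ 29 via 0x6504231 ∷ [])) ∷
  (6 , (0x540 ∷ 0x320 ∷ 0x421 ∷ 0x321 ∷ 0x543 ∷ 0x210 ∷ []) , branch 0x42
    (closed ∷ 12 via 0x6231504 ∷ 199 via 0x543210 ∷ 29 via 0x6543201 ∷ 143 via 0x6123504 ∷
    41 via 0x54760132 ∷ 12 via 0x6201534 ∷ 40 via 0x20761534 ∷ 143 via 0x6120534 ∷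
    41 via 0x54763102 ∷ [])) ∷
  (6 , (0x542 ∷ 0x541 ∷ 0x320 ∷ 0x421 ∷ 0x321 ∷ 0x543 ∷ 0x210 ∷ []) , branch 0x52
    (199 via 0x032451 ∷ 27 via 0x2601543 ∷ 27 via 0x2630541 ∷ 29 via 0x6021534 ∷
    118 via 0x6023415 ∷ [])) ∷
  (6 , (0x541 ∷ 0x320 ∷ 0x421 ∷ 0x321 ∷ 0x543 ∷ 0x210 ∷ []) , branch 0x31
    (200 via 0x543201 ∷ 200 via 0x453201 ∷ 127 via 0x6543201 ∷ 200 via 0x543210 ∷
    181 via 0x6534201 ∷ 147 via 0x4650213 ∷ 41 via 0x54760132 ∷ 201 via 0x543210 ∷
    196 via 0x6534120 ∷ 139 via 0x3654201 ∷ 72 via 0x76120543 ∷ [])) ∷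
  (6 , (0x320 ∷ 0x421 ∷ 0x321 ∷ 0x543 ∷ 0x210 ∷ []) , branch 0x32
    (198 via 0x543210 ∷ 110 via 0x6543102 ∷ 200 via 0x543210 ∷ 181 via 0x6534201 ∷
    147 via 0x4650213 ∷ 41 via 0x54760132 ∷ 202 via 0x543210 ∷ 190 via 0x6534210 ∷
    190 via 0x6435210 ∷ 71 via 0x76534210 ∷ 139 via 0x3654201 ∷ 72 via 0x76120543 ∷
    72 via 0x76120453 ∷ 37 via 0x012876543 ∷ [])) ∷
  (6 , (0x540 ∷ 0x520 ∷ 0x430 ∷ 0x421 ∷ 0x321 ∷ 0x543 ∷ 0x210 ∷ []) , branch 0x42
    (200 via 0x123504 ∷ 27 via 0x4605213 ∷ [])) ∷
  (6 , (0x520 ∷ 0x430 ∷ 0x421 ∷ 0x321 ∷ 0x543 ∷ 0x210 ∷ []) , branch 0x32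
    (204 via 0x543210 ∷ 27 via 0x4605213 ∷ [])) ∷
  (6 , (0x540 ∷ 0x430 ∷ 0x421 ∷ 0x321 ∷ 0x543 ∷ 0x210 ∷ []) , branch 0x42
    (200 via 0x543120 ∷ 204 via 0x543120 ∷ 118 via 0x6543102 ∷ closed ∷ 29 via 0x6543201 ∷
    27 via 0x4605213 ∷ 42 via 0x54760231 ∷ 204 via 0x540123 ∷ 118 via 0x6540132 ∷
    185 via 0x6201453 ∷ 27 via 0x4653210 ∷ 42 via 0x54763201 ∷ 42 via 0x34765201 ∷ [])) ∷
  (6 , (0x542 ∷ 0x430 ∷ 0x421 ∷ 0x321 ∷ 0x543 ∷ 0x210 ∷ []) , branch 0x42
    (202 via 0x543120 ∷ 117 via 0x6543102 ∷ 204 via 0x530214 ∷ 119 via 0x5630241 ∷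
    12 via 0x6435102 ∷ 41 via 0x12760534 ∷ 140 via 0x6120354 ∷ 40 via 0x43765102 ∷ [])) ∷
  (6 , (0x430 ∷ 0x421 ∷ 0x321 ∷ 0x543 ∷ 0x210 ∷ []) , branch 0x31
    (203 via 0x534210 ∷ 205 via 0x543210 ∷ 121 via 0x6543201 ∷ 206 via 0x543210 ∷
    184 via 0x6534201 ∷ 27 via 0x4605213 ∷ 42 via 0x54760231 ∷ 207 via 0x543210 ∷
    196 via 0x6534120 ∷ 188 via 0x6102453 ∷ 77 via 0x76435120 ∷ 146 via 0x6210453 ∷
    77 via 0x76210543 ∷ 42 via 0x04765231 ∷ 48 via 0x43876201 ∷ [])) ∷
  (6 , (0x431 ∷ 0x432 ∷ 0x421 ∷ 0x321 ∷ 0x543 ∷ 0x210 ∷ []) , branch 0x42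
    (203 via 0x543120 ∷ 203 via 0x051432 ∷ 115 via 0x6543102 ∷ 203 via 0x503214 ∷
    184 via 0x6543201 ∷ 38 via 0x4650321 ∷ 38 via 0x4760321 ∷ 203 via 0x021345 ∷
    196 via 0x6543210 ∷ 184 via 0x6021453 ∷ 77 via 0x76435012 ∷ 115 via 0x6012354 ∷
    77 via 0x76210534 ∷ 38 via 0x1765243 ∷ 39 via 0x4876321 ∷ [])) ∷
  (6 , (0x432 ∷ 0x421 ∷ 0x321 ∷ 0x543 ∷ 0x210 ∷ []) , branch 0x52
    (203 via 0x543120 ∷ 203 via 0x534120 ∷ 115 via 0x6543102 ∷ 208 via 0x543210 ∷
    184 via 0x6543201 ∷ 184 via 0x6534201 ∷ 47 via 0x54760132 ∷ 209 via 0x543210 ∷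
    196 via 0x6543210 ∷ 196 via 0x6534210 ∷ 77 via 0x76435012 ∷ 172 via 0x6021435 ∷
    77 via 0x76210534 ∷ 77 via 0x76210543 ∷ 47 via 0x54876132 ∷ [])) ∷
  (6 , (0x421 ∷ 0x321 ∷ 0x543 ∷ 0x210 ∷ []) , branch 0x51
    (203 via 0x543210 ∷ 203 via 0x534210 ∷ 127 via 0x6543201 ∷ 208 via 0x543210 ∷
    184 via 0x6543201 ∷ 184 via 0x6534201 ∷ 48 via 0x54760231 ∷ 210 via 0x543210 ∷
    196 via 0x6543120 ∷ 196 via 0x6534120 ∷ 79 via 0x76543120 ∷ 172 via 0x6021435 ∷
    77 via 0x76210534 ∷ 77 via 0x76210543 ∷ 48 via 0x54876231 ∷ [])) ∷
  (6 , (0x532 ∷ 0x420 ∷ 0x541 ∷ 0x321 ∷ 0x543 ∷ 0x210 ∷ []) , branch 0x42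
    (1 via 0x2601534 ∷ 197 via 0x024531 ∷ 12 via 0x6543012 ∷ 143 via 0x6021534 ∷ [])) ∷
  (6 , (0x420 ∷ 0x541 ∷ 0x321 ∷ 0x543 ∷ 0x210 ∷ []) , branch 0x41
    (200 via 0x543201 ∷ 205 via 0x354201 ∷ 146 via 0x6543201 ∷ 12 via 0x6210534 ∷
    186 via 0x6435201 ∷ 40 via 0x21760534 ∷ 212 via 0x543210 ∷ 188 via 0x6012534 ∷
    143 via 0x6021534 ∷ 41 via 0x54763012 ∷ [])) ∷
  (6 , (0x541 ∷ 0x321 ∷ 0x543 ∷ 0x210 ∷ []) , branch 0x31
    (213 via 0x543210 ∷ 213 via 0x453210 ∷ 146 via 0x6543201 ∷ 211 via 0x201543 ∷
    188 via 0x6534201 ∷ 188 via 0x6435201 ∷ 46 via 0x23760514 ∷ 208 via 0x021543 ∷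
    196 via 0x6534120 ∷ 196 via 0x6435120 ∷ 77 via 0x76543021 ∷ 168 via 0x6021543 ∷
    77 via 0x76210543 ∷ 77 via 0x76210453 ∷ 48 via 0x21876534 ∷ [])) ∷
  (6 , (0x321 ∷ 0x543 ∷ 0x210 ∷ []) , branch 0x30
    (211 via 0x543210 ∷ 211 via 0x453210 ∷ 174 via 0x6543210 ∷ 214 via 0x543210 ∷
    196 via 0x6534210 ∷ 196 via 0x6435210 ∷ 79 via 0x76543210 ∷ 214 via 0x543120 ∷
    196 via 0x6534120 ∷ 196 via 0x6435120 ∷ 79 via 0x76543120 ∷ 168 via 0x6021543 ∷
    77 via 0x76210543 ∷ 77 via 0x76210453 ∷ 63 via 0x876543021 ∷ [])) ∷
  (6 , (0x543 ∷ 0x210 ∷ []) , branch 0x50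
    (215 via 0x543210 ∷ 215 via 0x534210 ∷ 174 via 0x6543210 ∷ 215 via 0x201435 ∷
    196 via 0x6543210 ∷ 196 via 0x6534210 ∷ 79 via 0x76543210 ∷ 215 via 0x102435 ∷
    196 via 0x6543120 ∷ 196 via 0x6534120 ∷ 79 via 0x76543120 ∷ 174 via 0x6210435 ∷
    79 via 0x76210534 ∷ 79 via 0x76210543 ∷ 64 via 0x876543210 ∷ [])) ∷
  []

import Data.Bool.Properties as Bool
open import Data.Bool.Properties using (T-∧; T-∨; T-≡; T?)
open import Data.Empty using (⊥; ⊥-elim)
open import Data.Fin using (Fin; zero; suc; toℕ)
import Data.Fin.Properties as Fin
open import Data.Fin.Subset
  using (Subset; inside; outside; ⁅_⁆; ⋃; ∣_∣; _∩_; _⊆_; Nonempty; Empty)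
  renaming (_∈_ to _∈ˢ_; _∉_ to _∉ˢ_)
open import Data.Fin.Subset.Properties
  using (_∈?_; nonempty?; x∈⁅x⁆; x∈⁅y⁆⇒x≡y; x∈p∪q⁺; x∈p∪q⁻; x∈p∩q⁺; x∈p∩q⁻; p∩q⊆p; ∉⊥;
         ⊆-antisym; p⊂q⇒∣p∣<∣q∣)
import Data.List.Membership.DecPropositional as DecMembership
open import Data.List.Membership.Propositional using (_∈_; _∉_; find; lose)
open import Data.List.Membership.Propositional.Properties
  using (∈-∃++; ∈-++⁺ˡ; ∈-++⁺ʳ; ∈-++⁻; ∈-map⁺; ∈-map⁻; ∈-filter⁺; ∈-filter⁻;
         ∈-upTo⁺; ∈-upTo⁻; ∈-applyUpTo⁺; ∈-allFin)
open import Data.List.Properties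
  using (length-map; length-++; length-++-sucʳ; length-filter; length-tabulate; map-∘;
         map-++; map-cong-local; map-applyUpTo; ++-assoc; ++-identityʳ)
open import Data.List.Relation.Binary.Disjoint.Propositional using (Disjoint)
open import Data.List.Relation.Unary.All as All using (All; []; _∷_; all?)
import Data.List.Relation.Unary.All.Properties as All
open import Data.List.Relation.Unary.AllPairs as AllPairs using (AllPairs; []; _∷_; allPairs?)
import Data.List.Relation.Unary.AllPairs.Properties as AllPairs
open import Data.List.Relation.Unary.Any as Any using (Any; here; there; any?)
import Data.List.Relation.Unary.Any.Properties as Any
open import Data.List.Relation.Unary.Unique.Propositional using (Unique)
import Data.List.Relation.Unary.Unique.Propositional.Properties as Unique
open import Data.Nat.Properties
  using (≤-refl; ≤-reflexive; ≤-trans; ≤-antisym; ≤-<-trans; <-irrefl; <⇒≱; ≮⇒≥;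
         ≤⇒≤ᵇ; ≤ᵇ⇒≤; <ᵇ⇒<; ≡⇒≡ᵇ; ≡ᵇ⇒≡; n≤1+n; m≤n⇒m≤1+n; m≤m+n; m<m+n; m+n≮m;
         m+n∸m≡n; m+[n∸m]≡n; m⊓n≤m; m⊓n≤n; +-comm; +-suc; +-identityʳ; +-monoʳ-≤;
         +-mono-≤; ∸-monoˡ-≤; ∸-monoˡ-<; ∸-cancelʳ-≡; *-cancelʳ-<)
open import Data.Sum using (_⊎_; inj₁; inj₂; [_,_]′)
open import Data.Unit using (tt)
import Data.Vec as Vec
open import Data.Vec.Properties using (≡-dec)
open import Relation.Binary.PropositionalEquality
  using (_≡_; _≢_; _≗_; refl; sym; trans; cong; cong₂; subst; subst₂; module ≡-Reasoning)
open import Relation.Nullary using (¬_; Dec; yes; no; contradiction; ¬?)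
open import Relation.Nullary.Decidable using (True; toWitness; _×-dec_; _⊎-dec_)
open import Relation.Unary using (Decidable)

private
  variable
    A : Set
    N k : ℕ

-- Finite sets of vertices

unique-⊆⇒length≤ : {xs ys : List A} → Unique xs →
                   (∀ {x} → x ∈ xs → x ∈ ys) → length xs ≤ length ys
unique-⊆⇒length≤ [] _ = z≤n
unique-⊆⇒length≤ {xs = x ∷ xs} (x∉xs ∷ xs!) xs⊆ with ∈-∃++ (xs⊆ (here refl))
... | as , bs , refl =
  ≤-trans (s≤s (unique-⊆⇒length≤ xs! (λ y∈ → drop y∈ (∈-++⁻ as (xs⊆ (there y∈))))))
          (≤-reflexive (sym (length-++-sucʳ as x bs)))
  where
  drop : ∀ {y} → y ∈ xs → y ∈ as ⊎ y ∈ x ∷ bs → y ∈ as ++ bs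
  drop y∈ (inj₁ y∈as)         = ∈-++⁺ˡ y∈as
  drop y∈ (inj₂ (here refl))  = contradiction refl (All.lookup x∉xs y∈)
  drop y∈ (inj₂ (there y∈bs)) = ∈-++⁺ʳ as y∈bs

_∈ᴸ?_ : (E : Subset N) (Es : List (Subset N)) → Dec (E ∈ Es)
_∈ᴸ?_ {N} = DecMembership._∈?_ (≡-dec {n = N} Bool._≟_)

members : Subset N → List (Fin N)
members Vec.[]              = []
members (inside Vec.∷ p)  = zero ∷ map suc (members p)
members (outside Vec.∷ p) = map suc (members p)

∈-members⁺ : ∀ {v} {p : Subset N} → v ∈ˢ p → v ∈ members p
∈-members⁺ Vec.here                               = here refl
∈-members⁺ {p = inside Vec.∷ p} (Vec.there v∈p) = there (∈-map⁺ suc (∈-members⁺ v∈p))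
∈-members⁺ {p = outside Vec.∷ p} (Vec.there v∈p) = ∈-map⁺ suc (∈-members⁺ v∈p)

∈-members⁻ : ∀ {v} (p : Subset N) → v ∈ members p → v ∈ˢ p
∈-members⁻ (inside Vec.∷ p) (here refl) = Vec.here
∈-members⁻ (inside Vec.∷ p) (there v∈) with ∈-map⁻ suc v∈
... | _ , w∈ , refl = Vec.there (∈-members⁻ p w∈)
∈-members⁻ (outside Vec.∷ p) v∈ with ∈-map⁻ suc v∈
... | _ , w∈ , refl = Vec.there (∈-members⁻ p w∈)

members-unique : (p : Subset N) → Unique (members p)
members-unique Vec.[]              = []
members-unique (inside Vec.∷ p) =
  All.map⁺ (All.universal (λ _ ()) _) ∷ Unique.map⁺ Fin.suc-injective (members-unique p)
members-unique (outside Vec.∷ p) = Unique.map⁺ Fin.suc-injective (members-unique p)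

length-members : (p : Subset N) → length (members p) ≡ ∣ p ∣
length-members Vec.[]              = refl
length-members (inside Vec.∷ p) = cong suc (trans (length-map suc (members p)) (length-members p))
length-members (outside Vec.∷ p) = trans (length-map suc (members p)) (length-members p)

unique⇒length≤∣∣ : ∀ {xs} (p : Subset N) → Unique xs → (∀ {v} → v ∈ xs → v ∈ˢ p) →
                  length xs ≤ ∣ p ∣
unique⇒length≤∣∣ p xs! xs⊆p =
  subst (_ ≤_) (length-members p) (unique-⊆⇒length≤ xs! (∈-members⁺ ∘ xs⊆p))

∣∣≤length : ∀ {xs} (p : Subset N) → (∀ {v} → v ∈ˢ p → v ∈ xs) → ∣ p ∣ ≤ length xs
∣∣≤length p p⊆xs =
  subst (_≤ _) (length-members p)
    (unique-⊆⇒length≤ (members-unique p) (p⊆xs ∘ ∈-members⁻ p))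

⟦_⟧ : List (Fin N) → Subset N
⟦ xs ⟧ = ⋃ (map ⁅_⁆ xs)

∈⟦⟧⁺ : ∀ {v} {xs : List (Fin N)} → v ∈ xs → v ∈ˢ ⟦ xs ⟧
∈⟦⟧⁺ {v = v} (here refl) = x∈p∪q⁺ (inj₁ (x∈⁅x⁆ v))
∈⟦⟧⁺ (there v∈xs)        = x∈p∪q⁺ (inj₂ (∈⟦⟧⁺ v∈xs))

∈⟦⟧⁻ : ∀ {v} (xs : List (Fin N)) → v ∈ˢ ⟦ xs ⟧ → v ∈ xs
∈⟦⟧⁻ []       v∈ = contradiction v∈ ∉⊥
∈⟦⟧⁻ (x ∷ xs) v∈ with x∈p∪q⁻ ⁅ x ⁆ ⟦ xs ⟧ v∈
... | inj₁ v∈x  = here (x∈⁅y⁆⇒x≡y x v∈x)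
... | inj₂ v∈xs = there (∈⟦⟧⁻ xs v∈xs)

∣⟦⟧∣≤length : (xs : List (Fin N)) → ∣ ⟦ xs ⟧ ∣ ≤ length xs
∣⟦⟧∣≤length xs = ∣∣≤length ⟦ xs ⟧ (∈⟦⟧⁻ xs)

⊆∧∣∣≡⇒≡ : {p q : Subset N} → p ⊆ q → ∣ p ∣ ≡ ∣ q ∣ → p ≡ q
⊆∧∣∣≡⇒≡ {p = p} {q} p⊆q ∣p∣≡∣q∣ = ⊆-antisym p⊆q q⊆p
  where
  q⊆p : q ⊆ p
  q⊆p {v} v∈q with v ∈? p
  ... | yes v∈p = v∈p
  ... | no  v∉p = contradiction (p⊂q⇒∣p∣<∣q∣ (p⊆q , v , v∈q , v∉p)) (<-irrefl ∣p∣≡∣q∣)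

∣∩∣<∣∣ : ∀ (p q : Subset N) {v} → v ∈ˢ p → v ∉ˢ q → ∣ p ∩ q ∣ < ∣ p ∣
∣∩∣<∣∣ p q {v} v∈p v∉q = p⊂q⇒∣p∣<∣q∣ (p∩q⊆p p q , v , v∈p , v∉q ∘ proj₂ ∘ x∈p∩q⁻ p q)

unique⊆⇒covers : ∀ {xs} (p : Subset N) → Unique xs → (∀ {v} → v ∈ xs → v ∈ˢ p) →
                 ∣ p ∣ ≤ length xs → ∀ {v} → v ∈ˢ p → v ∈ xs
unique⊆⇒covers {xs = xs} p xs! xs⊆p ∣p∣≤ {v} v∈p with Any.any? (v Fin.≟_) xs
... | yes v∈xs = v∈xs
... | no  v∉xs = contradiction ∣p∣≤ (<⇒≱ (unique⇒length≤∣∣ {xs = v ∷ xs} p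
      (All.tabulate (λ w∈ v≡w → v∉xs (subst (_∈ xs) (sym v≡w) w∈)) ∷ xs!) λ { (here refl) → v∈p ; (there w∈) → xs⊆p w∈ }))

unique⊆⇒⟦⟧≡ : ∀ {xs} (p : Subset N) → Unique xs → (∀ {v} → v ∈ xs → v ∈ˢ p) →
              ∣ p ∣ ≤ length xs → ⟦ xs ⟧ ≡ p
unique⊆⇒⟦⟧≡ {xs = xs} p xs! xs⊆p ∣p∣≤ =
  ⊆-antisym (xs⊆p ∘ ∈⟦⟧⁻ xs) (∈⟦⟧⁺ ∘ unique⊆⇒covers p xs! xs⊆p ∣p∣≤)

-- Soundness of the finite search

∧⁻ : ∀ {x y} → T (x ∧ y) → T x × T y
∧⁻ = Equivalence.to T-∧

∧⁺ : ∀ {x y} → T x × T y → T (x ∧ y)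
∧⁺ = Equivalence.from T-∧

∨⁻ : ∀ {x y} → T (x ∨ y) → T x ⊎ T y
∨⁻ = Equivalence.to T-∨

∨⁺ˡ : ∀ {x y} → T x → T (x ∨ y)
∨⁺ˡ = Equivalence.from T-∨ ∘ inj₁

∨⁺ʳ : ∀ x {y} → T y → T (x ∨ y)
∨⁺ʳ x = Equivalence.from (T-∨ {x}) ∘ inj₂

T-not : ∀ {x} → T (not x) → ¬ T x
T-not {false} _ ()

not-T : ∀ {x} → ¬ T x → T (not x)
not-T {false} _  = tt
not-T {true}  ¬x = ¬x tt

requiredF-≤ : ∀ {b d g} → (b , d) ∈ demands → b ≤ g → requiredF g ≤ d
requiredF-≤ {b} {d} {g} bd∈ b≤g = go demands bd∈
  where
  go : ∀ bds → (b , d) ∈ bds →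
       foldr (λ (b , d) n → if b ≤ᵇ g then d ⊓ n else n) 100 bds ≤ d
  go (_ ∷ bds) (here refl) with b ≤ᵇ g | ≤⇒≤ᵇ b≤g
  ... | true | _ = m⊓n≤m d _
  go ((b′ , d′) ∷ bds) (there bd∈) with b′ ≤ᵇ g
  ... | true  = ≤-trans (m⊓n≤n d′ _) (go bds bd∈)
  ... | false = go bds bd∈

requiredG-≤ : ∀ {b d f} → (b , d) ∈ demands → d ≤ f → requiredG f ≤ b
requiredG-≤ {b} {d} {f} bd∈ d≤f = go demands bd∈
  where
  go : ∀ bds → (b , d) ∈ bds →
       foldr (λ (b , d) n → if d ≤ᵇ f then b ⊓ n else n) 100 bds ≤ b
  go (_ ∷ bds) (here refl) with d ≤ᵇ f | ≤⇒≤ᵇ d≤f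
  ... | true | _ = m⊓n≤m b _
  go ((b′ , d′) ∷ bds) (there bd∈) with d′ ≤ᵇ f
  ... | true  = ≤-trans (m⊓n≤n b′ _) (go bds bd∈)
  ... | false = go bds bd∈

feasible⁺ : ∀ {b d g f t} → (b , d) ∈ demands → b ≤ g → d ≤ f → b + d ≤ t →
            T (feasible g f t)
feasible⁺ bd∈ b≤g d≤f b+d≤t =
  Any.any⁺ (withinᵇ _ _ _) (lose bd∈ (∧⁺ (≤⇒≤ᵇ b≤g , ∧⁺ (≤⇒≤ᵇ d≤f , ≤⇒≤ᵇ b+d≤t))))

sameᵇ⇒≡ : ∀ c e → T (sameᵇ c e) → c ≡ e
sameᵇ⇒≡ (triple a b c) (triple d e f) same =
  let a≡d , rest = ∧⁻ {a ≡ᵇ d} same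
      b≡e , c≡f  = ∧⁻ {b ≡ᵇ e} rest
  in cong₂ (λ f x → f x) (cong₂ triple (≡ᵇ⇒≡ a d a≡d) (≡ᵇ⇒≡ b e b≡e)) (≡ᵇ⇒≡ c f c≡f)

-- Soundness rests on this direction: the test may let an impossible pair through, but it must never
-- reject a possible one.
compatible⁺ : ∀ c e {i} → i ∈ labels c → i ∈ labels e → c ≢ e → T (compatible c e)
compatible⁺ (triple a b c) (triple d e f) i∈c i∈e c≢e
  with a ≡ᵇ d in a≡d | b ≡ᵇ e in b≡e | c ≡ᵇ f in c≡f
... | true  | true  | true  = c≢e (sameᵇ⇒≡ (triple a b c) (triple d e f)
        (subst T (sym (cong₂ _∧_ a≡d (cong₂ _∧_ b≡e c≡f))) tt))
... | true  | true  | false = tt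
... | true  | false | _     = tt
... | false | true  | _     = tt
... | false | false | true  = tt
... | false | false | false = shared i∈c i∈e
  where
  T≡ : ∀ i → T (i ≡ᵇ i)
  T≡ i = ≡⇒≡ᵇ i i refl
  shared : ∀ {i} → i ∈ a ∷ b ∷ c ∷ [] → i ∈ d ∷ e ∷ f ∷ [] →
           T ((a ≡ᵇ e) ∨ (a ≡ᵇ f) ∨ (b ≡ᵇ d) ∨ (b ≡ᵇ f) ∨ (c ≡ᵇ d) ∨ (c ≡ᵇ e))
  shared (here refl) (here refl) = contradiction (T≡ a) (subst T a≡d)
  shared (here refl) (there (here refl)) = ∨⁺ˡ {a ≡ᵇ e} (T≡ a)
  shared (here refl) (there (there (here refl))) = ∨⁺ʳ (a ≡ᵇ e) (∨⁺ˡ {a ≡ᵇ f} (T≡ a))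
  shared (there (here refl)) (here refl) =
    ∨⁺ʳ (a ≡ᵇ e) (∨⁺ʳ (a ≡ᵇ f) (∨⁺ˡ {b ≡ᵇ d} (T≡ b)))
  shared (there (here refl)) (there (here refl)) = contradiction (T≡ b) (subst T b≡e)
  shared (there (here refl)) (there (there (here refl))) =
    ∨⁺ʳ (a ≡ᵇ e) (∨⁺ʳ (a ≡ᵇ f) (∨⁺ʳ (b ≡ᵇ d) (∨⁺ˡ {b ≡ᵇ f} (T≡ b))))
  shared (there (there (here refl))) (here refl) =
    ∨⁺ʳ (a ≡ᵇ e) (∨⁺ʳ (a ≡ᵇ f) (∨⁺ʳ (b ≡ᵇ d) (∨⁺ʳ (b ≡ᵇ f) (∨⁺ˡ {c ≡ᵇ d} (T≡ c)))))
  shared (there (there (here refl))) (there (here refl)) =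
    ∨⁺ʳ (a ≡ᵇ e) (∨⁺ʳ (a ≡ᵇ f) (∨⁺ʳ (b ≡ᵇ d) (∨⁺ʳ (b ≡ᵇ f) (∨⁺ʳ (c ≡ᵇ d) (T≡ c)))))
  shared (there (there (here refl))) (there (there (here refl))) =
    contradiction (T≡ c) (subst T c≡f)

contains⁻ : ∀ i c → T (contains i c) → i ∈ labels c
contains⁻ i (triple a b c) i∈ with ∨⁻ {i ≡ᵇ a} i∈
... | inj₁ i≡a = here (≡ᵇ⇒≡ i a i≡a)
... | inj₂ i∈′ with ∨⁻ {i ≡ᵇ b} i∈′
...   | inj₁ i≡b = there (here (≡ᵇ⇒≡ i b i≡b))
...   | inj₂ i≡c = there (there (here (≡ᵇ⇒≡ i c i≡c)))

-- `P` and `Q` stand for naming a member of `F` and naming an edge of `G`. One demand is fixed here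
-- while the tests range over all of them, so each failed test is read off at `bd∈`.
module Search
  {P Q : Triple → Set} (P? : Decidable P) (Q? : Decidable Q)
  (P-Q-compatible : ∀ {c e} → P c → Q e → T (compatible c e))
  {b d : ℕ} (bd∈ : (b , d) ∈ demands)
  where

  #P #Q : List Triple → ℕ
  #P cs = length (filter P? cs)
  #Q es = length (filter Q? es)

  #-≤-countᵇ : ∀ {R : Triple → Set} (R? : Decidable R) {p} → (∀ {c} → R c → T (p c)) →
               ∀ cs → length (filter R? cs) ≤ countᵇ p cs
  #-≤-countᵇ R? R⇒p []       = z≤n
  #-≤-countᵇ R? {p} R⇒p (c ∷ cs) with R? c | p c in pc
  ... | yes r | true  = s≤s (#-≤-countᵇ R? R⇒p cs)
  ... | yes r | false = ⊥-elim (subst T pc (R⇒p r))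
  ... | no  _ | true  = m≤n⇒m≤1+n (#-≤-countᵇ R? R⇒p cs)
  ... | no  _ | false = #-≤-countᵇ R? R⇒p cs

  #-filterᵇ : ∀ {R : Triple → Set} (R? : Decidable R) {p} → (∀ {c} → R c → T (p c)) →
              ∀ cs → length (filter R? cs) ≤ length (filter R? (filterᵇ p cs))
  #-filterᵇ R? R⇒p []       = z≤n
  #-filterᵇ R? {p} R⇒p (c ∷ cs) with R? c | p c in pc
  ... | yes r | false = ⊥-elim (subst T pc (R⇒p r))
  ... | no  _ | false = #-filterᵇ R? R⇒p cs
  ... | yes r | true  with R? c
  ...   | yes _ = s≤s (#-filterᵇ R? R⇒p cs)
  ...   | no ¬r = contradiction r ¬r
  #-filterᵇ R? {p} R⇒p (c ∷ cs) | no ¬r | true with R? c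
  ...   | yes r = contradiction r ¬r
  ...   | no  _ = #-filterᵇ R? R⇒p cs

  #Q-strike : ∀ c es → #Q es ≤ suc (#Q (strike c es))
  #Q-strike c []       = z≤n
  #Q-strike c (e ∷ es) with compatible c e
  ... | true  with Q? e
  ...   | yes _ = s≤s (#Q-strike c es)
  ...   | no  _ = #Q-strike c es
  #Q-strike c (e ∷ es) | false with Q? e
  ...   | yes _ = ≤-refl
  ...   | no  _ = n≤1+n _

  -- The struck triple is in conflict with a member of `F`, hence it is not an edge of `G` and was
  -- not counted.
  #Q-strike-P : ∀ {c} → P c → ∀ es → #Q es ≤ #Q (strike c es)
  #Q-strike-P {c} Pc []       = z≤n
  #Q-strike-P {c} Pc (e ∷ es) with compatible c e in comp | Q? e in Qe
  ... | true  | yes _ rewrite Qe = s≤s (#Q-strike-P Pc es)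
  ... | true  | no  _ rewrite Qe = #Q-strike-P Pc es
  ... | false | yes q = ⊥-elim (subst T comp (P-Q-compatible Pc q))
  ... | false | no  _ = ≤-refl

  #-≤-total : ∀ cs es → #P cs + #Q es ≤ total cs es
  #-≤-total []       es = length-filter Q? es
  #-≤-total (c ∷ cs) es with P? c
  -- Of `c` and the triple struck with it at most one is real. If `c` is, nothing of `Q` is lost; if
  -- not, the `suc` that `total` spends on `c` pays for the struck triple.
  ... | yes Pc = s≤s (≤-trans (+-monoʳ-≤ (#P cs) (#Q-strike-P Pc es)) (#-≤-total cs _))
  ... | no  _  = ≤-trans (+-monoʳ-≤ (#P cs) (#Q-strike c es))
                   (≤-trans (≤-reflexive (+-suc (#P cs) _)) (s≤s (#-≤-total cs _)))

  -- This is `τ(F) = 3` in terms of labels. The witness is asked to satisfy `P` as well as to be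
  -- listed, because that is what lets it survive every filter that keeps the members of `F`.
  Avoidable : List Triple → Set
  Avoidable cs = ∀ i j → ∃[ c ] c ∈ cs × P c × i ∉ labels c × j ∉ labels c

  Avoidable-filterᵇ : ∀ {p cs} → (∀ {c} → P c → T (p c)) → Avoidable cs → Avoidable (filterᵇ p cs)
  Avoidable-filterᵇ {p} P⇒p avoid i j =
    let c , c∈ , Pc , i∉ , j∉ = avoid i j in
    c , ∈-filter⁺ (T? ∘ p) c∈ (P⇒p Pc) , Pc , i∉ , j∉

  ¬isCover : ∀ {cs} → Avoidable cs → ∀ i j → ¬ T (isCover cs i j)
  ¬isCover {cs} avoid i j cover =
    let c , c∈ , _ , i∉ , j∉ = avoid i j in
    [ i∉ ∘ contains⁻ i c , j∉ ∘ contains⁻ j c ]′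
      (∨⁻ {contains i c} (All.lookup (All.all⁺ _ cs cover) c∈))

  module _ (k : ℕ) where

    -- The invariant says that no filter has lost a real triple: at least `d` candidates name
    -- members of `F`, at least `b` name edges of `G`, and no two labels meet all named members of
    -- `F`.
    refuteF-sound : ∀ n cs es → T (refuteF k n cs es) →
                    d ≤ #P cs → b ≤ #Q es → Avoidable cs → ⊥
    refuteG-sound : ∀ n cs es → T (refuteG k n cs es) →
                    d ≤ #P cs → b ≤ #Q es → Avoidable cs → ⊥
    search-sound  : ∀ n cs es → T (search k n cs es) →
                    d ≤ #P cs → b ≤ #Q es → Avoidable cs → ⊥
    decide-sound  : ∀ n t cs es → T (decide k n t cs es) →
                    d ≤ #P cs → b ≤ #Q es → Avoidable cs → ⊥

    refuteF-sound n cs es ok d≤ b≤ avoid =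
      search-sound n cs (pruneG cs es) ok d≤ (≤-trans b≤ (#-filterᵇ Q? keep es)) avoid
      where
      keep : ∀ {e} → Q e → T (requiredF (length es) ≤ᵇ countᵇ (λ c → compatible c e) cs)
      keep Qe = ≤⇒≤ᵇ (≤-trans
        (requiredF-≤ bd∈ (≤-trans b≤ (length-filter Q? es)))
        (≤-trans d≤ (#-≤-countᵇ P? (λ Pc → P-Q-compatible Pc Qe) cs)))

    refuteG-sound n cs es ok d≤ b≤ avoid =
      search-sound n (pruneF cs es) es ok (≤-trans d≤ (#-filterᵇ P? keep cs)) b≤
        (Avoidable-filterᵇ keep avoid)
      where
      keep : ∀ {c} → P c → T (requiredG (length cs) ≤ᵇ countᵇ (compatible c) es)
      keep Pc = ≤⇒≤ᵇ (≤-trans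
        (requiredG-≤ bd∈ (≤-trans d≤ (length-filter P? cs)))
        (≤-trans b≤ (#-≤-countᵇ Q? (P-Q-compatible Pc) es)))

    search-sound (suc n) cs es ok d≤ b≤ avoid with ∨⁻ {length cs <ᵇ requiredF (length es)} ok
    ... | inj₁ few = <⇒≱ (<ᵇ⇒< (length cs) _ few)
            (≤-trans (requiredF-≤ bd∈ (≤-trans b≤ (length-filter Q? es)))
                     (≤-trans d≤ (length-filter P? cs)))
    ... | inj₂ ok with ∨⁻ {not (feasible (length es) (length cs) (total cs es))} ok
    ...   | inj₁ infeasible = T-not infeasible
              (feasible⁺ bd∈ (≤-trans b≤ (length-filter Q? es)) (≤-trans d≤ (length-filter P? cs))
                (≤-trans (≤-reflexive (+-comm b d)) (≤-trans (+-mono-≤ d≤ b≤) (#-≤-total cs es))))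
    ...   | inj₂ ok with ∨⁻ {any (λ i → any (isCover cs i) (upTo i)) (upTo k)} ok
    ...     | inj₁ covered =
                let i , _ , ok = find (Any.any⁻ (λ i → any (isCover cs i) (upTo i)) (upTo k) covered)
                    j , _ , cover = find (Any.any⁻ (isCover cs i) (upTo i) ok)
                in ¬isCover avoid i j cover
    ...     | inj₂ ok = decide-sound n (hardest cs es) cs es ok d≤ b≤ avoid

    decide-sound n t cs es ok d≤ b≤ avoid with P? t
    ... | yes Pt = refuteG-sound n cs (filterᵇ (compatible t) es) (proj₁ (∧⁻ ok)) d≤
                     (≤-trans b≤ (#-filterᵇ Q? (P-Q-compatible Pt) es)) avoid
    ... | no ¬Pt = refuteF-sound n (filterᵇ (not ∘ sameᵇ t) cs) es
                     (proj₂ (∧⁻ {refuteG k n cs (filterᵇ (compatible t) es)} ok))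
                     (≤-trans d≤ (#-filterᵇ P? keep cs)) b≤ (Avoidable-filterᵇ keep avoid)
      where
      keep : ∀ {c} → P c → T (not (sameᵇ t c))
      keep {c} Pc = not-T λ same → ¬Pt (subst P (sym (sameᵇ⇒≡ t c same)) Pc)

-- Soundness of the certificate checker

∈ᵇ⁻ : ∀ i c → T (i ∈ᵇ c) → i ∈ c
∈ᵇ⁻ i c i∈ = Any.map (≡ᵇ⇒≡ i _) (Any.any⁻ (i ≡ᵇ_) c i∈)

∈ᵇ⁺ : ∀ {i c} → i ∈ c → T (i ∈ᵇ c)
∈ᵇ⁺ {i} i∈ = Any.any⁺ (i ≡ᵇ_) (Any.map (≡⇒≡ᵇ i _) i∈)

⊆ᵇ⁻ : ∀ c e → T (c ⊆ᵇ e) → ∀ {i} → i ∈ c → i ∈ e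
⊆ᵇ⁻ c e c⊆e i∈c = ∈ᵇ⁻ _ e (All.lookup (All.all⁺ (_∈ᵇ e) c c⊆e) i∈c)

⊆ᵇ⁺ : ∀ {c e} → (∀ {i} → i ∈ c → i ∈ e) → T (c ⊆ᵇ e)
⊆ᵇ⁺ {c} {e} c⊆e = All.all⁻ (_∈ᵇ e) (All.tabulate (∈ᵇ⁺ ∘ c⊆e))

meets⁺ : ∀ {c e i} → i ∈ c → i ∈ e → T (meets c e)
meets⁺ {e = e} i∈c i∈e = Any.any⁺ (_∈ᵇ e) (lose i∈c (∈ᵇ⁺ i∈e))

Bounded : ℕ → Labels → Set
Bounded k = All (_< k)

bounded⁻ : ∀ k es → T (bounded (k , es)) → All (Bounded k) es
bounded⁻ k es ok =
  All.map (λ {e} ok → All.map (<ᵇ⇒< _ k) (All.all⁺ (_<ᵇ k) e ok)) (All.all⁺ _ es ok)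

-- The labels lying in a given edge form a filtered list, so the completeness of both `patterns` and
-- `triples` reduces to this.
filter∈sublists≤ : ∀ {R : ℕ → Set} (R? : Decidable R) n xs → length (filter R? xs) ≤ n →
                   filter R? xs ∈ sublists≤ n xs
filter∈sublists≤ R? n       []       _ = here refl
filter∈sublists≤ R? zero    (x ∷ xs) len≤ with filter R? (x ∷ xs)
... | [] = here refl
filter∈sublists≤ R? (suc n) (x ∷ xs) len≤ with R? x
filter∈sublists≤ R? (suc n) (x ∷ xs) (s≤s len≤) | yes _ =
  ∈-++⁺ˡ (∈-map⁺ (x ∷_) (filter∈sublists≤ R? n xs len≤))
filter∈sublists≤ R? (suc n) (x ∷ xs) len≤ | no _ =
  ∈-++⁺ʳ (map (x ∷_) (sublists≤ n xs)) (filter∈sublists≤ R? (suc n) xs len≤)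

labels-fromLabels : ∀ c → length c ≡ 3 → labels (fromLabels c) ≡ c
labels-fromLabels (a ∷ b ∷ c ∷ []) refl = refl

image : (ℕ → Fin N) → Labels → Subset N
image φ c = ⟦ map φ c ⟧

∈-image⁺ : ∀ (φ : ℕ → Fin N) {c i} → i ∈ c → φ i ∈ˢ image φ c
∈-image⁺ φ i∈c = ∈⟦⟧⁺ (∈-map⁺ φ i∈c)

∈-image⁻ : ∀ (φ : ℕ → Fin N) c {v} → v ∈ˢ image φ c → ∃[ i ] i ∈ c × v ≡ φ i
∈-image⁻ φ c v∈ = ∈-map⁻ φ (∈⟦⟧⁻ (map φ c) v∈)

image-mono : ∀ (φ : ℕ → Fin N) c e → (∀ {i} → i ∈ c → i ∈ e) →
             ∀ {v} → v ∈ˢ image φ c → v ∈ˢ image φ e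
image-mono φ c e c⊆e v∈ with ∈-image⁻ φ c v∈
... | i , i∈c , refl = ∈-image⁺ φ (c⊆e i∈c)

InjectiveBelow : ℕ → (ℕ → A) → Set
InjectiveBelow k φ = ∀ {i j} → i < k → j < k → φ i ≡ φ j → i ≡ j

map-unique : ∀ {φ : ℕ → A} {c} → InjectiveBelow k φ → Bounded k c → Unique c → Unique (map φ c)
map-unique inj []       []         = []
map-unique inj (i<k ∷ c<k) (i∉c ∷ c!) =
  All.map⁺ (All.tabulate λ j∈c → All.lookup i∉c j∈c ∘ inj i<k (All.lookup c<k j∈c))
  ∷ map-unique inj c<k c!

module _ {d : A} where

  applyUpTo-cong : ∀ {f g : ℕ → A} → f ≗ g → ∀ n → applyUpTo f n ≡ applyUpTo g n
  applyUpTo-cong f≗g zero    = refl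
  applyUpTo-cong f≗g (suc n) = cong₂ _∷_ (f≗g 0) (applyUpTo-cong (f≗g ∘ suc) n)

  applyUpTo-at : ∀ xs → applyUpTo (at d xs) (length xs) ≡ xs
  applyUpTo-at []       = refl
  applyUpTo-at (x ∷ xs) = cong (x ∷_) (applyUpTo-at xs)

  at∈ : ∀ xs {i} → i < length xs → at d xs i ∈ xs
  at∈ (x ∷ xs) {zero}  _         = here refl
  at∈ (x ∷ xs) {suc i} (s≤s i<n) = there (at∈ xs i<n)

  at-injective : ∀ {xs} → Unique xs → InjectiveBelow (length xs) (at d xs)
  at-injective (x∉ ∷ xs!) {zero}  {zero}  _ _ _ = refl
  at-injective {x ∷ xs} (x∉ ∷ xs!) {zero}  {suc j} _ (s≤s j<) eq =
    contradiction eq (All.lookup x∉ (at∈ xs j<))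
  at-injective {x ∷ xs} (x∉ ∷ xs!) {suc i} {zero}  (s≤s i<) _ eq =
    contradiction (sym eq) (All.lookup x∉ (at∈ xs i<))
  at-injective (x∉ ∷ xs!) {suc i} {suc j} (s≤s i<) (s≤s j<) eq =
    cong suc (at-injective xs! i< j< eq)

-- The edge `E` splits into the images of the labels in `s`, which lie outside `p` because `E`
-- avoids `p`, and into the vertices `news` without a label. Giving the latter the labels from `k`
-- on turns `E` into the image of the pattern belonging to `s`.
extend : ∀ {k} (φ : ℕ → Fin N) → InjectiveBelow k φ → ∀ p E → ∣ E ∣ ≡ 3 →
         (∀ {v} → v ∈ˢ image φ p → v ∉ˢ E) →
         ∃[ k′ ] ∃[ e ] ∃[ φ′ ] (k′ , e) ∈ patterns k p × InjectiveBelow k′ φ′ ×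
           image φ′ e ≡ E × (∀ i → i < k → φ′ i ≡ φ i)
extend {N} {k} φ φ-inj p E ∣E∣≡3 p∩E =
  k + r , s ++ applyUpTo (k +_) r , φ′ ,
  ∈-map⁺ pattern-of (filter∈sublists≤ s? 3 rest (subst (length s ≤_) len (m≤m+n _ _))) ,
  φ′-inj , trans (cong ⟦_⟧ map-φ′) ⟦xs⟧≡E , φ′-old
  where
  pattern-of : Labels → ℕ × Labels
  pattern-of s = k + (3 ∸ length s) , s ++ applyUpTo (k +_) (3 ∸ length s)

  K    = image φ (upTo k)
  s?   = λ i → φ i ∈? E
  new? = λ v → ¬? (v ∈? K)
  rest = filterᵇ (λ i → not (i ∈ᵇ p)) (upTo k)
  s    = filter s? rest
  news = filter new? (members E)
  r    = 3 ∸ length s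

  ∈K : ∀ {i} → i < k → φ i ∈ˢ K
  ∈K i<k = ∈-image⁺ φ (∈-upTo⁺ i<k)

  s<k : Bounded k s
  s<k = All.filter⁺ s? (All.filter⁺ (T? ∘ λ i → not (i ∈ᵇ p)) (All.tabulate ∈-upTo⁻))

  xs! : Unique (map φ s ++ news)
  xs! = Unique.++⁺
    (map-unique φ-inj s<k (Unique.filter⁺ s? (Unique.filter⁺ (T? ∘ λ i → not (i ∈ᵇ p)) (Unique.upTo⁺ k))))
    (Unique.filter⁺ new? (members-unique E))
    λ (v∈s , v∈news) → old∩new (∈-map⁻ φ v∈s) (proj₂ (∈-filter⁻ new? {xs = members E} v∈news))
    where
    old∩new : ∀ {v} → ∃[ i ] i ∈ s × v ≡ φ i → v ∉ˢ K → ⊥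
    old∩new (i , i∈s , refl) v∉K = v∉K (∈K (All.lookup s<k i∈s))

  xs⊆E : ∀ {v} → v ∈ map φ s ++ news → v ∈ˢ E
  xs⊆E v∈ with ∈-++⁻ (map φ s) v∈
  ... | inj₂ v∈news = ∈-members⁻ E (proj₁ (∈-filter⁻ new? v∈news))
  ... | inj₁ v∈s with ∈-map⁻ φ v∈s
  ...   | i , i∈s , refl = proj₂ (∈-filter⁻ s? {xs = rest} i∈s)

  E⊆xs : ∀ {v} → v ∈ˢ E → v ∈ map φ s ++ news
  E⊆xs {v} v∈E with v ∈? K
  ... | no  v∉K = ∈-++⁺ʳ (map φ s) (∈-filter⁺ new? (∈-members⁺ v∈E) v∉K)
  ... | yes v∈K with ∈-image⁻ φ (upTo k) v∈K
  ...   | i , i∈ , refl = ∈-++⁺ˡ (∈-map⁺ φ (∈-filter⁺ s?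
            (∈-filter⁺ (T? ∘ λ i → not (i ∈ᵇ p)) i∈
              (not-T λ i∈p → p∩E (∈-image⁺ φ (∈ᵇ⁻ i p i∈p)) v∈E)) v∈E))

  ⟦xs⟧≡E : ⟦ map φ s ++ news ⟧ ≡ E
  ⟦xs⟧≡E = unique⊆⇒⟦⟧≡ E xs! xs⊆E (∣∣≤length E E⊆xs)

  len : length s + length news ≡ 3
  len = begin
    length s + length news          ≡⟨ cong (_+ length news) (length-map φ s) ⟨
    length (map φ s) + length news  ≡⟨ length-++ (map φ s) ⟨
    length (map φ s ++ news)        ≡⟨ ≤-antisym (unique⇒length≤∣∣ E xs! xs⊆E) (∣∣≤length E E⊆xs) ⟩
    ∣ E ∣                           ≡⟨ ∣E∣≡3 ⟩
    3                               ∎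
    where open ≡-Reasoning

  r≡ : r ≡ length news
  r≡ = trans (cong (_∸ length s) (sym len)) (m+n∸m≡n (length s) _)

  -- The default `φ 0` makes the labelling total. It is taken only from label `k + r` on, where
  -- injectivity is not claimed.
  new : ℕ → Fin N
  new = at (φ 0) news

  φ′ : ℕ → Fin N
  φ′ i with i <? k
  ... | yes _ = φ i
  ... | no  _ = new (i ∸ k)

  φ′-old : ∀ i → i < k → φ′ i ≡ φ i
  φ′-old i i<k with i <? k
  ... | yes _  = refl
  ... | no i≮k = contradiction i<k i≮k

  φ′-new : ∀ j → φ′ (k + j) ≡ new j
  φ′-new j with k + j <? k
  ... | yes k+j<k = contradiction k+j<k (m+n≮m k j)
  ... | no  _     = cong new (m+n∸m≡n k j)

  map-φ′ : map φ′ (s ++ applyUpTo (k +_) r) ≡ map φ s ++ news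
  map-φ′ = begin
    map φ′ (s ++ applyUpTo (k +_) r)        ≡⟨ map-++ φ′ s _ ⟩
    map φ′ s ++ map φ′ (applyUpTo (k +_) r)
      ≡⟨ cong₂ _++_ (map-cong-local (All.map (λ {i} → φ′-old i) s<k)) (map-applyUpTo (k +_) φ′ r) ⟩
    map φ s ++ applyUpTo (φ′ ∘ (k +_)) r    ≡⟨ cong (map φ s ++_) (applyUpTo-cong {d = φ 0} φ′-new r) ⟩
    map φ s ++ applyUpTo new r              ≡⟨ cong (λ r → map φ s ++ applyUpTo new r) r≡ ⟩
    map φ s ++ applyUpTo new (length news)  ≡⟨ cong (map φ s ++_) (applyUpTo-at news) ⟩
    map φ s ++ news                         ∎
    where open ≡-Reasoning

  ∸k< : ∀ {i} → ¬ i < k → i < k + r → i ∸ k < length news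
  ∸k< {i} i≮k i<k+r =
    subst (i ∸ k <_) (trans (m+n∸m≡n k r) r≡) (∸-monoˡ-< i<k+r (≮⇒≥ i≮k))

  new∉K : ∀ {i} → i < length news → new i ∉ˢ K
  new∉K i< = proj₂ (∈-filter⁻ new? {xs = members E} (at∈ news i<))

  φ′-inj : InjectiveBelow (k + r) φ′
  φ′-inj {i} {j} i< j< eq with i <? k | j <? k
  ... | yes i<k | yes j<k = φ-inj i<k j<k eq
  ... | yes i<k | no  j≮k = contradiction (subst (_∈ˢ K) eq (∈K i<k)) (new∉K (∸k< j≮k j<))
  ... | no  i≮k | yes j<k = contradiction (subst (_∈ˢ K) (sym eq) (∈K j<k)) (new∉K (∸k< i≮k i<))
  ... | no  i≮k | no  j≮k = ∸-cancelʳ-≡ (≮⇒≥ i≮k) (≮⇒≥ j≮k)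
          (at-injective (Unique.filter⁺ new? (members-unique E)) (∸k< i≮k i<) (∸k< j≮k j<) eq)

-- Realised configurations and their refutation

twoDisjointEdges : State
twoDisjointEdges = 6 , (3 ∷ 4 ∷ 5 ∷ []) ∷ (0 ∷ 1 ∷ 2 ∷ []) ∷ []

-- The hypotheses collect what is used of `F = B(G)`. The covering numbers enter as avoidance: a set
-- with fewer than three vertices is no cover, so some member of the family misses it. For `G` this
-- produces new edges and the weights; for `F` it confines `G` to the labels and closes branches of
-- the search.
module Refutation
  (G F : 3-Graph N)
  (cross : ∀ {T E} → T ∈ edges F → E ∈ edges G → ∃[ v ] v ∈ˢ T × v ∈ˢ E)
  (disjoint : ∀ {E} → E ∈ edges F → E ∉ edges G)
  (G-avoids : ∀ S → ∣ S ∣ < 3 → ∃[ E ] E ∈ edges G × (∀ {v} → v ∈ˢ S → v ∉ˢ E))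
  (F-avoids : ∀ S → ∣ S ∣ < 3 → ∃[ E ] E ∈ edges F × (∀ {v} → v ∈ˢ S → v ∉ˢ E))
  {b d : ℕ} (bd∈ : (b , d) ∈ demands) (b≤ : b ≤ size G) (d≤ : d ≤ size F)
  where

  ∣G∣ : ∀ {E} → E ∈ edges G → ∣ E ∣ ≡ 3
  ∣G∣ = All.lookup (uniform G)

  ∣F∣ : ∀ {E} → E ∈ edges F → ∣ E ∣ ≡ 3
  ∣F∣ = All.lookup (uniform F)

  Realises : State → (ℕ → Fin N) → Set
  Realises (k , es) φ = InjectiveBelow k φ × All (λ e → image φ e ∈ edges G) es

  Refuted : State → Set
  Refuted s = ∀ φ → ¬ Realises s φ

  nth-refuted : ∀ {known} i {s} → All Refuted known → nth known i ≡ just s → Refuted s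
  nth-refuted {s ∷ _} zero    (r ∷ _)  refl = r
  nth-refuted {_ ∷ _} (suc i) (_ ∷ rs) eq   = nth-refuted i rs eq

  embeds-sound : ∀ s s′ ψ → T (embeds s s′ ψ) → ∀ {φ} → Realises s′ φ → Realises s (φ ∘ ψ)
  embeds-sound (k , es) (k′ , es′) ψ ok {φ} (φ-inj , φ-edges) =
    (λ i<k j<k φψ≡ → ψ-inj i<k j<k (φ-inj (ψ< i<k) (ψ< j<k) φψ≡)) ,
    All.map (λ {e} → edge e) (All.all⁺ (λ e → any (sameSet (map ψ e)) es′) es ok₃)
    where
    ok₁ = proj₁ (∧⁻ ok)
    ok₂ = proj₁ (∧⁻ {injectiveᵇ k ψ} (proj₂ (∧⁻ {all (λ i → ψ i <ᵇ k′) (upTo k)} ok)))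
    ok₃ = proj₂ (∧⁻ {injectiveᵇ k ψ} (proj₂ (∧⁻ {all (λ i → ψ i <ᵇ k′) (upTo k)} ok)))

    ψ< : ∀ {i} → i < k → ψ i < k′
    ψ< i<k = <ᵇ⇒< _ k′ (All.lookup (All.all⁺ (λ i → ψ i <ᵇ k′) (upTo k) ok₁) (∈-upTo⁺ i<k))

    ψ-inj : InjectiveBelow k ψ
    ψ-inj {i} {j} i<k j<k ψi≡ψj
      with ∨⁻ {not (ψ i ≡ᵇ ψ j)} (All.lookup (All.all⁺ _ (upTo k)
             (All.lookup (All.all⁺ _ (upTo k) ok₂) (∈-upTo⁺ i<k))) (∈-upTo⁺ j<k))
    ... | inj₁ ψi≢ψj = contradiction (≡⇒≡ᵇ (ψ i) (ψ j) ψi≡ψj) (T-not ψi≢ψj)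
    ... | inj₂ i≡j   = ≡ᵇ⇒≡ i j i≡j

    edge : ∀ e → T (any (sameSet (map ψ e)) es′) → image (φ ∘ ψ) e ∈ edges G
    edge e ok with find (Any.any⁻ (sameSet (map ψ e)) es′ ok)
    ... | e′ , e′∈ , same =
      subst (_∈ edges G)
        (trans (⊆-antisym (image-mono φ e′ (map ψ e) (⊆ᵇ⁻ e′ (map ψ e) (proj₂ (∧⁻ {map ψ e ⊆ᵇ e′} same))))
                          (image-mono φ (map ψ e) e′ (⊆ᵇ⁻ (map ψ e) e′ (proj₁ (∧⁻ same)))))
               (cong ⟦_⟧ (sym (map-∘ e))))
        (All.lookup φ-edges e′∈)

  checkEmbedding-sound : ∀ {known} → All Refuted known → ∀ s i x →
                         T (checkEmbedding known s i x) → Refuted s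
  checkEmbedding-sound {known} rs s i x ok φ φ-real with nth known i in eq
  ... | just (k , es) =
    nth-refuted i rs eq (φ ∘ at 0 (digits k x)) (embeds-sound (k , es) s (at 0 (digits k x)) ok φ-real)

  -- Distinct labels below `k` have distinct images, so a partial cover with three of them that lies
  -- in a triple is that triple, and one with `s` of them fixes `s` vertices in the weight.
  WF : ℕ → Labels → Set
  WF k c = Bounded k c × Unique c

  module _ (φ : ℕ → Fin N) where

    _⊑_ : Labels → Subset N → Set
    c ⊑ E = All (λ i → φ i ∈ˢ E) c

    Covered : List Labels → Subset N → Set
    Covered cs E = Any (_⊑ E) cs

    module _ {k} (φ-inj : InjectiveBelow k φ) where

      ⊑⇒image≡ : ∀ {c E} → WF k c → c ⊑ E → ∣ E ∣ ≤ length c → image φ c ≡ E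
      ⊑⇒image≡ {c} {E} (c<k , c!) c⊑E ∣E∣≤ =
        unique⊆⇒⟦⟧≡ E (map-unique φ-inj c<k c!) (λ v∈ → sub (∈-map⁻ φ v∈))
          (subst (∣ E ∣ ≤_) (sym (length-map φ c)) ∣E∣≤)
        where
        sub : ∀ {v} → ∃[ i ] i ∈ c × v ≡ φ i → v ∈ˢ E
        sub (i , i∈c , refl) = All.lookup c⊑E i∈c

      ⊑⇒length≤ : ∀ {c E} → WF k c → c ⊑ E → length c ≤ ∣ E ∣
      ⊑⇒length≤ {c} {E} (c<k , c!) c⊑E =
        subst (_≤ ∣ E ∣) (length-map φ c)
          (unique⇒length≤∣∣ E (map-unique φ-inj c<k c!) (λ v∈ → sub (∈-map⁻ φ v∈)))
        where
        sub : ∀ {v} → ∃[ i ] i ∈ c × v ≡ φ i → v ∈ˢ E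
        sub (i , i∈c , refl) = All.lookup c⊑E i∈c

      image∩ : ∀ {c e v} → Bounded k c → Bounded k e →
               v ∈ˢ image φ c → v ∈ˢ image φ e → ∃[ i ] i ∈ c × i ∈ e
      image∩ {c} {e} c<k e<k v∈c v∈e with ∈-image⁻ φ c v∈c | ∈-image⁻ φ e v∈e
      ... | i , i∈c , refl | j , j∈e , φi≡φj
        with refl ← φ-inj (All.lookup c<k i∈c) (All.lookup e<k j∈e) φi≡φj = i , i∈c , j∈e

      insert-WF : ∀ {c cs} → WF k c → All (WF k) cs → All (WF k) (insert c cs)
      insert-WF {c} {cs} wf wfs with any (_⊆ᵇ c) cs
      ... | true  = wfs
      ... | false = wf ∷ wfs

      -- If `c` is dropped, it contains a listed set, which a member of `F` containing `c` contains
      -- too.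
      insert-new : ∀ {c cs E} → c ⊑ E → Covered (insert c cs) E
      insert-new {c} {cs} c⊑E with any (_⊆ᵇ c) cs in eq
      ... | true  = Any.map (λ {c′} c′⊆c → All.tabulate λ i∈ → All.lookup c⊑E (⊆ᵇ⁻ c′ c c′⊆c i∈))
                      (Any.any⁻ (_⊆ᵇ c) cs (subst T (sym eq) _))
      ... | false = here c⊑E

      insert-old : ∀ {c cs E} → Covered cs E → Covered (insert c cs) E
      insert-old {c} {cs} cov with any (_⊆ᵇ c) cs
      ... | true  = cov
      ... | false = there cov

      inserts-WF : ∀ {cs} ns → All (WF k) ns → All (WF k) cs → All (WF k) (foldr insert cs ns)
      inserts-WF []       []        wfs = wfs
      inserts-WF (n ∷ ns) (wf ∷ wf′) wfs = insert-WF {n} wf (inserts-WF ns wf′ wfs)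

      inserts-old : ∀ {cs} ns {E} → Covered cs E → Covered (foldr insert cs ns) E
      inserts-old []       cov = cov
      inserts-old {cs} (n ∷ ns) cov = insert-old {n} {foldr insert cs ns} (inserts-old ns cov)

      inserts-new : ∀ {cs} ns {E} → Covered ns E → Covered (foldr insert cs ns) E
      inserts-new {cs} (n ∷ ns) (here n⊑E)  = insert-new {n} {foldr insert cs ns} n⊑E
      inserts-new {cs} (n ∷ ns) (there cov) = insert-old {n} {foldr insert cs ns} (inserts-new ns cov)

      extensions-WF : ∀ {e c} → Bounded k e → WF k c → ¬ T (meets c e) → All (WF k) (extensions e c)
      extensions-WF {e} {c} e<k (c<k , c!) ¬meets with 3 ≤ᵇ length c
      ... | true  = []
      ... | false = All.map⁺ (All.tabulate λ i∈e →
        All.lookup e<k i∈e ∷ c<k ,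
        All.tabulate (λ j∈c i≡j → ¬meets (meets⁺ (subst (_∈ c) (sym i≡j) j∈c) i∈e)) ∷ c!)

      refine-WF : ∀ {e cs} → Bounded k e → All (WF k) cs → All (WF k) (refine e cs)
      refine-WF {e} {cs} e<k wfs =
        inserts-WF (concatMap (extensions e) (filterᵇ (λ c → not (meets c e)) cs))
          (All.concat⁺ (All.map⁺ (All.tabulate λ {c} c∈ →
            let c∈cs , ¬meets = ∈-filter⁻ (T? ∘ λ c → not (meets c e)) {xs = cs} c∈ in
            extensions-WF e<k (All.lookup wfs c∈cs) (T-not ¬meets))))
          (All.filter⁺ (T? ∘ λ c → meets c e) wfs)

      -- Let `c` be a partial cover inside `E`. If it meets `e`, it is kept. Otherwise `E` meets the
      -- edge in the image of some label `i` of `e`, and `i ∷ c` still lies in `E`. No extension is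
      -- provided when `c` already has three labels, but then `E` is the image of `c`, and by
      -- cross-intersection `c` would meet `e` after all.
      refine-covered : ∀ {e cs} → Bounded k e → image φ e ∈ edges G → All (WF k) cs →
                       ∀ {E} → E ∈ edges F → Covered cs E → Covered (refine e cs) E
      refine-covered {e} {cs} e<k e∈G wfs {E} E∈F cov with find cov
      ... | c , c∈cs , c⊑E with T? (meets c e)
      ...   | yes met = inserts-old (concatMap (extensions e) (filterᵇ (λ c → not (meets c e)) cs))
                          (lose (∈-filter⁺ (T? ∘ λ c → meets c e) c∈cs met) c⊑E)
      ...   | no ¬met =
        inserts-new (concatMap (extensions e) (filterᵇ (λ c → not (meets c e)) cs))
          (Any.concatMap⁺ (extensions e)
            (lose (∈-filter⁺ (T? ∘ λ c → not (meets c e)) c∈cs (not-T ¬met)) extended))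
        where
        wf = All.lookup wfs c∈cs
        extended : Covered (extensions e c) E
        extended with 3 ≤ᵇ length c in eq
        ... | true  =
          let v , v∈E , v∈e = cross E∈F e∈G
              image≡ = ⊑⇒image≡ wf c⊑E
                (subst (_≤ length c) (sym (∣F∣ E∈F)) (≤ᵇ⇒≤ 3 (length c) (subst T (sym eq) _)))
              i , i∈c , i∈e = image∩ (proj₁ wf) e<k (subst (v ∈ˢ_) (sym image≡) v∈E) v∈e
          in contradiction (meets⁺ i∈c i∈e) ¬met
        ... | false with cross E∈F e∈G
        ...   | v , v∈E , v∈e with ∈-image⁻ φ e v∈e
        ...     | i , i∈e , refl = Any.map⁺ (lose i∈e (v∈E ∷ c⊑E))

      covers-WF : ∀ es → All (Bounded k) es → All (WF k) (covers es)
      covers-WF []       []        = ([] , []) ∷ []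
      covers-WF (e ∷ es) (e<k ∷ es<k) = refine-WF e<k (covers-WF es es<k)

      covers-covered : ∀ es → All (Bounded k) es → All (λ e → image φ e ∈ edges G) es →
                       ∀ {E} → E ∈ edges F → Covered (covers es) E
      covers-covered []       []           []           E∈F = here []
      covers-covered (e ∷ es) (e<k ∷ es<k) (e∈G ∷ es∈G) E∈F =
        refine-covered e<k e∈G (covers-WF es es<k) E∈F (covers-covered es es<k es∈G E∈F)

      live-WF : ∀ es {cs} → All (WF k) cs → All (WF k) (live es cs)
      live-WF es = All.filter⁺ (T? ∘ λ c → not (hasLength 3 c ∧ any (c ⊆ᵇ_) es))

      -- A removed cover has three labels inside a known edge, so a member of `F` containing it
      -- would be that edge, whereas `F` and `G` are disjoint.
      live-covered : ∀ es {cs} → All (λ e → image φ e ∈ edges G) es → All (WF k) cs →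
                     ∀ {E} → E ∈ edges F → Covered cs E → Covered (live es cs) E
      live-covered es {cs} es∈G wfs {E} E∈F cov with find cov
      ... | c , c∈cs , c⊑E = lose (∈-filter⁺ (T? ∘ _) c∈cs (not-T dead)) c⊑E
        where
        dead : ¬ T (hasLength 3 c ∧ any (c ⊆ᵇ_) es)
        dead ok with find (Any.any⁻ (c ⊆ᵇ_) es (proj₂ (∧⁻ {hasLength 3 c} ok)))
        ... | e , e∈es , c⊆e =
          disjoint E∈F (subst (_∈ edges G)
            (sym (⊆∧∣∣≡⇒≡ E⊆e (trans (∣F∣ E∈F) (sym (∣G∣ e∈G))))) e∈G)
          where
          e∈G = All.lookup es∈G e∈es
          len = ≡ᵇ⇒≡ (length c) 3 (proj₁ (∧⁻ ok))
          E⊆e : ∀ {v} → v ∈ˢ E → v ∈ˢ image φ e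
          E⊆e v∈E = image-mono φ c e (⊆ᵇ⁻ c e c⊆e)
            (subst (_ ∈ˢ_) (sym (⊑⇒image≡ (All.lookup wfs c∈cs) c⊑E
              (≤-reflexive (trans (∣F∣ E∈F) (sym len))))) v∈E)

  -- While `S` has fewer than three vertices, some edge of `G` avoids it. Every member of `F`
  -- containing `S` meets this edge, necessarily outside `S`, so it contains one of three sets with
  -- one more vertex. A list that contains all these members is returned instead of a count, which
  -- makes unions and repetitions harmless.
  narrow : ∀ n S → length S + n ≡ 3 → Unique S →
           ∃[ Es ] length Es ≤ 3 ^ n ×
             (∀ {E} → E ∈ edges F → (∀ {v} → v ∈ S → v ∈ˢ E) → E ∈ Es)
  narrow zero S len S! = ⟦ S ⟧ ∷ [] , ≤-refl , λ {E} E∈F S⊆E →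
    here (sym (unique⊆⇒⟦⟧≡ E S! S⊆E (≤-reflexive (trans (∣F∣ E∈F) (sym (trans (sym (+-identityʳ _)) len))))))
  narrow (suc n) S len S! =
    let E , E∈G , S∩E = G-avoids ⟦ S ⟧ (≤-<-trans (∣⟦⟧∣≤length S)
                          (subst (length S <_) len (m<m+n (length S) z<s)))
        Es , len≤ , all = go (members E) λ v∈ → S∩E′ E S∩E (∈-members⁻ E v∈)
    in Es , subst (λ n → length Es ≤ n * _) (trans (length-members E) (∣G∣ E∈G)) len≤ ,
       λ T∈F S⊆T → let v , v∈T , v∈E = cross T∈F E∈G in all T∈F S⊆T (∈-members⁺ v∈E) v∈T
    where
    S∩E′ : ∀ E → (∀ {v} → v ∈ˢ ⟦ S ⟧ → v ∉ˢ E) → ∀ {v} → v ∈ˢ E → v ∉ S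
    S∩E′ E S∩E v∈E v∈S = S∩E (∈⟦⟧⁺ v∈S) v∈E
    go : ∀ vs → (∀ {v} → v ∈ vs → v ∉ S) →
         ∃[ Es ] length Es ≤ length vs * 3 ^ n ×
           (∀ {E} → E ∈ edges F → (∀ {v} → v ∈ S → v ∈ˢ E) → ∀ {v} → v ∈ vs → v ∈ˢ E → E ∈ Es)
    go []       _  = [] , z≤n , λ _ _ ()
    go (v ∷ vs) ∉S =
      let Es , len≤ , all = narrow n (v ∷ S) (trans (sym (+-suc (length S) n)) len)
                              (All.tabulate (λ w∈S v≡w → ∉S (here refl) (subst (_∈ S) (sym v≡w) w∈S)) ∷ S!)
          Es′ , len≤′ , all′ = go vs (∉S ∘ there)
      in Es ++ Es′ ,
         subst (_≤ 3 ^ n + length vs * 3 ^ n) (sym (length-++ Es)) (+-mono-≤ len≤ len≤′) ,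
         λ E∈F S⊆E → λ
           { (here refl)  v∈E → ∈-++⁺ˡ (all E∈F λ { (here refl) → v∈E ; (there w∈S) → S⊆E w∈S })
           ; (there w∈vs) w∈E → ∈-++⁺ʳ Es (all′ E∈F S⊆E w∈vs w∈E) }

  weight-bound : ∀ {φ k} → InjectiveBelow k φ → ∀ cs → All (WF k) cs →
                 (∀ {E} → E ∈ edges F → Covered φ cs E) → size F ≤ weight cs
  weight-bound {φ} {k} φ-inj cs wfs cov =
    let Es , len≤ , all = go cs wfs in
    ≤-trans (unique-⊆⇒length≤ (unique F) (λ E∈F → all E∈F (cov E∈F))) len≤
    where
    go : ∀ cs → All (WF k) cs →
         ∃[ Es ] length Es ≤ weight cs × (∀ {E} → E ∈ edges F → Covered φ cs E → E ∈ Es)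
    go []       []         = [] , z≤n , λ _ ()
    go (c ∷ cs) (wf ∷ wfs) =
      let Es , len≤ , all    = containing (length c ≤? 3)
          Es′ , len≤′ , all′ = go cs wfs
      in Es ++ Es′ , subst (_≤ weight (c ∷ cs)) (sym (length-++ Es)) (+-mono-≤ len≤ len≤′) ,
         λ E∈F → λ { (here c⊑E)  → ∈-++⁺ˡ (all E∈F c⊑E)
                   ; (there cov) → ∈-++⁺ʳ Es (all′ E∈F cov) }
      where
      containing : Dec (length c ≤ 3) →
        ∃[ Es ] length Es ≤ 3 ^ (3 ∸ length c) × (∀ {E} → E ∈ edges F → _⊑_ φ c E → E ∈ Es)
      -- More than three distinct labels fit into no triple, so the empty list suffices.
      containing (no  ≰3) = [] , z≤n , λ {E} E∈F c⊑E →
        contradiction (subst (length c ≤_) (∣F∣ E∈F) (⊑⇒length≤ φ φ-inj {E = E} wf c⊑E)) ≰3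
      containing (yes ≤3) =
        let Es , len≤ , all = narrow (3 ∸ length c) (map φ c)
              (trans (cong (_+ (3 ∸ length c)) (length-map φ c)) (m+[n∸m]≡n ≤3))
              (map-unique φ-inj (proj₁ wf) (proj₂ wf))
        in Es , len≤ , λ {E} E∈F c⊑E → all E∈F λ v∈ → sub {E} c⊑E (∈-map⁻ φ v∈)
        where
        sub : ∀ {E v} → _⊑_ φ c E → ∃[ i ] i ∈ c × v ≡ φ i → v ∈ˢ E
        sub c⊑E (i , i∈c , refl) = All.lookup c⊑E i∈c

  enough⁺ : ∀ {w} → d ≤ w → T (enough w)
  enough⁺ {w} d≤w = Any.any⁺ (λ (_ , d) → d ≤ᵇ w) (lose bd∈ (≤⇒≤ᵇ d≤w))

  -- Configurations on whose labels both families live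

  module Closed {k} (φ : ℕ → Fin N) (φ-inj : InjectiveBelow k φ) where

    K : Subset N
    K = image φ (upTo k)

    named : ∀ E → ∣ E ∣ ≡ 3 → (∀ {v} → v ∈ˢ E → v ∈ˢ K) →
            ∃[ t ] t ∈ triples k × Bounded k (labels t) × image φ (labels t) ≡ E
    named E ∣E∣≡3 E⊆K =
      fromLabels c ,
      ∈-map⁺ fromLabels (∈-filter⁺ (T? ∘ hasLength 3)
        (filter∈sublists≤ c? 3 (upTo k) (≤-reflexive len)) (≡⇒≡ᵇ (length c) 3 len)) ,
      subst (Bounded k) (sym labels≡) c<k ,
      trans (cong (image φ) labels≡) image≡
      where
      c? = λ i → φ i ∈? E
      c  = filter c? (upTo k)
      c<k : Bounded k c
      c<k = All.filter⁺ c? (All.tabulate ∈-upTo⁻)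
      c⊆E : ∀ {v} → v ∈ map φ c → v ∈ˢ E
      c⊆E v∈ with ∈-map⁻ φ v∈
      ... | i , i∈c , refl = proj₂ (∈-filter⁻ c? {xs = upTo k} i∈c)
      E⊆c : ∀ {v} → v ∈ˢ E → v ∈ map φ c
      E⊆c v∈E with ∈-image⁻ φ (upTo k) (E⊆K v∈E)
      ... | i , i∈ , refl = ∈-map⁺ φ (∈-filter⁺ c? i∈ v∈E)
      c! : Unique (map φ c)
      c! = map-unique φ-inj c<k (Unique.filter⁺ c? (Unique.upTo⁺ k))
      len : length c ≡ 3
      len = trans (sym (length-map φ c))
        (trans (≤-antisym (unique⇒length≤∣∣ E c! c⊆E) (∣∣≤length E E⊆c)) ∣E∣≡3)
      labels≡ : labels (fromLabels c) ≡ c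
      labels≡ = labels-fromLabels c len
      image≡ : image φ c ≡ E
      image≡ = unique⊆⇒⟦⟧≡ E c! c⊆E (∣∣≤length E E⊆c)

    Names : 3-Graph N → Triple → Set
    Names H t = Bounded k (labels t) × image φ (labels t) ∈ edges H

    names? : ∀ H → Decidable (Names H)
    names? H t = All.all? (_<? k) (labels t) ×-dec (image φ (labels t) ∈ᴸ? edges H)

    compatible-names : ∀ {c e} → Names F c → Names G e → T (compatible c e)
    compatible-names {c} {e} (c<k , c∈F) (e<k , e∈G) =
      let v , v∈c , v∈e = cross c∈F e∈G
          i , i∈c , i∈e = image∩ φ φ-inj c<k e<k v∈c v∈e
      in compatible⁺ c e i∈c i∈e λ { refl → disjoint c∈F e∈G }

    size-≤ : ∀ H ts → (∀ {E} → E ∈ edges H → ∃[ t ] t ∈ ts × Names H t × image φ (labels t) ≡ E) →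
             size H ≤ length (filter (names? H) ts)
    size-≤ H ts name =
      subst (size H ≤_) (length-map (image φ ∘ labels) (filter (names? H) ts))
        (unique-⊆⇒length≤ (unique H) λ E∈H →
          let t , t∈ , Ht , image≡ = name E∈H in
          subst (_∈ _) image≡ (∈-map⁺ (image φ ∘ labels) (∈-filter⁺ (names? H) t∈ Ht)))

    -- If an edge `E` had a vertex outside `K`, then `E ∩ K` would have at most two vertices, and
    -- some member of `F` would avoid it. That member lies in `K` and meets `E`, hence meets
    -- `E ∩ K`, a contradiction.
    G⊆K : (∀ {E} → E ∈ edges F → ∀ {v} → v ∈ˢ E → v ∈ˢ K) →
          ∀ {E} → E ∈ edges G → ∀ {v} → v ∈ˢ E → v ∈ˢ K
    G⊆K F⊆K {E} E∈G {v} v∈E with v ∈? K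
    ... | yes v∈K = v∈K
    ... | no  v∉K =
      let E′ , E′∈F , avoids = F-avoids (E ∩ K)
            (subst (∣ E ∩ K ∣ <_) (∣G∣ E∈G) (∣∩∣<∣∣ E K v∈E v∉K))
          w , w∈E′ , w∈E = cross E′∈F E∈G
      in contradiction w∈E′ (avoids (x∈p∩q⁺ (w∈E , F⊆K E′∈F w∈E′)))

    -- The same labelling `φ` would realise the state enlarged by the excluded triple, into which a
    -- refuted state embeds.
    ¬excluded : ∀ {known} → All Refuted known → ∀ {es} →
                All (λ e → image φ e ∈ edges G) es → ∀ ex →
                T (all (λ (e , i , x) → checkEmbedding known (k , digits 3 e ∷ es) i x) ex) →
                ∀ t → image φ (labels t) ∈ edges G → ¬ T (excluded ex t)
    ¬excluded {known} rs {es} es∈G ex ok t t∈G ex∋t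
      with find (Any.any⁻ (λ (e , _) → sameᵇ t (fromLabels (digits 3 e))) ex ex∋t)
    ... | (e , i , x) , ex∈ , same with refl ← sameᵇ⇒≡ t (fromLabels (digits 3 e)) same =
      checkEmbedding-sound rs (k , digits 3 e ∷ es) i x
        (All.lookup (All.all⁺ (λ (e , i , x) → checkEmbedding known (k , digits 3 e ∷ es) i x) ex ok)
          ex∈)
        φ (φ-inj , t∈G ∷ es∈G)

    closed-sound : ∀ {known} → All Refuted known → ∀ {es} →
                   All (λ e → image φ e ∈ edges G) es → ∀ ex cs →
                   All (WF k) cs → (∀ {E} → E ∈ edges F → Covered φ cs E) →
                   ¬ T (checkClosed known (k , es) ex cs)
    closed-sound {known} rs {es} es∈G ex cs wfs cov ok =
      refuteF-sound k 50 ts us ok₃ (≤-trans d≤ (size-≤ F ts F-named))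
        (≤-trans b≤ (size-≤ G us G-named)) avoidable
      where
      open Search (names? F) (names? G) (λ {c} {e} → compatible-names {c} {e}) bd∈
      checkExcluded : ℕ × ℕ × ℕ → Bool
      checkExcluded (e , i , x) = checkEmbedding known (k , digits 3 e ∷ es) i x
      ts = candidatesF k cs
      us = candidatesG k ex
      ok₁ : T (all checkExcluded ex)
      ok₁ = proj₁ (∧⁻ ok)
      ok₂₃ : T (all (hasLength 3) cs ∧ refuteF k 50 ts us)
      ok₂₃ = proj₂ (∧⁻ {all checkExcluded ex} ok)
      ok₂ : T (all (hasLength 3) cs)
      ok₂ = proj₁ (∧⁻ ok₂₃)
      ok₃ : T (refuteF k 50 ts us)
      ok₃ = proj₂ (∧⁻ {all (hasLength 3) cs} ok₂₃)

      covered : ∀ {E} → E ∈ edges F → ∃[ c ] c ∈ cs × Bounded k c × image φ c ≡ E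
      covered E∈F =
        let c , c∈cs , c⊑E = find (cov E∈F)
            wf  = All.lookup wfs c∈cs
            len = ≡ᵇ⇒≡ (length c) 3 (All.lookup (All.all⁺ (hasLength 3) cs ok₂) c∈cs)
        in c , c∈cs , proj₁ wf ,
           ⊑⇒image≡ φ φ-inj wf c⊑E (≤-reflexive (trans (∣F∣ E∈F) (sym len)))

      F⊆K : ∀ {E} → E ∈ edges F → ∀ {v} → v ∈ˢ E → v ∈ˢ K
      F⊆K E∈F v∈E =
        let c , _ , c<k , c≡E = covered E∈F
        in image-mono φ c (upTo k) (∈-upTo⁺ ∘ All.lookup c<k) (subst (_ ∈ˢ_) (sym c≡E) v∈E)

      F-named : ∀ {E} → E ∈ edges F → ∃[ t ] t ∈ ts × Names F t × image φ (labels t) ≡ E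
      F-named {E} E∈F =
        let c , c∈cs , c<k , c≡E = covered E∈F
            t , t∈ , t<k , t≡E = named E (∣F∣ E∈F) (F⊆K E∈F)
            c⊆t : ∀ {i} → i ∈ c → i ∈ labels t
            c⊆t i∈c = let j , j∈t , φi≡φj = ∈-image⁻ φ (labels t)
                            (subst (_ ∈ˢ_) (trans c≡E (sym t≡E)) (∈-image⁺ φ i∈c))
                      in subst (_∈ labels t)
                           (sym (φ-inj (All.lookup c<k i∈c) (All.lookup t<k j∈t) φi≡φj)) j∈t
        in t , ∈-filter⁺ (T? ∘ λ t → any (_⊆ᵇ labels t) cs) t∈ (Any.any⁺ (_⊆ᵇ labels t) (lose c∈cs (⊆ᵇ⁺ c⊆t))) ,
           (t<k , subst (_∈ edges F) (sym t≡E) E∈F) , t≡E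

      G-named : ∀ {E} → E ∈ edges G → ∃[ t ] t ∈ us × Names G t × image φ (labels t) ≡ E
      G-named {E} E∈G =
        let t , t∈ , t<k , t≡E = named E (∣G∣ E∈G) (G⊆K F⊆K E∈G)
            t∈G = subst (_∈ edges G) (sym t≡E) E∈G
        in t , ∈-filter⁺ (T? ∘ (not ∘ excluded ex)) t∈ (not-T (¬excluded rs es∈G ex ok₁ t t∈G)) , (t<k , t∈G) , t≡E

      avoidable : Avoidable ts
      avoidable i j =
        -- The labels `i` and `j` are arbitrary, possibly equal or not below `k`; their images are
        -- still at most two vertices.
        let E , E∈F , avoids = F-avoids (image φ (i ∷ j ∷ [])) (s≤s (∣⟦⟧∣≤length (φ i ∷ φ j ∷ [])))
            t , t∈ , Ft , t≡E = F-named E∈F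
            out : ∀ {l} → l ∈ i ∷ j ∷ [] → l ∉ labels t
            out l∈ij l∈t = avoids (∈-image⁺ φ l∈ij) (subst (_ ∈ˢ_) t≡E (∈-image⁺ φ l∈t))
        in t , t∈ , Ft , out (here refl) , out (there (here refl))

  module _ {known : List State} (rs : All Refuted known) where

    checkReason-sound : ∀ {φ} k es ds r → Realises (k , es) φ →
                        All (WF k) ds → (∀ {E} → E ∈ edges F → Covered φ ds E) →
                        ¬ T (checkReason known (k , es) ds r)
    checkReason-sound {φ} k es ds (i via x) real _ _ ok =
      checkEmbedding-sound rs (k , es) i x ok φ real
    checkReason-sound {φ} k es ds closed (φ-inj , es∈G) wfs cov ok =
      Closed.closed-sound φ φ-inj rs es∈G [] ds wfs cov ok

    checkBranch-sound : ∀ es ps ρs → T (checkBranch known es (covers es) ps ρs) →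
                        ∀ {k e φ} → (k , e) ∈ ps → ¬ Realises (k , e ∷ es) φ
    -- Whether the pattern consumes a reason depends on its weight. The list of reasons left over is
    -- therefore part of the result, so that the induction over the patterns can go on with it.
    checkPattern-sound : ∀ es k e ps ρs →
      T (checkPattern known es (covers es) k e (live (e ∷ es) (covers (e ∷ es))) ps ρs) →
      ∃[ ρs′ ] T (checkBranch known es (covers es) ps ρs′) ×
        (All (Bounded k) (e ∷ es) → ∀ {φ} → ¬ Realises (k , e ∷ es) φ)

    checkBranch-sound es ((k , e) ∷ ps) ρs ok (here refl) real =
      proj₂ (proj₂ (checkPattern-sound es k e ps ρs (proj₂ (∧⁻ {bounded (k , e ∷ es)} ok))))
        (bounded⁻ k (e ∷ es) (proj₁ (∧⁻ {bounded (k , e ∷ es)} ok))) real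
    checkBranch-sound es ((k , e) ∷ ps) ρs ok (there ∈ps) real =
      let ρs′ , ok′ , _ = checkPattern-sound es k e ps ρs (proj₂ (∧⁻ {bounded (k , e ∷ es)} ok))
      in checkBranch-sound es ps ρs′ ok′ ∈ps real

    checkPattern-sound es k e ps ρs ok
      with enough (weight (live (e ∷ es) (covers (e ∷ es)))) in enough≡
    ... | false = ρs , ok , λ es<k {φ} (φ-inj , es∈G) →
      let wfs = covers-WF φ φ-inj (e ∷ es) es<k in
      subst T enough≡ (enough⁺ (≤-trans d≤ (weight-bound φ-inj _ (live-WF φ φ-inj (e ∷ es) wfs)
        λ E∈F → live-covered φ φ-inj (e ∷ es) es∈G wfs E∈F
                  (covers-covered φ φ-inj (e ∷ es) es<k es∈G E∈F))))
    ... | true with ρs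
    ...   | r ∷ ρs′ = ρs′ , proj₂ (∧⁻ {checkReason known (k , e ∷ es) ds r} ok) ,
      λ es<k {φ} real@(φ-inj , es∈G) →
        let wfs = covers-WF φ φ-inj (e ∷ es) es<k in
        checkReason-sound k (e ∷ es) ds r real (live-WF φ φ-inj (e ∷ es) wfs)
          (λ E∈F → live-covered φ φ-inj (e ∷ es) es∈G wfs E∈F
                     (covers-covered φ φ-inj (e ∷ es) es<k es∈G E∈F))
          (proj₁ (∧⁻ {checkReason known (k , e ∷ es) ds r} ok))
      where ds = live (e ∷ es) (covers (e ∷ es))

    checkMethod-sound : ∀ k es μ → T (checkMethod known (k , es) μ) → Refuted (k , es)
    checkMethod-sound k es (close ex) ok φ (φ-inj , es∈G) =
      let es<k = bounded⁻ k es (proj₁ (∧⁻ {bounded (k , es)} ok))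
          wfs  = covers-WF φ φ-inj es es<k
      in Closed.closed-sound φ φ-inj rs es∈G ex (live es (covers es)) (live-WF φ φ-inj es wfs)
           (λ E∈F → live-covered φ φ-inj es es∈G wfs E∈F (covers-covered φ φ-inj es es<k es∈G E∈F))
           (proj₂ (∧⁻ {bounded (k , es)} ok))
    checkMethod-sound k es (branch p ρs) ok φ (φ-inj , es∈G) =
      let es<k = bounded⁻ k es (proj₁ (∧⁻ {bounded (k , es)} ok))
          -- The images of two labels cannot cover `G`. The edge that avoids them follows one of the
          -- patterns, all of which the branch has refuted.
          E , E∈G , avoids = G-avoids (image φ (digits 2 p)) (s≤s (∣⟦⟧∣≤length (map φ (digits 2 p))))
          k′ , e , φ′ , ke∈ , φ′-inj , e≡E , old = extend φ φ-inj (digits 2 p) E (∣G∣ E∈G) avoids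
          old-edge : ∀ {e} → Bounded k e → image φ e ∈ edges G → image φ′ e ∈ edges G
          old-edge e<k = subst (_∈ edges G) (cong ⟦_⟧ (sym (map-cong-local (All.map (λ {i} → old i) e<k))))
      in checkBranch-sound es (patterns k (digits 2 p)) ρs (proj₂ (∧⁻ {bounded (k , es)} ok)) ke∈
           (φ′-inj , subst (_∈ edges G) (sym e≡E) E∈G ∷
             All.map (λ (e<k , e∈G) → old-edge e<k e∈G) (All.zip (es<k , es∈G)))

  checkAll-sound : ∀ {known} → All Refuted known → ∀ ls → T (checkAll known ls) →
                   All Refuted (known ++ map state ls)
  checkAll-sound {known} rs []                  _  = subst (All Refuted) (sym (++-identityʳ known)) rs
  checkAll-sound {known} rs (ℓ@(k , es , μ) ∷ ls) ok =
    subst (All Refuted) (++-assoc known _ _)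
      (checkAll-sound
        (All.++⁺ rs (checkMethod-sound rs k (map (digits 3) es) μ
          (proj₁ (∧⁻ {checkMethod known (state ℓ) μ} ok)) ∷ []))
        ls (proj₂ (∧⁻ {checkMethod known (state ℓ) μ} ok)))

  module _ {E₁ E₂} (E₁∈G : E₁ ∈ edges G) (E₂∈G : E₂ ∈ edges G) (E₁∩E₂ : Empty (E₁ ∩ E₂)) where

    realises-twoDisjointEdges : ∃[ φ ] Realises twoDisjointEdges φ
    realises-twoDisjointEdges =
      -- A labelling is total even when no label is in use, so some vertex is needed to start from;
      -- a common vertex of `E₁` and a member of `F` serves as the constant value.
      let F₁ , F₁∈F , _ = F-avoids ⟦ [] ⟧ (s≤s (≤-trans (∣⟦⟧∣≤length {N} []) z≤n))
          v , _ = cross F₁∈F E₁∈G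
      in second (extend (const v) (λ ()) [] E₁ (∣G∣ E₁∈G) λ v∈ → contradiction (∈⟦⟧⁻ [] v∈) λ ())
      where
      Extension : ℕ → (ℕ → Fin N) → Labels → Subset N → Set
      Extension k φ p E =
        ∃[ k′ ] ∃[ e ] ∃[ φ′ ] (k′ , e) ∈ patterns k p × InjectiveBelow k′ φ′ ×
          image φ′ e ≡ E × (∀ i → i < k → φ′ i ≡ φ i)

      third : ∀ {φ} → image φ (0 ∷ 1 ∷ 2 ∷ []) ≡ E₁ →
              Extension 3 φ (0 ∷ 1 ∷ 2 ∷ []) E₂ → ∃[ φ ] Realises twoDisjointEdges φ
      -- All three old labels are excluded, so `patterns` has a single entry and `here refl`
      -- identifies the new edge as `3 ∷ 4 ∷ 5 ∷ []`.
      third {φ} φ≡E₁ (_ , _ , φ′ , here refl , φ′-inj , φ′≡E₂ , old) =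
        φ′ , φ′-inj , subst (_∈ edges G) (sym φ′≡E₂) E₂∈G ∷
          subst (_∈ edges G) (trans (sym φ≡E₁) (cong ⟦_⟧ (sym (map-cong-local {f = φ′} {φ}
            (old 0 z<s ∷ old 1 (s<s z<s) ∷ old 2 (s<s (s<s z<s)) ∷ []))))) E₁∈G ∷ []

      second : ∀ {φ} → Extension 0 φ [] E₁ → ∃[ φ ] Realises twoDisjointEdges φ
      second (_ , _ , φ , here refl , φ-inj , φ≡E₁ , _) =
        third φ≡E₁ (extend φ φ-inj (0 ∷ 1 ∷ 2 ∷ []) E₂ (∣G∣ E₂∈G)
          λ {v} v∈ v∈E₂ → E₁∩E₂ (v , x∈p∩q⁺ (subst (v ∈ˢ_) φ≡E₁ v∈ , v∈E₂)))

  -- The certificate is a variable here: the concrete one is evaluated only for the two closed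
  -- equations with `true`, apart from any graph.
  no-disjoint-edges : ∀ ls i x → checkAll [] ls ≡ true →
    checkEmbedding (map state ls) twoDisjointEdges i x ≡ true →
    ∀ {E₁ E₂} → E₁ ∈ edges G → E₂ ∈ edges G → ¬ Empty (E₁ ∩ E₂)
  no-disjoint-edges ls i x ok ok′ E₁∈G E₂∈G E₁∩E₂ =
    let φ , φ-realises = realises-twoDisjointEdges E₁∈G E₂∈G E₁∩E₂
    in checkEmbedding-sound (checkAll-sound [] ls (Equivalence.from T-≡ ok)) twoDisjointEdges i x
         (Equivalence.from T-≡ ok′) φ φ-realises

-- Graphs attaining the maximum

-- Disjointness makes the concatenated vertex lists of the edges of `M` free of repetitions. This
-- bounds `ν` from above in the examples by the size of their ground set.
matching-bound : ∀ (G : 3-Graph N) {M} → IsMatching G M → length M * 3 ≤ N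
matching-bound {N} G {M} (M⊆G , M-disjoint) = subst₂ _≤_ (len M M⊆G) (length-tabulate id)
  (unique-⊆⇒length≤
    (Unique.concat⁺ (All.map⁺ (All.universal members-unique M))
      (AllPairs.map⁺ (AllPairs.map (λ {E} {F} → disjoint {E} {F}) M-disjoint)))
    (λ {v} _ → ∈-allFin v))
  where
  disjoint : ∀ {E F} → Empty (E ∩ F) → Disjoint (members E) (members F)
  disjoint {E} {F} E∩F (v∈E , v∈F) =
    E∩F (_ , x∈p∩q⁺ (∈-members⁻ E v∈E , ∈-members⁻ F v∈F))
  len : ∀ M → All (_∈ edges G) M → length (concat (map members M)) ≡ length M * 3
  len []      []           = refl
  len (E ∷ M) (E∈G ∷ M⊆G) = trans (length-++ (members E))
    (cong₂ _+_ (trans (length-members E) (All.lookup (uniform G) E∈G)) (len M M⊆G))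

covering? : (Es : List (Subset N)) → Decidable (λ T → All (λ E → Nonempty (T ∩ E)) Es)
covering? Es T = all? (λ E → nonempty? (T ∩ E)) Es

-- Minimality quantifies over all numbers and sets; going through `subsets N` makes it a finite
-- check. The cardinality comes first in the disjunction, so only sets with at most two vertices
-- have to be tested as covers.
τ≡3? : (Es : List (Subset N)) →
       Dec (Any (λ T → All (λ E → Nonempty (T ∩ E)) Es × ∣ T ∣ ≡ 3) (subsets N) ×
            All (λ T → 3 ≤ ∣ T ∣ ⊎ ¬ All (λ E → Nonempty (T ∩ E)) Es) (subsets N))
τ≡3? {N} Es =
  any? (λ T → covering? Es T ×-dec (∣ T ∣ ≟ 3)) (subsets N)
  ×-dec all? (λ T → (3 ≤? ∣ T ∣) ⊎-dec ¬? (covering? Es T)) (subsets N)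

τ≡3 : (G : 3-Graph N) → True (τ≡3? (edges G)) → HasCoveringNumber G 3
τ≡3 {N} G ok =
  let some , none = toWitness ok
      T , _ , cover = find some
  in (T , cover) , λ { k (T , cover , refl) →
       [ id , contradiction cover ]′ (All.lookup none (∈-subsets T)) }

valid? : (Es : List (Subset N)) → Dec (Unique Es × All (λ E → ∣ E ∣ ≡ 3) Es)
valid? Es = allPairs? (λ E F → ¬? (≡-dec Bool._≟_ E F)) Es ×-dec all? (λ E → ∣ E ∣ ≟ 3) Es

matching? : ∀ Es (M : List (Subset N)) →
            Dec (All (_∈ Es) M × AllPairs (λ E F → Empty (E ∩ F)) M)
matching? Es M = all? (_∈ᴸ? Es) M ×-dec allPairs? (λ E F → ¬? (nonempty? (E ∩ F))) M

edgeSets : ∀ N → List ℕ → List (Subset N)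
edgeSets N = map (λ e → Vec.tabulate λ i → toℕ i ∈ᵇ digits 3 e)

-- All conditions on an example are decided by evaluation except `ν ≤ n`, which follows from
-- `N < 3 (n + 1)`. This is why the examples live on 8 vertices for `n = 2` and on 9 for `n = 3`.
attains : ∀ b n N es (let Es = edgeSets N es) {valid : True (valid? Es)} →
          let G = record { edges = Es ; unique = proj₁ (toWitness valid) ; uniform = proj₂ (toWitness valid) } in
          {_ : True (size G ≟ b)} {_ : True (length (take n Es) ≟ n)} {_ : True (N <? suc n * 3)}
          {_ : True (matching? Es (take n Es))}
          {_ : True (τ≡3? Es)} {_ : True (τ≡3? (edges (B G)))} {_ : True (size (B G) ≟ m b)} →
          IsBlockerSize b n (m b)
attains b n N es {valid} {|G|} {|M|} {N<} {matching} {τG} {τB} {|B|} =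
  N , G , toWitness |G| ,
  ((take n Es , toWitness matching , toWitness |M|) ,
   -- From `length M * 3 ≤ N < suc n * 3` the factor 3 is cancelled.
   λ { k (M , isMatching , refl) → s≤s⁻¹ (*-cancelʳ-< 3 (length M) (suc n)
         (≤-<-trans (matching-bound G isMatching) (toWitness N<))) }) ,
  τ≡3 G τG , τ≡3 (B G) τB , toWitness |B|
  where
  Es = edgeSets N es
  G : 3-Graph N
  G = record { edges = Es ; unique = proj₁ (toWitness valid) ; uniform = proj₂ (toWitness valid) }

-- The first n edges of each example form a matching.
examples₂ : All (λ b → IsBlockerSize b 2 (m b)) (4 ∷ 5 ∷ 6 ∷ 7 ∷ 8 ∷ 9 ∷ 10 ∷ 11 ∷ [])
examples₂ =
  attains 4 2 8 (0x210 ∷ 0x543 ∷ 0x610 ∷ 0x762 ∷ []) ∷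
  attains 5 2 8 (0x210 ∷ 0x543 ∷ 0x610 ∷ 0x762 ∷ 0x310 ∷ []) ∷
  attains 6 2 8 (0x210 ∷ 0x543 ∷ 0x310 ∷ 0x762 ∷ 0x430 ∷ 0x610 ∷ []) ∷
  attains 7 2 8 (0x210 ∷ 0x543 ∷ 0x310 ∷ 0x430 ∷ 0x652 ∷ 0x610 ∷ 0x432 ∷ []) ∷
  attains 8 2 8 (0x210 ∷ 0x543 ∷ 0x610 ∷ 0x720 ∷ 0x760 ∷ 0x310 ∷ 0x730 ∷ 0x621 ∷ []) ∷
  attains 9 2 8 (0x210 ∷ 0x543 ∷ 0x610 ∷ 0x720 ∷ 0x760 ∷ 0x430 ∷ 0x310 ∷ 0x730 ∷ 0x621 ∷ []) ∷
  attains 10 2 8 (0x210 ∷ 0x543 ∷ 0x310 ∷ 0x430 ∷ 0x421 ∷ 0x610 ∷ 0x521 ∷ 0x432 ∷ 0x530 ∷ 0x542 ∷ []) ∷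
  attains 11 2 8 (0x210 ∷ 0x543 ∷ 0x310 ∷ 0x620 ∷ 0x430 ∷ 0x610 ∷ 0x531 ∷ 0x420 ∷ 0x521 ∷ 0x542 ∷ 0x621 ∷ []) ∷ []

examples₃ : All (λ b → IsBlockerSize b 3 (m b)) (4 ∷ 5 ∷ 6 ∷ 7 ∷ 8 ∷ 9 ∷ 10 ∷ 11 ∷ [])
examples₃ =
  attains 4 3 9 (0x210 ∷ 0x543 ∷ 0x876 ∷ 0x310 ∷ []) ∷
  attains 5 3 9 (0x210 ∷ 0x543 ∷ 0x876 ∷ 0x310 ∷ 0x610 ∷ []) ∷
  attains 6 3 9 (0x210 ∷ 0x543 ∷ 0x876 ∷ 0x310 ∷ 0x430 ∷ 0x610 ∷ []) ∷
  attains 7 3 9 (0x210 ∷ 0x543 ∷ 0x876 ∷ 0x310 ∷ 0x760 ∷ 0x430 ∷ 0x610 ∷ []) ∷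
  attains 8 3 9 (0x210 ∷ 0x543 ∷ 0x876 ∷ 0x310 ∷ 0x420 ∷ 0x760 ∷ 0x430 ∷ 0x610 ∷ []) ∷
  attains 9 3 9 (0x210 ∷ 0x543 ∷ 0x876 ∷ 0x310 ∷ 0x430 ∷ 0x610 ∷ 0x720 ∷ 0x420 ∷ 0x760 ∷ []) ∷
  attains 10 3 9 (0x210 ∷ 0x543 ∷ 0x876 ∷ 0x310 ∷ 0x610 ∷ 0x730 ∷ 0x430 ∷ 0x760 ∷ 0x420 ∷ 0x720 ∷ []) ∷
  attains 11 3 9 (0x210 ∷ 0x543 ∷ 0x876 ∷ 0x310 ∷ 0x610 ∷ 0x730 ∷ 0x430 ∷ 0x760 ∷ 0x640 ∷ 0x420 ∷ 0x720 ∷ []) ∷ []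

-- The upper bound and the theorem

lemmas-checked : checkAll [] lemmas ≡ true
lemmas-checked = refl

-- Entry 216 is the last of `lemmas` and is this very state; `0x543210` is the identity on its six
-- labels.
twoDisjointEdges-checked : checkEmbedding (map state lemmas) twoDisjointEdges 216 0x543210 ≡ true
twoDisjointEdges-checked = refl

4≤b≤11⇒b∈ : ∀ {b} → 4 ≤ b → b ≤ 11 → b ∈ 4 ∷ 5 ∷ 6 ∷ 7 ∷ 8 ∷ 9 ∷ 10 ∷ 11 ∷ []
4≤b≤11⇒b∈ {b} 4≤b b≤11 =
  subst (_∈ applyUpTo (4 +_) 8) (m+[n∸m]≡n 4≤b)
    (∈-applyUpTo⁺ (4 +_) (s≤s (∸-monoˡ-≤ 4 b≤11)))

-- By minimality `S` is not a cover; meeting an edge is decidable and the edges are finitely many,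
-- so a missed edge can be exhibited.
τ≡3⇒avoids : (G : 3-Graph N) → HasCoveringNumber G 3 →
             ∀ S → ∣ S ∣ < 3 → ∃[ E ] E ∈ edges G × (∀ {v} → v ∈ˢ S → v ∉ˢ E)
τ≡3⇒avoids G (_ , τ≥3) S ∣S∣<3 =
  let E , E∈G , S∩E = find (All.¬All⇒Any¬ (λ E → nonempty? (S ∩ E)) (edges G)
        λ cover → <⇒≱ ∣S∣<3 (τ≥3 ∣ S ∣ (S , cover , refl)))
  in E , E∈G , λ v∈S v∈E → S∩E (_ , x∈p∩q⁺ (v∈S , v∈E))

-- A maximum matching with `n ≥ 2` edges supplies two disjoint edges of `G`, which is the
-- configuration refuted by the certificate; the same refutation thus serves `n = 2` and `n = 3`.
blocker-size-≤ : ∀ {b n k} → 4 ≤ b → b ≤ 11 → 2 ≤ n → IsBlockerSize b n k → k ≤ m b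
blocker-size-≤ _ _ (s≤s (s≤s _)) (_ , _ , _ , (([] , _ , ()) , _) , _)
blocker-size-≤ _ _ (s≤s (s≤s _)) (_ , _ , _ , ((_ ∷ [] , _ , ()) , _) , _)
blocker-size-≤ {b} 4≤b b≤11 _
  (_ , G , refl , ((_ ∷ _ ∷ _ , (E₁∈G ∷ E₂∈G ∷ _ , (E₁∩E₂ ∷ _) ∷ _) , _) , _) , τG , τB , refl) =
  -- The assumption `m b < k` unfolds to `suc (m b) ≤ size (B G)`, which is exactly the demand
  -- belonging to `b`; the bound on `G` holds with equality.
  ≮⇒≥ λ m<k → Refutation.no-disjoint-edges G (B G) cross
    (λ {E} E∈B → proj₂ (Equivalence.to (∈-B G E) E∈B))
    (τ≡3⇒avoids G τG) (τ≡3⇒avoids (B G) τB)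
    (∈-map⁺ (λ b → b , suc (m b)) (4≤b≤11⇒b∈ 4≤b b≤11)) ≤-refl m<k
    lemmas 216 0x543210 lemmas-checked twoDisjointEdges-checked E₁∈G E₂∈G E₁∩E₂
  where
  cross : ∀ {T E} → T ∈ edges (B G) → E ∈ edges G → ∃[ v ] v ∈ˢ T × v ∈ˢ E
  cross {T} {E} T∈B E∈G =
    let v , v∈ = All.lookup (proj₂ (proj₂ (proj₁ (Equivalence.to (∈-B G T) T∈B)))) E∈G
    in v , x∈p∩q⁻ T E v∈

mainTheorem2 : (b n : ℕ) → 4 ≤ b → b ≤ 11 → 2 ≤ n → n ≤ 3 →
    IsMaximum (IsBlockerSize b n) (m b)
mainTheorem2 b n 4≤b b≤11 2≤n n≤3 =
  attained n 2≤n n≤3 , λ k → blocker-size-≤ 4≤b b≤11 2≤n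
  where
  attained : ∀ n → 2 ≤ n → n ≤ 3 → IsBlockerSize b n (m b)
  attained 0 () _
  attained 1 (s≤s ()) _
  attained 2 _ _ = All.lookup examples₂ (4≤b≤11⇒b∈ 4≤b b≤11)
  attained 3 _ _ = All.lookup examples₃ (4≤b≤11⇒b∈ 4≤b b≤11)
  attained (suc (suc (suc (suc _)))) _ (s≤s (s≤s (s≤s ())))
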